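{- Let $\{\tau_j\}_{j\ge1}$ be a sequence of permutations with $|\tau_j|\to\infty$ such that $t(\pi,\tau_j)\to 1/4!$ as $j\to\infty$ for every $\pi\in S_4$. Then for every positive integer $k$ and every $\pi\in S_k$ we have $t(\pi,\tau_j)\to 1/k!$ as $j\to\infty$.
   Context: For a positive integer $k$, $S_k$ denotes the set of permutations of $[k]=\{1,\dots,k\}$, viewed as bijections $[k]\to[k]$; the length of $\pi\in S_k$ is $|\pi|=k$. For $\pi\in S_k$ and $\tau\in S_m$ with $k\le m$, $t(\pi,\tau)$ is the probability that a uniformly random $k$-element subset $X=\{x_1<\dots<x_k\}$ of $[m]$ satisfies: for all $i,j\in[k]$, $\tau(x_i)\le\tau(x_j)$ if and only if $\pi(i)\le\pi(j)$ (i.e. $\tau$ restricted to $X$ is order-isomorphic to $\pi$). For $k>m$ the quantity is not needed since $|\tau_j|\to\infty$. -}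

module Defs where

open import Data.Nat using (ℕ; zero; suc; _!; _≥_)
open import Data.Nat.Properties using (_!≢0)
open import Data.Nat.Combinatorics using (_C_)
open import Data.Fin using (Fin; zero; suc; _≤?_)
open import Data.Fin.Permutation using (Permutation′; _⟨$⟩ʳ_)
open import Data.Vec using (Vec; []; _∷_; lookup)
import Data.Vec as Vec
open import Data.List using (List; []; _∷_; _++_; map; filterᵇ; length; allFin)
open import Data.Bool.ListAction using (and)
open import Data.Bool using (Bool; not; _xor_)
open import Relation.Nullary.Decidable using (⌊_⌋)
open import Data.Product using (Σ; ∃-syntax; _×_; proj₁; proj₂)
open import Data.Integer using (+_)
open import Data.Rational using (ℚ; 0ℚ; _/_; _-_; ∣_∣; _<_)

Perm : ℕ → Set
Perm k = Permutation′ k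

-- All k-element subsets of [m], each listed as its strictly increasing
-- sequence of elements x₁ < … < x_k (each subset occurs exactly once).
subsets : (k m : ℕ) → List (Vec (Fin m) k)
subsets zero    m       = [] ∷ []
subsets (suc k) zero    = []
subsets (suc k) (suc m) =
  map (λ v → zero ∷ Vec.map suc v) (subsets k m)
  ++ map (Vec.map suc) (subsets (suc k) m)

allᵇ : {A : Set} → (A → Bool) → List A → Bool
allᵇ p xs = and (map p xs)

_==_ : Bool → Bool → Bool
a == b = not (a xor b)

orderIso : ∀ {k m} → Perm k → Perm m → Vec (Fin m) k → Bool
orderIso {k} π τ x =
  allᵇ (λ i → allᵇ (λ j →
        ⌊ (τ ⟨$⟩ʳ lookup x i) ≤? (τ ⟨$⟩ʳ lookup x j) ⌋
     == ⌊ (π ⟨$⟩ʳ i) ≤? (π ⟨$⟩ʳ j) ⌋) (allFin k)) (allFin k)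

occurrences : ∀ {k m} → Perm k → Perm m → ℕ
occurrences {k} {m} π τ = length (filterᵇ (orderIso π τ) (subsets k m))

-- Density t(π, τ) = occurrences / (m choose k).
-- (When k > m the binomial is 0; the value 0 is a dummy, never used.)
t : ∀ {k m} → Perm k → Perm m → ℚ
t {k} {m} π τ with m C k
... | zero  = 0ℚ
... | suc c = + occurrences π τ / suc c

inv! : ℕ → ℚ
inv! k = (+ 1 / (k !)) {{k !≢0}}

PermSeq : Set
PermSeq = ℕ → Σ ℕ Perm

len : PermSeq → ℕ → ℕ
len τ j = proj₁ (τ j)

LengthsDiverge : PermSeq → Set
LengthsDiverge τ = ∀ (M : ℕ) → ∃[ N ] ∀ j → j ≥ N → len τ j ≥ M

DensityTendsTo : ∀ {k} → Perm k → PermSeq → ℚ → Set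
DensityTendsTo π τ L =
  ∀ (ε : ℚ) → 0ℚ < ε → ∃[ N ] ∀ j → j ≥ N → ∣ t π (proj₂ (τ j)) - L ∣ < ε

{-# OPTIONS --safe #-}
-- For τ of length n put F(i,j) = #{a < i : τ(a) < j} and D(i,j) = n F(i,j) − i j.  In
--   2 Σ_{i,j} D(i,j)² + n Σ_i D(i,τ(i))²
-- the only moment not determined by 4-point densities, Σ_a a² τ(a)², occurs in the cross term
-- Σ_{i,j} F(i,j) i j of the first sum and in the second sum, and cancels.  What remains is a count of
-- 4-tuples, so almost uniform 4-point densities make the whole expression o(n⁶).  Since D is
-- Lipschitz, |D| = o(n²) uniformly on the grid.
--
-- Given uniformly small D, compare n^k · occurrences(π, τ), an integral over k points of the graph
-- of τ, with C(n,k)², the same integral over k points of the full grid [n]².  Exchanging one point at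
-- a time costs o(n²) each, because the condition on a single point confines it to a rectangle and the
-- discrepancy of a rectangle is a combination of four values of D.
module Submission where

open import Defs
open import Data.Nat using (ℕ; _≥_)
open import Data.Nat as ℕ using (zero; suc; _!; NonZero; _⊔_)
import Data.Nat.Properties as ℕ
open import Data.Nat.Combinatorics using (_C_; nCk+nC[k+1]≡[n+1]C[k+1])
open import Data.Nat.Coprimality using (Coprime)
open import Data.Nat.DivMod using (_/_; m/n*n≤m; m≡m%n+[m/n]*n; m%n<n; m≥n⇒m/n>0)
open import Data.Integer using (ℤ; +_; _+_; _*_; _-_; -_; _≤_; _^_; 0ℤ; 1ℤ; +≤+)
import Data.Integer as ℤ
import Data.Integer.Properties as ℤ
open import Data.Integer.Tactic.RingSolver using (solve-∀)
import Data.Rational as ℚ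
import Data.Rational.Properties as ℚ
import Data.Rational.Unnormalised as ℚᵘ
import Data.Rational.Unnormalised.Properties as ℚᵘ
open import Data.Rational using (mkℚ)
open import Data.Rational.Unnormalised using (mkℚᵘ)
open import Algebra.Properties.Semiring.Sum ℤ.+-*-semiring using (sum; sum-cong-≗; ∑-distrib-+; ∑-comm; sum-permute; *-distribˡ-sum)
open import Data.Fin as Fin using (Fin; zero; suc; toℕ; punchIn)
open import Data.Fin.Patterns using (0F; 1F; 2F; 3F)
import Data.Fin.Properties as Fin
open import Data.Fin.Permutation as Perm using (_⟨$⟩ʳ_; _⟨$⟩ˡ_)
open import Data.Vec as Vec using (Vec; []; _∷_; lookup; tabulate; insertAt; _[_]≔_)
import Data.Vec.Properties as Vec
open import Data.List as List using (List; []; _∷_; _++_; filterᵇ; length; allFin)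
import Data.List.Properties as List
open import Data.Bool using (Bool; true; false; if_then_else_; _∧_; not)
open import Data.Bool.Properties using (T-≡)
open import Data.Product using (∃-syntax; _×_; _,_; proj₁; proj₂)
open import Data.Sum using (_⊎_; inj₁; inj₂)
open import Function using (_∘_; id)
open import Function.Bundles using (Equivalence)
open import Function.Definitions using (Injective)
open import Relation.Nullary using (¬_; Dec; yes; no; contradiction)
open import Relation.Nullary.Decidable using (⌊_⌋)
open import Relation.Binary.PropositionalEquality using (_≡_; refl; sym; trans; cong; cong₂; subst; subst₂; module ≡-Reasoning)

-- Integer inequalities

-- Which terms are 4-point counts is a matter of counting free points. A row `j` of the grid costs
-- one point `c` with `τ(c) = j`, and each factor `i` or `j` costs one further point. So `F(i,j)²`
-- on the grid uses `i`, `c` and the two points counted by `F`, and `F(i,τ(i)) i τ(i)` on the graph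
-- uses `i` and three more; but `F(i,j) i j` on the grid and `i² τ(i)²` on the graph need five.
-- Summed over the grid, the former becomes a sum over `a` of a quadratic in `a` times a quadratic
-- in `τ(a)`, and four times it contains Σ a² τ(a)² exactly once. This forces the ratio 2 : n
-- between the two energies. Both energies are sums of squares, so an upper bound for the 4-tuple
-- count suffices, and with a nonnegative kernel only upper bounds for the 4-point densities enter.
-- All limits are replaced by integer inequalities: `1/q` is the accuracy wanted, `K` is a multiple
-- of `k k! q`, windows have side `L = n / K`, and `1/E` is the tolerance on S₄. A window has energy
-- about `n⁶/K⁴`, which has to beat `41 n⁶/E`, whence `E` of order `K⁴`.

nonneg-* : ∀ {a b} → 0ℤ ≤ a → 0ℤ ≤ b → 0ℤ ≤ a * b
nonneg-* {+ m} {+ n} _ _ = subst (0ℤ ≤_) (ℤ.pos-* m n) (+≤+ ℕ.z≤n)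

nonneg-+ : ∀ {a b} → 0ℤ ≤ a → 0ℤ ≤ b → 0ℤ ≤ a + b
nonneg-+ = ℤ.+-mono-≤

nonneg-pos : ∀ {n} → 0ℤ ≤ + n
nonneg-pos = +≤+ ℕ.z≤n

nonneg-square : ∀ a → 0ℤ ≤ a * a
nonneg-square (+ n)       = nonneg-* {+ n} {+ n} nonneg-pos nonneg-pos
nonneg-square ℤ.-[1+ n ] = nonneg-pos

gap : ∀ {a b} → a ≤ b → 0ℤ ≤ b - a
gap = ℤ.i≤j⇒0≤j-i

≤-by-gap : ∀ {a b c} → b - a ≡ c → 0ℤ ≤ c → a ≤ b
≤-by-gap eq 0≤c = ℤ.0≤i-j⇒j≤i (subst (0ℤ ≤_) (sym eq) 0≤c)

*-monoˡ : ∀ {a b c} → 0ℤ ≤ c → a ≤ b → c * a ≤ c * b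
*-monoˡ {a} {b} {c} 0≤c a≤b = ≤-by-gap (lem a b c) (nonneg-* 0≤c (gap a≤b))
  where
  lem : ∀ a b c → c * b - c * a ≡ c * (b - a)
  lem = solve-∀

*-mono : ∀ {a b c d} → 0ℤ ≤ a → 0ℤ ≤ c → a ≤ b → c ≤ d → a * c ≤ b * d
*-mono {a} {b} {c} {d} 0≤a 0≤c a≤b c≤d =
  ≤-by-gap (lem a b c d)
    (nonneg-+ (nonneg-* (ℤ.≤-trans 0≤a a≤b) (gap c≤d)) (nonneg-* 0≤c (gap a≤b)))
  where
  lem : ∀ a b c d → b * d - a * c ≡ b * (d - c) + c * (b - a)
  lem = solve-∀

-- Finite sums

sum-mono : ∀ {n} {f g : Fin n → ℤ} → (∀ i → f i ≤ g i) → sum f ≤ sum g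
sum-mono {zero}  f≤g = ℤ.≤-refl
sum-mono {suc n} f≤g = ℤ.+-mono-≤ (f≤g zero) (sum-mono (f≤g ∘ suc))

sum-zero : ∀ n → sum {n} (λ _ → 0ℤ) ≡ 0ℤ
sum-zero zero    = refl
sum-zero (suc n) = trans (ℤ.+-identityˡ _) (sum-zero n)

sum-nonneg : ∀ {n} {f : Fin n → ℤ} → (∀ i → 0ℤ ≤ f i) → 0ℤ ≤ sum f
sum-nonneg {zero}  0≤f = ℤ.≤-refl
sum-nonneg {suc n} 0≤f = nonneg-+ (0≤f zero) (sum-nonneg (0≤f ∘ suc))

sum-const : ∀ n c → sum {n} (λ _ → c) ≡ + n * c
sum-const zero    c = refl
sum-const (suc n) c = trans (cong (λ s → c + s) (sum-const n c)) (lem c (+ n))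
  where
  lem : ∀ c m → c + m * c ≡ (1ℤ + m) * c
  lem = solve-∀

sum-*ˡ : ∀ {n} c (f : Fin n → ℤ) → sum (λ i → c * f i) ≡ c * sum f
sum-*ˡ c f = sym (*-distribˡ-sum c f)

sum-+ : ∀ {n} (f g : Fin n → ℤ) → sum (λ i → f i + g i) ≡ sum f + sum g
sum-+ = ∑-distrib-+

sum-product : ∀ {m n} (f : Fin m → ℤ) (g : Fin n → ℤ) →
              sum (λ i → sum (λ j → f i * g j)) ≡ sum f * sum g
sum-product f g = begin
  sum (λ i → sum (λ j → f i * g j)) ≡⟨ sum-cong-≗ (λ i → trans (sum-*ˡ (f i) g) (ℤ.*-comm (f i) _)) ⟩
  sum (λ i → sum g * f i)           ≡⟨ sum-*ˡ (sum g) f ⟩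
  sum g * sum f                     ≡⟨ ℤ.*-comm (sum g) (sum f) ⟩
  sum f * sum g                     ∎
  where open ≡-Reasoning

term≤sum : ∀ {n} {f : Fin n → ℤ} → (∀ i → 0ℤ ≤ f i) → ∀ i → f i ≤ sum f
term≤sum {suc n} {f} 0≤f zero =
  subst (_≤ sum f) (ℤ.+-identityʳ _) (ℤ.+-monoʳ-≤ (f zero) (sum-nonneg (0≤f ∘ suc)))
term≤sum {suc n} {f} 0≤f (suc i) =
  subst (_≤ sum f) (ℤ.+-identityˡ _) (ℤ.+-mono-≤ (0≤f zero) (term≤sum (0≤f ∘ suc) i))

-- Indicators

𝟙 : Bool → ℤ
𝟙 true  = 1ℤ
𝟙 false = 0ℤ

𝟙-nonneg : ∀ b → 0ℤ ≤ 𝟙 b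
𝟙-nonneg true  = nonneg-pos
𝟙-nonneg false = nonneg-pos

𝟙≤1 : ∀ b → 𝟙 b ≤ 1ℤ
𝟙≤1 true  = ℤ.≤-refl
𝟙≤1 false = nonneg-pos

bool-ext : ∀ {a b} → (a ≡ true → b ≡ true) → (b ≡ true → a ≡ true) → a ≡ b
bool-ext {true}  {b}     f g = sym (f refl)
bool-ext {false} {true}  f g = g refl
bool-ext {false} {false} f g = refl

δ : ∀ {n} → Fin n → Fin n → ℤ
δ i j = 𝟙 ⌊ i Fin.≟ j ⌋

δ-suc : ∀ {n} (i j : Fin n) → δ (suc i) (suc j) ≡ δ i j
δ-suc i j with i Fin.≟ j
... | yes _ = refl
... | no  _ = refl

sum-δ : ∀ {n} (i : Fin n) (f : Fin n → ℤ) → sum (λ j → δ i j * f j) ≡ f i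
sum-δ {suc n} zero f = begin
  1ℤ * f zero + sum (λ j → 0ℤ * f (suc j)) ≡⟨ cong₂ _+_ (ℤ.*-identityˡ (f zero)) (sum-zero n) ⟩
  f zero + 0ℤ                             ≡⟨ ℤ.+-identityʳ _ ⟩
  f zero                                  ∎
  where open ≡-Reasoning
sum-δ {suc n} (suc i) f = begin
  0ℤ + sum (λ j → δ (suc i) (suc j) * f (suc j)) ≡⟨ ℤ.+-identityˡ _ ⟩
  sum (λ j → δ (suc i) (suc j) * f (suc j))      ≡⟨ sum-cong-≗ (λ j → cong (_* f (suc j)) (δ-suc i j)) ⟩
  sum (λ j → δ i j * f (suc j))                  ≡⟨ sum-δ i (f ∘ suc) ⟩
  f (suc i)                                      ∎
  where open ≡-Reasoning

below : ∀ {n} → Fin n → ℕ → ℤ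
below x h = 𝟙 (toℕ x ℕ.<ᵇ h)

sum-below : ∀ {n} h → h ℕ.≤ n → sum {n} (λ x → below x h) ≡ + h
sum-below {n}     zero    _           = sum-zero n
sum-below {suc n} (suc h) (ℕ.s≤s h≤n) = cong (λ s → 1ℤ + s) (sum-below h h≤n)

-- Sums over tuples

∑ᵛ : ∀ {n} k → (Vec (Fin n) k → ℤ) → ℤ
∑ᵛ zero    f = f []
∑ᵛ (suc k) f = sum (λ x → ∑ᵛ k (λ xs → f (x ∷ xs)))

∑ᵛ-cong : ∀ {n} k {f g : Vec (Fin n) k → ℤ} → (∀ xs → f xs ≡ g xs) → ∑ᵛ k f ≡ ∑ᵛ k g
∑ᵛ-cong zero    f≗g = f≗g []
∑ᵛ-cong (suc k) f≗g = sum-cong-≗ (λ x → ∑ᵛ-cong k (λ xs → f≗g (x ∷ xs)))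

∑ᵛ-mono : ∀ {n} k {f g : Vec (Fin n) k → ℤ} → (∀ xs → f xs ≤ g xs) → ∑ᵛ k f ≤ ∑ᵛ k g
∑ᵛ-mono zero    f≤g = f≤g []
∑ᵛ-mono (suc k) f≤g = sum-mono (λ x → ∑ᵛ-mono k (λ xs → f≤g (x ∷ xs)))

∑ᵛ-nonneg : ∀ {n} k {f : Vec (Fin n) k → ℤ} → (∀ xs → 0ℤ ≤ f xs) → 0ℤ ≤ ∑ᵛ k f
∑ᵛ-nonneg zero    0≤f = 0≤f []
∑ᵛ-nonneg (suc k) 0≤f = sum-nonneg (λ x → ∑ᵛ-nonneg k (λ xs → 0≤f (x ∷ xs)))

∑ᵛ-+ : ∀ {n} k (f g : Vec (Fin n) k → ℤ) → ∑ᵛ k (λ xs → f xs + g xs) ≡ ∑ᵛ k f + ∑ᵛ k g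
∑ᵛ-+ zero    f g = refl
∑ᵛ-+ (suc k) f g =
  trans (sum-cong-≗ (λ x → ∑ᵛ-+ k (λ xs → f (x ∷ xs)) (λ xs → g (x ∷ xs))))
        (sum-+ (λ x → ∑ᵛ k (λ xs → f (x ∷ xs))) (λ x → ∑ᵛ k (λ xs → g (x ∷ xs))))

∑ᵛ-*ˡ : ∀ {n} k c (f : Vec (Fin n) k → ℤ) → ∑ᵛ k (λ xs → c * f xs) ≡ c * ∑ᵛ k f
∑ᵛ-*ˡ zero    c f = refl
∑ᵛ-*ˡ (suc k) c f =
  trans (sum-cong-≗ (λ x → ∑ᵛ-*ˡ k c (λ xs → f (x ∷ xs))))
        (sum-*ˡ c (λ x → ∑ᵛ k (λ xs → f (x ∷ xs))))

∑ᵛ-*ʳ : ∀ {n} k c (f : Vec (Fin n) k → ℤ) → ∑ᵛ k (λ xs → f xs * c) ≡ ∑ᵛ k f * c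
∑ᵛ-*ʳ k c f = begin
  ∑ᵛ k (λ xs → f xs * c) ≡⟨ ∑ᵛ-cong k (λ xs → ℤ.*-comm (f xs) c) ⟩
  ∑ᵛ k (λ xs → c * f xs) ≡⟨ ∑ᵛ-*ˡ k c f ⟩
  c * ∑ᵛ k f             ≡⟨ ℤ.*-comm c _ ⟩
  ∑ᵛ k f * c             ∎
  where open ≡-Reasoning

∑ᵛ-const : ∀ {n} k c → ∑ᵛ {n} k (λ _ → c) ≡ (+ n) ^ k * c
∑ᵛ-const {n} zero    c = sym (ℤ.*-identityˡ c)
∑ᵛ-const {n} (suc k) c =
  trans (sum-cong-≗ {n} (λ _ → ∑ᵛ-const {n} k c))
        (trans (sum-const n ((+ n) ^ k * c)) (sym (ℤ.*-assoc (+ n) ((+ n) ^ k) c)))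

∑ᵛ-sum-comm : ∀ {m n} k (f : Fin m → Vec (Fin n) k → ℤ) →
              sum (λ i → ∑ᵛ k (f i)) ≡ ∑ᵛ k (λ xs → sum (λ i → f i xs))
∑ᵛ-sum-comm zero    f = refl
∑ᵛ-sum-comm (suc k) f =
  trans (∑-comm (λ i x → ∑ᵛ k (λ xs → f i (x ∷ xs))))
        (sum-cong-≗ (λ x → ∑ᵛ-sum-comm k (λ i xs → f i (x ∷ xs))))

∑ᵛ-comm : ∀ {m n} k l (f : Vec (Fin m) k → Vec (Fin n) l → ℤ) →
          ∑ᵛ k (λ xs → ∑ᵛ l (f xs)) ≡ ∑ᵛ l (λ ys → ∑ᵛ k (λ xs → f xs ys))
∑ᵛ-comm zero    l f = refl
∑ᵛ-comm (suc k) l f =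
  trans (sum-cong-≗ (λ x → ∑ᵛ-comm k l (λ xs → f (x ∷ xs))))
        (∑ᵛ-sum-comm l (λ x ys → ∑ᵛ k (λ xs → f (x ∷ xs) ys)))

term≤∑ᵛ : ∀ {n} k {f : Vec (Fin n) k → ℤ} → (∀ xs → 0ℤ ≤ f xs) → ∀ xs → f xs ≤ ∑ᵛ k f
term≤∑ᵛ zero    0≤f []       = ℤ.≤-refl
term≤∑ᵛ (suc k) 0≤f (x ∷ xs) =
  ℤ.≤-trans (term≤∑ᵛ k (λ ys → 0≤f (x ∷ ys)) xs)
            (term≤sum (λ y → ∑ᵛ-nonneg k (λ ys → 0≤f (y ∷ ys))) x)

∑ᵛ-insertAt : ∀ {n} k i (f : Vec (Fin n) (suc k) → ℤ) →
              ∑ᵛ (suc k) f ≡ sum (λ v → ∑ᵛ k (λ xs → f (insertAt xs i v)))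
∑ᵛ-insertAt k       zero    f = refl
∑ᵛ-insertAt (suc k) (suc i) f =
  trans (sum-cong-≗ (λ x → ∑ᵛ-insertAt k i (λ xs → f (x ∷ xs))))
        (∑-comm (λ x v → ∑ᵛ k (λ xs → f (x ∷ insertAt xs i v))))

-- Invariance of tuple sums under permuting coordinates

reindex : ∀ {A : Set} {k} → Perm k → Vec A k → Vec A k
reindex σ xs = tabulate (λ i → lookup xs (σ ⟨$⟩ʳ i))

lookup-ext : ∀ {A : Set} {k} {xs ys : Vec A k} → (∀ i → lookup xs i ≡ lookup ys i) → xs ≡ ys
lookup-ext {xs = []}     {[]}     eq = refl
lookup-ext {xs = x ∷ xs} {y ∷ ys} eq = cong₂ _∷_ (eq zero) (lookup-ext (eq ∘ suc))

punchIn-cover : ∀ {k} (i j : Fin (suc k)) → (j ≡ i) ⊎ ∃[ l ] j ≡ punchIn i l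
punchIn-cover i j with i Fin.≟ j
... | yes i≡j = inj₁ (sym i≡j)
... | no  i≢j = inj₂ (Fin.punchOut i≢j , sym (Fin.punchIn-punchOut i≢j))

-- The head lands at the coordinate that `σ` sends to `zero`, and the other coordinates are permuted
-- by `σ` with that point removed. This gives `∑ᵛ-reindex` by induction, without a bijection on
-- tuples.
reindex-∷ : ∀ {A : Set} {k} (σ : Perm (suc k)) (x : A) xs → let i = σ ⟨$⟩ˡ zero in
            reindex σ (x ∷ xs) ≡ insertAt (reindex (Perm.remove i σ) xs) i x
reindex-∷ σ x xs = lookup-ext step
  where
  i = σ ⟨$⟩ˡ zero
  step : ∀ j → lookup (reindex σ (x ∷ xs)) j ≡ lookup (insertAt (reindex (Perm.remove i σ) xs) i x) j
  step j with punchIn-cover i j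
  ... | inj₁ refl = begin
    lookup (reindex σ (x ∷ xs)) i ≡⟨ Vec.lookup∘tabulate (lookup (x ∷ xs) ∘ (σ ⟨$⟩ʳ_)) i ⟩
    lookup (x ∷ xs) (σ ⟨$⟩ʳ i)     ≡⟨ cong (lookup (x ∷ xs)) (Perm.inverseʳ σ) ⟩
    x                             ≡⟨ sym (Vec.insertAt-lookup (reindex (Perm.remove i σ) xs) i x) ⟩
    lookup (insertAt (reindex (Perm.remove i σ) xs) i x) i ∎
    where open ≡-Reasoning
  ... | inj₂ (l , refl) = begin
    lookup (reindex σ (x ∷ xs)) (punchIn i l) ≡⟨ Vec.lookup∘tabulate (lookup (x ∷ xs) ∘ (σ ⟨$⟩ʳ_)) (punchIn i l) ⟩
    lookup (x ∷ xs) (σ ⟨$⟩ʳ punchIn i l)       ≡⟨ cong (lookup (x ∷ xs)) (Perm.punchIn-permute′ σ zero l) ⟩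
    lookup xs (Perm.remove i σ ⟨$⟩ʳ l)         ≡⟨ sym (Vec.lookup∘tabulate (lookup xs ∘ (Perm.remove i σ ⟨$⟩ʳ_)) l) ⟩
    lookup (reindex (Perm.remove i σ) xs) l   ≡⟨ sym (Vec.insertAt-punchIn (reindex (Perm.remove i σ) xs) i x l) ⟩
    lookup (insertAt (reindex (Perm.remove i σ) xs) i x) (punchIn i l) ∎
    where open ≡-Reasoning

∑ᵛ-reindex : ∀ {n} k (σ : Perm k) (f : Vec (Fin n) k → ℤ) → ∑ᵛ k (λ xs → f (reindex σ xs)) ≡ ∑ᵛ k f
∑ᵛ-reindex zero    σ f = refl
∑ᵛ-reindex (suc k) σ f = begin
  sum (λ x → ∑ᵛ k (λ xs → f (reindex σ (x ∷ xs))))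
    ≡⟨ sum-cong-≗ (λ x → ∑ᵛ-cong k (λ xs → cong f (reindex-∷ σ x xs))) ⟩
  sum (λ x → ∑ᵛ k (λ xs → f (insertAt (reindex (Perm.remove i σ) xs) i x)))
    ≡⟨ sum-cong-≗ (λ x → ∑ᵛ-reindex k (Perm.remove i σ) (λ xs → f (insertAt xs i x))) ⟩
  sum (λ x → ∑ᵛ k (λ xs → f (insertAt xs i x)))
    ≡⟨ sym (∑ᵛ-insertAt k i f) ⟩
  ∑ᵛ (suc k) f ∎
  where
  open ≡-Reasoning
  i = σ ⟨$⟩ˡ zero

-- Order patterns

⌊⌋-true : ∀ {P : Set} (P? : Dec P) → ⌊ P? ⌋ ≡ true → P
⌊⌋-true (yes p) _ = p

⌊⌋-intro : ∀ {P : Set} (P? : Dec P) → P → ⌊ P? ⌋ ≡ true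
⌊⌋-intro (yes _) _ = refl
⌊⌋-intro (no ¬p) p = contradiction p ¬p

true≢false : ∀ {b} → b ≡ true → ¬ b ≡ false
true≢false refl ()

∧-true : ∀ {a b} → a ∧ b ≡ true → a ≡ true × b ≡ true
∧-true {true} {true} _ = refl , refl

∧-intro : ∀ {a b} → a ≡ true → b ≡ true → a ∧ b ≡ true
∧-intro refl refl = refl

le : ∀ {m n} → Fin m → Fin n → Bool
le i j = ⌊ i Fin.≤? j ⌋

lt : ∀ {m n} → Fin m → Fin n → Bool
lt i j = toℕ i ℕ.<ᵇ toℕ j

le-true : ∀ {m n} (i : Fin m) (j : Fin n) → le i j ≡ true → toℕ i ℕ.≤ toℕ j
le-true i j = ⌊⌋-true (i Fin.≤? j)

le-intro : ∀ {m n} (i : Fin m) (j : Fin n) → toℕ i ℕ.≤ toℕ j → le i j ≡ true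
le-intro i j = ⌊⌋-intro (i Fin.≤? j)

lt-true : ∀ {m n} (i : Fin m) (j : Fin n) → lt i j ≡ true → toℕ i ℕ.< toℕ j
lt-true i j eq = ℕ.<ᵇ⇒< (toℕ i) (toℕ j) (Equivalence.from T-≡ eq)

lt-intro : ∀ {m n} (i : Fin m) (j : Fin n) → toℕ i ℕ.< toℕ j → lt i j ≡ true
lt-intro i j i<j = Equivalence.to T-≡ (ℕ.<⇒<ᵇ i<j)

lt-irrefl : ∀ {n} (i : Fin n) → lt i i ≡ false
lt-irrefl i with lt i i in eq
... | true  = contradiction (lt-true i i eq) (ℕ.n≮n _)
... | false = refl

lt≡not-le : ∀ {m n} (i : Fin m) (j : Fin n) → lt i j ≡ not (le j i)
lt≡not-le i j with j Fin.≤? i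
... | yes j≤i with lt i j in eq
...   | true  = contradiction j≤i (ℕ.<⇒≱ (lt-true i j eq))
...   | false = refl
lt≡not-le i j | no j≰i = lt-intro i j (ℕ.≰⇒> j≰i)

allᵇ-tabulate-true : ∀ {A : Set} {k} (p : A → Bool) (f : Fin k → A) →
                     allᵇ p (List.tabulate f) ≡ true → ∀ i → p (f i) ≡ true
allᵇ-tabulate-true p f eq zero    = proj₁ (∧-true eq)
allᵇ-tabulate-true p f eq (suc i) =
  allᵇ-tabulate-true p (f ∘ suc) (proj₂ (∧-true {p (f zero)} eq)) i

allᵇ-tabulate-intro : ∀ {A : Set} {k} (p : A → Bool) (f : Fin k → A) →
                      (∀ i → p (f i) ≡ true) → allᵇ p (List.tabulate f) ≡ true
allᵇ-tabulate-intro {k = zero}  p f eq = refl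
allᵇ-tabulate-intro {k = suc k} p f eq =
  ∧-intro (eq zero) (allᵇ-tabulate-intro p (f ∘ suc) (eq ∘ suc))

==-true : ∀ a b → (a == b) ≡ true → a ≡ b
==-true true  true  _ = refl
==-true false false _ = refl

==-refl : ∀ a → (a == a) ≡ true
==-refl true  = refl
==-refl false = refl

-- `orderIso π τ xs` unfolds to `matches (π ⟨$⟩ʳ_) ((τ ⟨$⟩ʳ_) ∘ lookup
-- xs)`. Separating the pattern `s` from the points `p` lets the same predicate test positions and
-- values, and lets both be permuted together (`matches-∘`).
matches : ∀ {k m n} → (Fin k → Fin m) → (Fin k → Fin n) → Bool
matches {k} s p = allᵇ (λ i → allᵇ (λ j → le (p i) (p j) == le (s i) (s j)) (allFin k)) (allFin k)

SameOrder : ∀ {k m n} → (Fin k → Fin m) → (Fin k → Fin n) → Set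
SameOrder s p = ∀ i j → le (p i) (p j) ≡ le (s i) (s j)

matches-true : ∀ {k m n} (s : Fin k → Fin m) (p : Fin k → Fin n) → matches s p ≡ true → SameOrder s p
matches-true s p eq i j =
  ==-true _ _ (allᵇ-tabulate-true (λ j → le (p i) (p j) == le (s i) (s j)) id
    (allᵇ-tabulate-true (λ i → allᵇ (λ j → le (p i) (p j) == le (s i) (s j)) (allFin _)) id eq i) j)

matches-intro : ∀ {k m n} (s : Fin k → Fin m) (p : Fin k → Fin n) → SameOrder s p → matches s p ≡ true
matches-intro s p same =
  allᵇ-tabulate-intro _ id (λ i → allᵇ-tabulate-intro _ id (λ j →
    subst (λ b → (b == le (s i) (s j)) ≡ true) (sym (same i j)) (==-refl (le (s i) (s j)))))

matches-cong : ∀ {k m n} {s s′ : Fin k → Fin m} {p p′ : Fin k → Fin n} →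
               (∀ i → s i ≡ s′ i) → (∀ i → p i ≡ p′ i) → matches s p ≡ matches s′ p′
matches-cong {s = s} {s′} {p} {p′} s≗s′ p≗p′ =
  bool-ext (λ eq → matches-intro s′ p′ (λ i j → to (s≗s′ i) (s≗s′ j) (p≗p′ i) (p≗p′ j) (matches-true s p eq i j)))
           (λ eq → matches-intro s p (λ i j → from (s≗s′ i) (s≗s′ j) (p≗p′ i) (p≗p′ j) (matches-true s′ p′ eq i j)))
  where
  to : ∀ {a a′ b b′ c c′ d d′} → a ≡ a′ → b ≡ b′ → c ≡ c′ → d ≡ d′ → le c d ≡ le a b → le c′ d′ ≡ le a′ b′
  to refl refl refl refl eq = eq
  from : ∀ {a a′ b b′ c c′ d d′} → a ≡ a′ → b ≡ b′ → c ≡ c′ → d ≡ d′ → le c′ d′ ≡ le a′ b′ → le c d ≡ le a b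
  from refl refl refl refl eq = eq

matches-∘ : ∀ {k m n} (σ : Perm k) (s : Fin k → Fin m) (p : Fin k → Fin n) →
            matches (s ∘ (σ ⟨$⟩ʳ_)) (p ∘ (σ ⟨$⟩ʳ_)) ≡ matches s p
matches-∘ σ s p = bool-ext
  (λ eq → matches-intro s p (λ i j →
     subst₂ (λ i j → le (p i) (p j) ≡ le (s i) (s j)) (Perm.inverseʳ σ) (Perm.inverseʳ σ)
       (matches-true (s ∘ (σ ⟨$⟩ʳ_)) (p ∘ (σ ⟨$⟩ʳ_)) eq (σ ⟨$⟩ˡ i) (σ ⟨$⟩ˡ j))))
  (λ eq → matches-intro (s ∘ (σ ⟨$⟩ʳ_)) (p ∘ (σ ⟨$⟩ʳ_)) (λ i j →
     matches-true s p eq (σ ⟨$⟩ʳ i) (σ ⟨$⟩ʳ j)))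

-- Increasing tuples

belowAll : ∀ {n k} → Fin n → Vec (Fin n) k → Bool
belowAll x []       = true
belowAll x (y ∷ ys) = lt x y ∧ belowAll x ys

increasing : ∀ {n k} → Vec (Fin n) k → Bool
increasing []       = true
increasing (x ∷ xs) = belowAll x xs ∧ increasing xs

belowAll-true : ∀ {n k} (x : Fin n) (ys : Vec (Fin n) k) → belowAll x ys ≡ true →
                ∀ i → toℕ x ℕ.< toℕ (lookup ys i)
belowAll-true x (y ∷ ys) eq zero    = lt-true x y (proj₁ (∧-true eq))
belowAll-true x (y ∷ ys) eq (suc i) = belowAll-true x ys (proj₂ (∧-true {lt x y} eq)) i

belowAll-intro : ∀ {n k} (x : Fin n) (ys : Vec (Fin n) k) →
                 (∀ i → toℕ x ℕ.< toℕ (lookup ys i)) → belowAll x ys ≡ true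
belowAll-intro x []       x< = refl
belowAll-intro x (y ∷ ys) x< = ∧-intro (lt-intro x y (x< zero)) (belowAll-intro x ys (x< ∘ suc))

increasing-true : ∀ {n k} (xs : Vec (Fin n) k) → increasing xs ≡ true →
                  ∀ i j → toℕ i ℕ.< toℕ j → toℕ (lookup xs i) ℕ.< toℕ (lookup xs j)
increasing-true (x ∷ xs) eq zero    (suc j) _           = belowAll-true x xs (proj₁ (∧-true eq)) j
increasing-true (x ∷ xs) eq (suc i) (suc j) (ℕ.s≤s i<j) =
  increasing-true xs (proj₂ (∧-true {belowAll x xs} eq)) i j i<j

increasing-intro : ∀ {n k} (xs : Vec (Fin n) k) →
                   (∀ i j → toℕ i ℕ.< toℕ j → toℕ (lookup xs i) ℕ.< toℕ (lookup xs j)) →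
                   increasing xs ≡ true
increasing-intro []       inc = refl
increasing-intro (x ∷ xs) inc =
  ∧-intro (belowAll-intro x xs (λ i → inc zero (suc i) (ℕ.s≤s ℕ.z≤n)))
          (increasing-intro xs (λ i j i<j → inc (suc i) (suc j) (ℕ.s≤s i<j)))

-- `increasing` follows the recursion of `subsets`, while `matches id` behaves well under
-- permutation of coordinates; this is the bridge.
increasing≡matches-id : ∀ {n k} (xs : Vec (Fin n) k) → increasing xs ≡ matches id (lookup xs)
increasing≡matches-id xs = bool-ext (λ eq → matches-intro id (lookup xs) (same eq)) (λ eq → increasing-intro xs
    (inc eq))
  where
  same : increasing xs ≡ true → SameOrder id (lookup xs)
  same eq i j = bool-ext
    (λ xi≤xj → le-intro i j (ℕ.≮⇒≥ (λ j<i →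
       ℕ.<⇒≱ (increasing-true xs eq j i j<i) (le-true (lookup xs i) (lookup xs j) xi≤xj))))
    (λ i≤j → le-intro (lookup xs i) (lookup xs j) (weak (ℕ.m≤n⇒m<n∨m≡n (le-true i j i≤j))))
    where
    weak : toℕ i ℕ.< toℕ j ⊎ toℕ i ≡ toℕ j → toℕ (lookup xs i) ℕ.≤ toℕ (lookup xs j)
    weak (inj₁ i<j) = ℕ.<⇒≤ (increasing-true xs eq i j i<j)
    weak (inj₂ i≡j) = ℕ.≤-reflexive (cong (toℕ ∘ lookup xs) (Fin.toℕ-injective i≡j))
  inc : matches id (lookup xs) ≡ true → ∀ i j → toℕ i ℕ.< toℕ j → toℕ (lookup xs i) ℕ.< toℕ (lookup xs j)
  inc eq i j i<j = ℕ.≰⇒> (λ xj≤xi → ℕ.<⇒≱ i<j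
    (le-true j i (trans (sym (matches-true id (lookup xs) eq j i)) (le-intro (lookup xs j) (lookup xs i) xj≤xi))))

-- Sums over subsets as sums over increasing tuples

∑ˡ : ∀ {A : Set} → (A → ℤ) → List A → ℤ
∑ˡ f []       = 0ℤ
∑ˡ f (x ∷ xs) = f x + ∑ˡ f xs

∑ˡ-++ : ∀ {A : Set} (f : A → ℤ) xs ys → ∑ˡ f (xs ++ ys) ≡ ∑ˡ f xs + ∑ˡ f ys
∑ˡ-++ f []       ys = sym (ℤ.+-identityˡ _)
∑ˡ-++ f (x ∷ xs) ys =
  trans (cong (λ s → f x + s) (∑ˡ-++ f xs ys)) (sym (ℤ.+-assoc (f x) (∑ˡ f xs) (∑ˡ f ys)))

∑ˡ-map : ∀ {A B : Set} (f : B → ℤ) (g : A → B) xs → ∑ˡ f (List.map g xs) ≡ ∑ˡ (f ∘ g) xs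
∑ˡ-map f g []       = refl
∑ˡ-map f g (x ∷ xs) = cong (λ s → f (g x) + s) (∑ˡ-map f g xs)

length-filterᵇ : ∀ {A : Set} (p : A → Bool) xs → + length (filterᵇ p xs) ≡ ∑ˡ (𝟙 ∘ p) xs
length-filterᵇ p []       = refl
length-filterᵇ p (x ∷ xs) with p x
... | true  = cong (λ s → 1ℤ + s) (length-filterᵇ p xs)
... | false = trans (length-filterᵇ p xs) (sym (ℤ.+-identityˡ _))

∑ˡ-one : ∀ {A : Set} (xs : List A) → ∑ˡ (λ _ → 1ℤ) xs ≡ + length xs
∑ˡ-one []       = refl
∑ˡ-one (x ∷ xs) = cong (λ s → 1ℤ + s) (∑ˡ-one xs)

belowAll-map-suc : ∀ {n k} (x : Fin n) (ys : Vec (Fin n) k) → belowAll (suc x) (Vec.map suc ys) ≡ belowAll x ys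
belowAll-map-suc x []       = refl
belowAll-map-suc x (y ∷ ys) = cong (lt x y ∧_) (belowAll-map-suc x ys)

belowAll-zero : ∀ {n k} (ys : Vec (Fin n) k) → belowAll zero (Vec.map suc ys) ≡ true
belowAll-zero []       = refl
belowAll-zero (y ∷ ys) = belowAll-zero ys

belowAll-suc-false : ∀ {n k} (x : Fin n) (ys : Vec (Fin (suc n)) k) →
                     belowAll zero ys ≡ false → belowAll (suc x) ys ≡ false
belowAll-suc-false x (zero ∷ ys)  eq = refl
belowAll-suc-false x (suc y ∷ ys) eq with lt x y
... | true  = belowAll-suc-false x ys eq
... | false = refl

increasing-map-suc : ∀ {n k} (xs : Vec (Fin n) k) → increasing (Vec.map suc xs) ≡ increasing xs
increasing-map-suc []       = refl
increasing-map-suc (x ∷ xs) = cong₂ _∧_ (belowAll-map-suc x xs) (increasing-map-suc xs)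

-- The hypothesis kills the tuples with some entry `zero`; the remaining ones are exactly the images
-- under `Vec.map suc`.
∑ᵛ-map-suc : ∀ {n} k (g : Vec (Fin (suc n)) k → ℤ) →
             (∀ xs → belowAll zero xs ≡ false → g xs ≡ 0ℤ) → ∑ᵛ k g ≡ ∑ᵛ k (g ∘ Vec.map suc)
∑ᵛ-map-suc zero    g vanish = refl
∑ᵛ-map-suc {n} (suc k) g vanish = begin
  ∑ᵛ k (λ xs → g (zero ∷ xs)) + sum (λ x → ∑ᵛ k (λ xs → g (suc x ∷ xs)))
    ≡⟨ cong₂ _+_ (trans (∑ᵛ-cong k (λ xs → vanish (zero ∷ xs) refl))
                        (trans (∑ᵛ-const {suc n} k 0ℤ) (ℤ.*-zeroʳ ((+ suc n) ^ k))))
                 (sum-cong-≗ (λ x → ∑ᵛ-map-suc k (λ xs → g (suc x ∷ xs)) (λ xs → vanish (suc x ∷ xs)))) ⟩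
  0ℤ + sum (λ x → ∑ᵛ k (λ xs → g (suc x ∷ Vec.map suc xs)))
    ≡⟨ ℤ.+-identityˡ _ ⟩
  sum (λ x → ∑ᵛ k (λ xs → g (suc x ∷ Vec.map suc xs))) ∎
  where open ≡-Reasoning

-- `subsets` branches on whether the least element is `zero`. The tuple sum branches on its first
-- entry in the same way, and the indicator excludes `zero` from all later entries.
∑-subsets : ∀ k n (f : Vec (Fin n) k → ℤ) →
            ∑ˡ f (subsets k n) ≡ ∑ᵛ k (λ xs → 𝟙 (increasing xs) * f xs)
∑-subsets zero    n       f = trans (ℤ.+-identityʳ (f [])) (sym (ℤ.*-identityˡ (f [])))
∑-subsets (suc k) zero    f = refl
∑-subsets (suc k) (suc n) f = begin
  ∑ˡ f (List.map cons (subsets k n) ++ List.map (Vec.map suc) (subsets (suc k) n))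
    ≡⟨ ∑ˡ-++ f (List.map cons (subsets k n)) _ ⟩
  ∑ˡ f (List.map cons (subsets k n)) + ∑ˡ f (List.map (Vec.map suc) (subsets (suc k) n))
    ≡⟨ cong₂ _+_ (trans (∑ˡ-map f cons (subsets k n)) (∑-subsets k n (f ∘ cons)))
                 (trans (∑ˡ-map f (Vec.map suc) (subsets (suc k) n)) (∑-subsets (suc k) n (f ∘ Vec.map suc))) ⟩
  ∑ᵛ k (λ xs → 𝟙 (increasing xs) * f (cons xs)) + ∑ᵛ (suc k) (λ xs → 𝟙 (increasing xs) * f (Vec.map suc xs))
    ≡⟨ cong₂ _+_ (sym startsAtZero) (sum-cong-≗ (λ x → sym (startsLater x))) ⟩
  ∑ᵛ (suc k) (λ xs → 𝟙 (increasing xs) * f xs) ∎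
  where
  open ≡-Reasoning
  cons : Vec (Fin n) k → Vec (Fin (suc n)) (suc k)
  cons v = zero ∷ Vec.map suc v
  startsAtZero : ∑ᵛ k (λ xs → 𝟙 (increasing (zero ∷ xs)) * f (zero ∷ xs)) ≡
                 ∑ᵛ k (λ xs → 𝟙 (increasing xs) * f (cons xs))
  startsAtZero = trans
    (∑ᵛ-map-suc k (λ xs → 𝟙 (increasing (zero ∷ xs)) * f (zero ∷ xs))
      (λ xs eq → cong (λ b → 𝟙 (b ∧ increasing xs) * f (zero ∷ xs)) eq))
    (∑ᵛ-cong k (λ xs → cong₂ (λ b c → 𝟙 (b ∧ c) * f (cons xs)) (belowAll-zero xs) (increasing-map-suc xs)))
  startsLater : ∀ x → ∑ᵛ k (λ xs → 𝟙 (increasing (suc x ∷ xs)) * f (suc x ∷ xs)) ≡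
                      ∑ᵛ k (λ xs → 𝟙 (increasing (x ∷ xs)) * f (suc x ∷ Vec.map suc xs))
  startsLater x = trans
    (∑ᵛ-map-suc k (λ xs → 𝟙 (increasing (suc x ∷ xs)) * f (suc x ∷ xs))
      (λ xs eq → cong (λ b → 𝟙 (b ∧ increasing xs) * f (suc x ∷ xs)) (belowAll-suc-false x xs eq)))
    (∑ᵛ-cong k (λ xs → cong (λ b → 𝟙 b * f (suc x ∷ Vec.map suc xs)) (increasing-map-suc (x ∷ xs))))

length-subsets : ∀ k n → length (subsets k n) ≡ n C k
length-subsets zero    n       = refl
length-subsets (suc k) zero    = refl
length-subsets (suc k) (suc n) = begin
  length (List.map (λ v → zero ∷ Vec.map suc v) (subsets k n) ++ List.map (Vec.map suc) (subsets (suc k) n))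
    ≡⟨ List.length-++ (List.map (λ v → zero ∷ Vec.map suc v) (subsets k n)) ⟩
  length (List.map (λ v → zero ∷ Vec.map suc v) (subsets k n)) ℕ.+ length (List.map (Vec.map Fin.suc) (subsets
      (suc k) n))
    ≡⟨ cong₂ ℕ._+_ (trans (List.length-map _ (subsets k n)) (length-subsets k n))
                   (trans (List.length-map _ (subsets (suc k) n)) (length-subsets (suc k) n)) ⟩
  n C k ℕ.+ n C suc k ≡⟨ nCk+nC[k+1]≡[n+1]C[k+1] n k ⟩
  suc n C suc k ∎
  where open ≡-Reasoning

∑-matches-id : ∀ k n → ∑ᵛ {n} k (λ xs → 𝟙 (matches id (lookup xs))) ≡ + (n C k)
∑-matches-id k n = begin
  ∑ᵛ k (λ xs → 𝟙 (matches id (lookup xs)))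
    ≡⟨ ∑ᵛ-cong k (λ xs → trans (cong 𝟙 (sym (increasing≡matches-id xs))) (sym (ℤ.*-identityʳ (𝟙 (increasing xs))))) ⟩
  ∑ᵛ k (λ xs → 𝟙 (increasing xs) * 1ℤ) ≡⟨ sym (∑-subsets k n (λ _ → 1ℤ)) ⟩
  ∑ˡ (λ _ → 1ℤ) (subsets k n)          ≡⟨ ∑ˡ-one (subsets k n) ⟩
  + length (subsets k n)               ≡⟨ cong +_ (length-subsets k n) ⟩
  + (n C k)                            ∎
  where open ≡-Reasoning

occurrences≡∑ : ∀ {k n} (π : Perm k) (τ : Perm n) → + occurrences π τ ≡
  ∑ᵛ k (λ xs → 𝟙 (matches id (lookup xs)) * 𝟙 (matches (π ⟨$⟩ʳ_) ((τ ⟨$⟩ʳ_) ∘ lookup xs)))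
occurrences≡∑ {k} {n} π τ = begin
  + occurrences π τ                    ≡⟨ length-filterᵇ (orderIso π τ) (subsets k n) ⟩
  ∑ˡ (𝟙 ∘ orderIso π τ) (subsets k n)  ≡⟨ ∑-subsets k n (𝟙 ∘ orderIso π τ) ⟩
  ∑ᵛ k (λ xs → 𝟙 (increasing xs) * 𝟙 (orderIso π τ xs))
    ≡⟨ ∑ᵛ-cong k (λ xs → cong (λ b → 𝟙 b * 𝟙 (orderIso π τ xs)) (increasing≡matches-id xs)) ⟩
  ∑ᵛ k (λ xs → 𝟙 (matches id (lookup xs)) * 𝟙 (matches (π ⟨$⟩ʳ_) ((τ ⟨$⟩ʳ_) ∘ lookup xs))) ∎
  where open ≡-Reasoning

-- Permuting coordinates by `π` turns tuples of pattern `π` into increasing ones, so all patterns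
-- are equally frequent among tuples.
∑-matches-perm : ∀ {k} n (π : Perm k) → ∑ᵛ {n} k (λ xs → 𝟙 (matches (π ⟨$⟩ʳ_) (lookup xs))) ≡ + (n C k)
∑-matches-perm {k} n π = begin
  ∑ᵛ k (λ xs → 𝟙 (matches (π ⟨$⟩ʳ_) (lookup xs)))
    ≡⟨ sym (∑ᵛ-reindex k π (λ xs → 𝟙 (matches (π ⟨$⟩ʳ_) (lookup xs)))) ⟩
  ∑ᵛ k (λ xs → 𝟙 (matches (π ⟨$⟩ʳ_) (lookup (reindex π xs))))
    ≡⟨ ∑ᵛ-cong k (λ xs → cong 𝟙 (trans (matches-cong {p = lookup (reindex π xs)} (λ _ → refl)
        (Vec.lookup∘tabulate _)) (matches-∘ π id (lookup xs)))) ⟩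
  ∑ᵛ k (λ xs → 𝟙 (matches id (lookup xs))) ≡⟨ ∑-matches-id k n ⟩
  + (n C k) ∎
  where open ≡-Reasoning

-- Permuting coordinates by `σ` sorts the positions; the value at the `i`-th position then has rank
-- `ρ (σ⁻¹ i)`. A pair of patterns, one for positions and one for values, is thus an occurrence of a
-- single permutation.
∑-joint-matches : ∀ {k n} (σ ρ : Perm k) (τ : Perm n) →
  ∑ᵛ k (λ xs → 𝟙 (matches (σ ⟨$⟩ʳ_) (lookup xs)) * 𝟙 (matches (ρ ⟨$⟩ʳ_) ((τ ⟨$⟩ʳ_) ∘ lookup xs)))
    ≡ + occurrences (Perm.flip σ Perm.∘ₚ ρ) τ
∑-joint-matches {k} {n} σ ρ τ = begin
  ∑ᵛ k f                             ≡⟨ sym (∑ᵛ-reindex k σ f) ⟩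
  ∑ᵛ k (f ∘ reindex σ)               ≡⟨ ∑ᵛ-cong k pointwise ⟩
  ∑ᵛ k (λ xs → 𝟙 (matches id (lookup xs)) * 𝟙 (matches (π ⟨$⟩ʳ_) ((τ ⟨$⟩ʳ_) ∘ lookup xs)))
                                     ≡⟨ sym (occurrences≡∑ π τ) ⟩
  + occurrences π τ                  ∎
  where
  open ≡-Reasoning
  π = Perm.flip σ Perm.∘ₚ ρ
  f : Vec (Fin n) k → ℤ
  f xs = 𝟙 (matches (σ ⟨$⟩ʳ_) (lookup xs)) * 𝟙 (matches (ρ ⟨$⟩ʳ_) ((τ ⟨$⟩ʳ_) ∘ lookup xs))
  pointwise : ∀ xs → f (reindex σ xs) ≡ 𝟙 (matches id (lookup xs)) * 𝟙 (matches (π ⟨$⟩ʳ_) ((τ ⟨$⟩ʳ_) ∘ lookup xs))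
  pointwise xs = cong₂ (λ b c → 𝟙 b * 𝟙 c)
    (trans (matches-cong {p = lookup (reindex σ xs)} (λ _ → refl) (Vec.lookup∘tabulate _)) (matches-∘ σ id (lookup xs)))
    (trans (matches-cong (λ i → cong (ρ ⟨$⟩ʳ_) (sym (Perm.inverseˡ σ)))
                         (λ i → cong (τ ⟨$⟩ʳ_) (Vec.lookup∘tabulate (lookup xs ∘ (σ ⟨$⟩ʳ_)) i)))
           (matches-∘ σ (π ⟨$⟩ʳ_) ((τ ⟨$⟩ʳ_) ∘ lookup xs)))

-- Standardisation of tuples

bit : Bool → ℕ
bit b = if b then 1 else 0

bit-mono : ∀ {a b} → (a ≡ true → b ≡ true) → bit a ℕ.≤ bit b
bit-mono {false}     _   = ℕ.z≤n
bit-mono {true}      a⇒b = ℕ.≤-reflexive (cong bit (sym (a⇒b refl)))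

count : ∀ {k} → (Fin k → Bool) → ℕ
count {zero}  f = 0
count {suc k} f = bit (f zero) ℕ.+ count (f ∘ suc)

count-mono : ∀ {k} {f g : Fin k → Bool} → (∀ i → f i ≡ true → g i ≡ true) → count f ℕ.≤ count g
count-mono {zero}  f⇒g = ℕ.z≤n
count-mono {suc k} f⇒g = ℕ.+-mono-≤ (bit-mono (f⇒g zero)) (count-mono (f⇒g ∘ suc))

count-strict : ∀ {k} {f g : Fin k → Bool} → (∀ i → f i ≡ true → g i ≡ true) →
               ∀ i → f i ≡ false → g i ≡ true → count f ℕ.< count g
count-strict {suc k} f⇒g zero fi gi rewrite fi | gi = ℕ.s≤s (count-mono (f⇒g ∘ suc))
count-strict {suc k} f⇒g (suc i) fi gi =
  ℕ.+-mono-≤-< (bit-mono (f⇒g zero)) (count-strict (f⇒g ∘ suc) i fi gi)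

count-true : ∀ k → count {k} (λ _ → true) ≡ k
count-true zero    = refl
count-true (suc k) = cong suc (count-true k)

count-< : ∀ {k} {f : Fin k → Bool} i → f i ≡ false → count f ℕ.< k
count-< {k} {f} i fi = subst (count f ℕ.<_) (count-true k) (count-strict (λ _ _ → refl) i fi refl)

-- Only strictly smaller entries are counted: equal entries share a rank, so order is preserved
-- without assuming injectivity, and `i` does not count itself, which keeps the rank below `k`.
rank : ∀ {k n} → (Fin k → Fin n) → Fin k → Fin k
rank p i = Fin.fromℕ< (count-< {f = λ j → lt (p j) (p i)} i (lt-irrefl (p i)))

rank-sameOrder : ∀ {k n} (p : Fin k → Fin n) → SameOrder (rank p) p
rank-sameOrder p i j = bool-ext
  (λ pi≤pj → le-intro (rank p i) (rank p j) (subst₂ ℕ._≤_ (sym (toℕ-rank i)) (sym (toℕ-rank j))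
     (monotone (le-true (p i) (p j) pi≤pj))))
  (λ ri≤rj → le-intro (p i) (p j) (ℕ.≮⇒≥ (λ pj<pi →
     ℕ.<⇒≱ (strict pj<pi) (subst₂ ℕ._≤_ (toℕ-rank i) (toℕ-rank j) (le-true (rank p i) (rank p j) ri≤rj)))))
  where
  toℕ-rank : ∀ i → toℕ (rank p i) ≡ count (λ l → lt (p l) (p i))
  toℕ-rank i = Fin.toℕ-fromℕ< _
  monotone : ∀ {i j} → toℕ (p i) ℕ.≤ toℕ (p j) → count (λ l → lt (p l) (p i)) ℕ.≤ count (λ l → lt (p l) (p j))
  monotone {i} {j} pi≤pj = count-mono (λ l pl<pi →
    lt-intro (p l) (p j) (ℕ.<-≤-trans (lt-true (p l) (p i) pl<pi) pi≤pj))
  strict : toℕ (p j) ℕ.< toℕ (p i) → count (λ l → lt (p l) (p j)) ℕ.< count (λ l → lt (p l) (p i))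
  strict pj<pi = count-strict
    (λ l pl<pj → lt-intro (p l) (p i) (ℕ.<-trans (lt-true (p l) (p j) pl<pj) pj<pi))
    j (lt-irrefl (p j)) (lt-intro (p j) (p i) pj<pi)

sameOrder-injective : ∀ {k m n} (s : Fin k → Fin m) (p : Fin k → Fin n) →
                      SameOrder s p → Injective _≡_ _≡_ p → Injective _≡_ _≡_ s
sameOrder-injective s p same inj {i} {j} si≡sj = inj (Fin.toℕ-injective (ℕ.≤-antisym
  (le-true (p i) (p j) (trans (same i j) (le-intro (s i) (s j) (ℕ.≤-reflexive (cong toℕ si≡sj)))))
  (le-true (p j) (p i) (trans (same j i) (le-intro (s j) (s i) (ℕ.≤-reflexive (cong toℕ (sym si≡sj))))))))

sameOrder-lt : ∀ {k m n} (s : Fin k → Fin m) (p : Fin k → Fin n) →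
               SameOrder s p → ∀ i j → lt (p i) (p j) ≡ lt (s i) (s j)
sameOrder-lt s p same i j =
  trans (lt≡not-le (p i) (p j)) (trans (cong not (same j i)) (sym (lt≡not-le (s i) (s j))))

-- Pigeonhole: punching out a missed value would give an injection of `Fin (suc k)` into `Fin k`.
injective⇒surjective : ∀ {k} (f : Fin k → Fin k) → Injective _≡_ _≡_ f → ∀ y → ∃[ x ] f x ≡ y
injective⇒surjective {suc k} f inj y with Fin.any? (λ x → f x Fin.≟ y)
... | yes hit = hit
... | no  miss = contradiction
  (Fin.injective⇒≤ {f = λ x → Fin.punchOut (λ y≡fx → miss (x , sym y≡fx))}
     (λ eq → inj (Fin.punchOut-injective {i = y} _ _ eq)))
  ℕ.1+n≰n

fromInjective : ∀ {k} (f : Fin k → Fin k) → Injective _≡_ _≡_ f → Perm k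
fromInjective f inj = Perm.permutation f (λ y → proj₁ (surj y)) (λ y → proj₂ (surj y)) (λ x → inj (proj₂ (surj (f x))))
  where surj = injective⇒surjective f inj

-- Tuples with repeated entries

avoids : ∀ {n k} → Fin n → Vec (Fin n) k → Bool
avoids x []       = true
avoids x (y ∷ ys) = not ⌊ y Fin.≟ x ⌋ ∧ avoids x ys

distinct : ∀ {n k} → Vec (Fin n) k → Bool
distinct []       = true
distinct (x ∷ xs) = avoids x xs ∧ distinct xs

avoids-true : ∀ {n k} (x : Fin n) (ys : Vec (Fin n) k) → avoids x ys ≡ true → ∀ i → ¬ lookup ys i ≡ x
avoids-true x (y ∷ ys) eq zero y≡x with y Fin.≟ x
... | no y≢x = y≢x y≡x
avoids-true x (y ∷ ys) eq (suc i) = avoids-true x ys (proj₂ (∧-true {not ⌊ y Fin.≟ x ⌋} eq)) i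

avoids-intro : ∀ {n k} (x : Fin n) (ys : Vec (Fin n) k) → (∀ i → ¬ lookup ys i ≡ x) → avoids x ys ≡ true
avoids-intro x []       ≢x = refl
avoids-intro x (y ∷ ys) ≢x with y Fin.≟ x
... | yes y≡x = contradiction y≡x (≢x zero)
... | no  _   = avoids-intro x ys (≢x ∘ suc)

distinct-true : ∀ {n k} (xs : Vec (Fin n) k) → distinct xs ≡ true → Injective _≡_ _≡_ (lookup xs)
distinct-true (x ∷ xs) eq {zero}  {zero}  _   = refl
distinct-true (x ∷ xs) eq {zero}  {suc j} x≡  = contradiction (sym x≡) (avoids-true x xs (proj₁ (∧-true eq)) j)
distinct-true (x ∷ xs) eq {suc i} {zero}  ≡x  = contradiction ≡x (avoids-true x xs (proj₁ (∧-true eq)) i)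
distinct-true (x ∷ xs) eq {suc i} {suc j} xi≡xj =
  cong suc (distinct-true xs (proj₂ (∧-true {avoids x xs} eq)) xi≡xj)

distinct-intro : ∀ {n k} (xs : Vec (Fin n) k) → Injective _≡_ _≡_ (lookup xs) → distinct xs ≡ true
distinct-intro []       inj = refl
distinct-intro (x ∷ xs) inj = ∧-intro
  (avoids-intro x xs (λ i xi≡x → contradiction (inj {suc i} {zero} xi≡x) λ ()))
  (distinct-intro xs (λ eq → Fin.suc-injective (inj {suc _} {suc _} eq)))

multiplicity : ∀ {n k} → Fin n → Vec (Fin n) k → ℤ
multiplicity x []       = 0ℤ
multiplicity x (y ∷ ys) = δ y x + multiplicity x ys

𝟙-not-∧ : ∀ a b → 𝟙 (not (a ∧ b)) ≤ 𝟙 (not a) + 𝟙 (not b)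
𝟙-not-∧ true  b = ℤ.≤-reflexive (sym (ℤ.+-identityˡ _))
𝟙-not-∧ false b = ℤ.+-monoʳ-≤ 1ℤ (𝟙-nonneg (not b))

𝟙-not-avoids : ∀ {n k} (x : Fin n) (ys : Vec (Fin n) k) → 𝟙 (not (avoids x ys)) ≤ multiplicity x ys
𝟙-not-avoids x []       = ℤ.≤-refl
𝟙-not-avoids x (y ∷ ys) = ℤ.≤-trans (𝟙-not-∧ (not ⌊ y Fin.≟ x ⌋) (avoids x ys))
  (ℤ.+-mono-≤ (ℤ.≤-reflexive (not-not ⌊ y Fin.≟ x ⌋)) (𝟙-not-avoids x ys))
  where
  not-not : ∀ b → 𝟙 (not (not b)) ≡ 𝟙 b
  not-not true  = refl
  not-not false = refl

sum-multiplicity : ∀ {n k} (ys : Vec (Fin n) k) → sum (λ x → multiplicity x ys) ≡ + k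
sum-multiplicity {n} []       = sum-zero n
sum-multiplicity {n} {suc k} (y ∷ ys) = begin
  sum (λ x → δ y x + multiplicity x ys)           ≡⟨ sum-+ (δ y) (λ x → multiplicity x ys) ⟩
  sum (δ y) + sum (λ x → multiplicity x ys)       ≡⟨ cong₂ _+_ sum-δ-one (sum-multiplicity ys) ⟩
  1ℤ + + k                                        ∎
  where
  open ≡-Reasoning
  sum-δ-one : sum (δ y) ≡ 1ℤ
  sum-δ-one = trans (sum-cong-≗ (λ x → sym (ℤ.*-identityʳ (δ y x)))) (sum-δ y (λ _ → 1ℤ))

repeats : ℕ → ℕ → ℤ
repeats n k = ∑ᵛ {n} k (λ xs → 𝟙 (not (distinct xs)))

-- Union bound: either the head equals one of the `k` later entries, or the tail already has a
-- repetition.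
repeats-suc : ∀ n k → repeats n (suc k) ≤ + k * (+ n) ^ k + + n * repeats n k
repeats-suc n k = begin
  sum {n} (λ x → ∑ᵛ k (λ xs → 𝟙 (not (distinct (x ∷ xs)))))
    ≤⟨ sum-mono {n} (λ x → ∑ᵛ-mono k (λ xs → ℤ.≤-trans (𝟙-not-∧ (avoids x xs) (distinct xs))
                                                  (ℤ.+-monoˡ-≤ (𝟙 (not (distinct xs))) (𝟙-not-avoids x xs)))) ⟩
  sum {n} (λ x → ∑ᵛ k (λ xs → multiplicity x xs + 𝟙 (not (distinct xs))))
    ≡⟨ sum-cong-≗ {n} (λ x → ∑ᵛ-+ k (multiplicity x) (λ xs → 𝟙 (not (distinct xs)))) ⟩
  sum {n} (λ x → ∑ᵛ k (multiplicity x) + repeats n k)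
    ≡⟨ sum-+ {n} (λ x → ∑ᵛ k (multiplicity x)) (λ _ → repeats n k) ⟩
  sum {n} (λ x → ∑ᵛ k (multiplicity x)) + sum {n} (λ _ → repeats n k)
    ≡⟨ cong₂ _+_ (∑ᵛ-sum-comm {n} k multiplicity) (sum-const n (repeats n k)) ⟩
  ∑ᵛ k (λ xs → sum {n} (λ x → multiplicity x xs)) + + n * repeats n k
    ≡⟨ cong (λ s → s + + n * repeats n k) (trans (∑ᵛ-cong k sum-multiplicity) (∑ᵛ-const {n} k (+ k))) ⟩
  (+ n) ^ k * + k + + n * repeats n k
    ≡⟨ cong (λ s → s + + n * repeats n k) (ℤ.*-comm ((+ n) ^ k) (+ k)) ⟩
  + k * (+ n) ^ k + + n * repeats n k ∎
  where open ℤ.≤-Reasoning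

-- Order-invariant statistics of tuples

-- `value` is given for all ranges at once, so that `invariant` can compare a tuple of points with
-- its standardisation in `Fin k`. Nonnegativity is what allows estimates from upper bounds on
-- pattern counts alone.
record OrderKernel (k : ℕ) : Set where
  field
    value     : ∀ {m n} → (Fin k → Fin m) → (Fin k → Fin n) → ℤ
    bound     : ℤ
    nonneg    : ∀ {m n} (x : Fin k → Fin m) (y : Fin k → Fin n) → 0ℤ ≤ value x y
    bounded   : ∀ {m n} (x : Fin k → Fin m) (y : Fin k → Fin n) → value x y ≤ bound
    invariant : ∀ {m n m′ n′} (s : Fin k → Fin m′) (s′ : Fin k → Fin n′) (x : Fin k → Fin m) (y : Fin k → Fin n) →
                SameOrder s x → SameOrder s′ y → value x y ≡ value s s′

module KernelSum {k} (κ : OrderKernel k) where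
  open OrderKernel κ

  -- Permutations are listed as value tables with the indicator `distinct`, which makes
  -- `totalWeight` a finite sum that evaluates for a concrete kernel.
  coefficient : Vec (Fin k) k → Vec (Fin k) k → ℤ
  coefficient s s′ = 𝟙 (distinct s ∧ distinct s′) * value (lookup s) (lookup s′)

  totalWeight : ℤ
  totalWeight = ∑ᵛ k (λ s → ∑ᵛ k (λ s′ → coefficient s s′))

  module _ {n} (τ : Perm n) where

    hits : Vec (Fin k) k → Vec (Fin k) k → Vec (Fin n) k → ℤ
    hits s s′ xs = 𝟙 (matches (lookup s) (lookup xs)) * 𝟙 (matches (lookup s′) ((τ ⟨$⟩ʳ_) ∘ lookup xs))

    private
      hits-nonneg : ∀ s s′ xs → 0ℤ ≤ hits s s′ xs
      hits-nonneg s s′ xs = nonneg-* {𝟙 (matches (lookup s) (lookup xs))} (𝟙-nonneg (matches (lookup s) (lookup xs)))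
        (𝟙-nonneg (matches (lookup s′) ((τ ⟨$⟩ʳ_) ∘ lookup xs)))

      coefficient-nonneg : ∀ s s′ → 0ℤ ≤ coefficient s s′
      coefficient-nonneg s s′ = nonneg-* {𝟙 (distinct s ∧ distinct s′)} (𝟙-nonneg (distinct s ∧ distinct s′)) (nonneg
          (lookup s) (lookup s′))

      term-nonneg : ∀ xs s s′ → 0ℤ ≤ coefficient s s′ * hits s s′ xs
      term-nonneg xs s s′ = nonneg-* {coefficient s s′} (coefficient-nonneg s s′) (hits-nonneg s s′ xs)

    -- A tuple without repetitions has the value of its two standardisations, a single term of the
    -- double sum; the other terms are nonnegative, so an inequality is immediate. A tuple with
    -- repetitions is paid for by `bound`.
    value-expansion : ∀ xs → value (lookup xs) ((τ ⟨$⟩ʳ_) ∘ lookup xs) ≤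
      bound * 𝟙 (not (distinct xs)) + ∑ᵛ k (λ s → ∑ᵛ k (λ s′ → coefficient s s′ * hits s s′ xs))
    value-expansion xs with distinct xs in eq
    ... | false = begin
      value (lookup xs) ((τ ⟨$⟩ʳ_) ∘ lookup xs)  ≤⟨ bounded (lookup xs) ((τ ⟨$⟩ʳ_) ∘ lookup xs) ⟩
      bound                                      ≡⟨ sym (trans (ℤ.+-identityʳ _) (ℤ.*-identityʳ bound)) ⟩
      bound * 1ℤ + 0ℤ                            ≤⟨ ℤ.+-monoʳ-≤ (bound * 1ℤ) (∑ᵛ-nonneg k (λ s → ∑ᵛ-nonneg k
          (λ s′ → term-nonneg xs s s′))) ⟩
      bound * 1ℤ + ∑ᵛ k (λ s → ∑ᵛ k (λ s′ → coefficient s s′ * hits s s′ xs)) ∎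
      where open ℤ.≤-Reasoning
    ... | true = begin
      value x y                       ≡⟨ invariant (lookup s) (lookup s′) x y same same′ ⟩
      value (lookup s) (lookup s′)    ≡⟨ sym one ⟩
      coefficient s s′ * hits s s′ xs ≤⟨ term≤∑ᵛ k (λ s′ → term-nonneg xs s s′) s′ ⟩
      ∑ᵛ k (λ s′ → coefficient s s′ * hits s s′ xs)
        ≤⟨ term≤∑ᵛ k (λ s → ∑ᵛ-nonneg k (λ s′ → term-nonneg xs s s′)) s ⟩
      ∑ᵛ k (λ s → ∑ᵛ k (λ s′ → coefficient s s′ * hits s s′ xs))
        ≡⟨ sym (trans (cong (λ z → z + ∑ᵛ k (λ s → ∑ᵛ k (λ s′ → coefficient s s′ * hits s s′ xs))) (ℤ.*-zeroʳ bound))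
            (ℤ.+-identityˡ _)) ⟩
      bound * 0ℤ + ∑ᵛ k (λ s → ∑ᵛ k (λ s′ → coefficient s s′ * hits s s′ xs)) ∎
      where
      open ℤ.≤-Reasoning
      x = lookup xs
      y = (τ ⟨$⟩ʳ_) ∘ lookup xs
      s  = tabulate (rank x)
      s′ = tabulate (rank y)
      tabulated : ∀ {m} (p : Fin k → Fin m) → SameOrder (lookup (tabulate (rank p))) p
      tabulated p i j = trans (rank-sameOrder p i j)
        (sym (cong₂ le (Vec.lookup∘tabulate (rank p) i) (Vec.lookup∘tabulate (rank p) j)))
      same : SameOrder (lookup s) x
      same = tabulated x
      same′ : SameOrder (lookup s′) y
      same′ = tabulated y
      x-injective : Injective _≡_ _≡_ x
      x-injective = distinct-true xs eq
      y-injective : Injective _≡_ _≡_ y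
      y-injective yi≡yj = x-injective (trans (sym (Perm.inverseˡ τ)) (trans (cong (τ ⟨$⟩ˡ_) yi≡yj) (Perm.inverseˡ τ)))
      one : coefficient s s′ * hits s s′ xs ≡ value (lookup s) (lookup s′)
      one rewrite distinct-intro s (sameOrder-injective (lookup s) x same x-injective)
                | distinct-intro s′ (sameOrder-injective (lookup s′) y same′ y-injective)
                | matches-intro (lookup s) x same | matches-intro (lookup s′) y same′ =
        trans (ℤ.*-identityʳ (1ℤ * value (lookup s) (lookup s′))) (ℤ.*-identityˡ (value (lookup s) (lookup s′)))

    -- A table with repetitions has coefficient zero; two tables without are permutations, and their
    -- hits are the occurrences of one permutation by `∑-joint-matches`.
    ∑-hits-bound : ∀ {c M} → (∀ π → c * + occurrences {k} π τ ≤ M) → ∀ s s′ →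
                   c * (coefficient s s′ * ∑ᵛ k (hits s s′)) ≤ coefficient s s′ * M
    ∑-hits-bound {c} {M} occ≤M s s′ with distinct s in eq | distinct s′ in eq′
    ... | false | _     = ℤ.≤-reflexive (ℤ.*-zeroʳ c)
    ... | true  | false = ℤ.≤-reflexive (ℤ.*-zeroʳ c)
    ... | true  | true  = subst (_≤ (1ℤ * value (lookup s) (lookup s′)) * M)
      (exchange (1ℤ * value (lookup s) (lookup s′)) c (∑ᵛ k (hits s s′)))
      (*-monoˡ {c = 1ℤ * value (lookup s) (lookup s′)}
        (nonneg-* {1ℤ} nonneg-pos (nonneg (lookup s) (lookup s′)))
        (subst (λ z → c * z ≤ M) (sym (∑-joint-matches σ ρ τ)) (occ≤M (Perm.flip σ Perm.∘ₚ ρ))))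
      where
      σ = fromInjective (lookup s) (distinct-true s eq)
      ρ = fromInjective (lookup s′) (distinct-true s′ eq′)
      exchange : ∀ x y z → x * (y * z) ≡ y * (x * z)
      exchange = solve-∀

    ∑-value-bound : ∀ {c M} → 0ℤ ≤ c → (∀ π → c * + occurrences {k} π τ ≤ M) →
      c * ∑ᵛ k (λ xs → value (lookup xs) ((τ ⟨$⟩ʳ_) ∘ lookup xs)) ≤ c * (bound * repeats n k) + totalWeight * M
    ∑-value-bound {c} {M} 0≤c occ≤M = begin
      c * ∑ᵛ k (λ xs → value (lookup xs) ((τ ⟨$⟩ʳ_) ∘ lookup xs))
        ≤⟨ *-monoˡ {c = c} 0≤c (∑ᵛ-mono k value-expansion) ⟩
      c * ∑ᵛ k (λ xs → bound * 𝟙 (not (distinct xs)) + ∑ᵛ k (λ s → ∑ᵛ k (λ s′ → coefficient s s′ * hits s s′ xs)))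
        ≡⟨ cong (λ z → c * z) (trans (∑ᵛ-+ k (λ xs → bound * 𝟙 (not (distinct xs))) _)
                                   (cong₂ _+_ (∑ᵛ-*ˡ k bound (λ xs → 𝟙 (not (distinct xs)))) swap)) ⟩
      c * (bound * repeats n k + ∑ᵛ k (λ s → ∑ᵛ k (λ s′ → coefficient s s′ * ∑ᵛ k (hits s s′))))
        ≡⟨ ℤ.*-distribˡ-+ c (bound * repeats n k) _ ⟩
      c * (bound * repeats n k) + c * ∑ᵛ k (λ s → ∑ᵛ k (λ s′ → coefficient s s′ * ∑ᵛ k (hits s s′)))
        ≡⟨ cong (λ z → c * (bound * repeats n k) + z)
             (sym (trans (∑ᵛ-cong k (λ s → ∑ᵛ-*ˡ k c (λ s′ → coefficient s s′ * ∑ᵛ k (hits s s′))))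
                         (∑ᵛ-*ˡ k c (λ s → ∑ᵛ k (λ s′ → coefficient s s′ * ∑ᵛ k (hits s s′)))))) ⟩
      c * (bound * repeats n k) + ∑ᵛ k (λ s → ∑ᵛ k (λ s′ → c * (coefficient s s′ * ∑ᵛ k (hits s s′))))
        ≤⟨ ℤ.+-monoʳ-≤ (c * (bound * repeats n k)) (∑ᵛ-mono k (λ s → ∑ᵛ-mono k (λ s′ → ∑-hits-bound {c} occ≤M s s′))) ⟩
      c * (bound * repeats n k) + ∑ᵛ k (λ s → ∑ᵛ k (λ s′ → coefficient s s′ * M))
        ≡⟨ cong (λ z → c * (bound * repeats n k) + z)
             (trans (∑ᵛ-cong k (λ s → ∑ᵛ-*ʳ k M (coefficient s))) (∑ᵛ-*ʳ k M (λ s → ∑ᵛ k (coefficient s)))) ⟩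
      c * (bound * repeats n k) + totalWeight * M ∎
      where
      open ℤ.≤-Reasoning
      swap : ∑ᵛ k (λ xs → ∑ᵛ k (λ s → ∑ᵛ k (λ s′ → coefficient s s′ * hits s s′ xs))) ≡
             ∑ᵛ k (λ s → ∑ᵛ k (λ s′ → coefficient s s′ * ∑ᵛ k (hits s s′)))
      swap = trans (∑ᵛ-comm k k (λ xs s → ∑ᵛ k (λ s′ → coefficient s s′ * hits s s′ xs)))
        (∑ᵛ-cong k (λ s → trans (∑ᵛ-comm k k (λ xs s′ → coefficient s s′ * hits s s′ xs))
          (∑ᵛ-cong k (λ s′ → ∑ᵛ-*ˡ k (coefficient s s′) (hits s s′)))))

open KernelSum

-- The four-point kernel

χ : ∀ {k n} → (Fin k → Fin n) → Fin k → Fin k → Bool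
χ p i j = lt (p i) (p j)

-- The energies put weight -2 on the third event. Putting 2 on its complement instead keeps the
-- kernel nonnegative, at the price of a constant 2 per tuple.
combine : Bool → Bool → Bool → ℤ
combine a b c = + 2 * 𝟙 a + 𝟙 b + + 2 * 𝟙 (not c)

combine-nonneg : ∀ a b c → 0ℤ ≤ combine a b c
combine-nonneg true  true  true  = nonneg-pos
combine-nonneg true  true  false = nonneg-pos
combine-nonneg true  false true  = nonneg-pos
combine-nonneg true  false false = nonneg-pos
combine-nonneg false true  true  = nonneg-pos
combine-nonneg false true  false = nonneg-pos
combine-nonneg false false true  = nonneg-pos
combine-nonneg false false false = nonneg-pos

combine≤5 : ∀ a b c → combine a b c ≤ + 5
combine≤5 a b c = ℤ.+-mono-≤ (ℤ.+-mono-≤ (*-monoˡ {c = + 2} nonneg-pos (𝟙≤1 a)) (𝟙≤1 b))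
                             (*-monoˡ {c = + 2} nonneg-pos (𝟙≤1 (not c)))

-- With x = (i, a, b, c) and y = τ x, these count a, b ∈ [0,i) × [0,τc); a, b ∈ [0,i) × [0,τi);
-- and a ∈ [0,i) × [0,τi) with b < i and τc < τi.
quadrants : OrderKernel 4
quadrants = record
  { value     = value
  ; bound     = + 5
  ; nonneg    = λ x y → combine-nonneg (A x y) (B x y) (C x y)
  ; bounded   = λ x y → combine≤5 (A x y) (B x y) (C x y)
  ; invariant = invariant
  }
  where
  A B C : ∀ {m n} → (Fin 4 → Fin m) → (Fin 4 → Fin n) → Bool
  A x y = (χ x 1F 0F ∧ χ y 1F 3F) ∧ (χ x 2F 0F ∧ χ y 2F 3F)
  B x y = (χ x 1F 0F ∧ χ y 1F 0F) ∧ (χ x 2F 0F ∧ χ y 2F 0F)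
  C x y = (χ x 1F 0F ∧ χ y 1F 0F) ∧ (χ x 2F 0F ∧ χ y 3F 0F)
  value : ∀ {m n} → (Fin 4 → Fin m) → (Fin 4 → Fin n) → ℤ
  value x y = combine (A x y) (B x y) (C x y)
  invariant : ∀ {m n m′ n′} (s : Fin 4 → Fin m′) (s′ : Fin 4 → Fin n′) (x : Fin 4 → Fin m) (y : Fin 4 → Fin n) →
              SameOrder s x → SameOrder s′ y → value x y ≡ value s s′
  invariant s s′ x y sx s′y
    rewrite sameOrder-lt s x sx 1F 0F | sameOrder-lt s x sx 2F 0F
          | sameOrder-lt s′ y s′y 1F 3F | sameOrder-lt s′ y s′y 2F 3F
          | sameOrder-lt s′ y s′y 1F 0F | sameOrder-lt s′ y s′y 2F 0F | sameOrder-lt s′ y s′y 3F 0F = refl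

-- 1216 = 24² (2 · 1/9 + 1/9 + 2 · 8/9)
totalWeight-quadrants : totalWeight quadrants ≡ + 1216
totalWeight-quadrants = refl

-- The discrepancy of a permutation

sum-linear : ∀ {n} a b c (f g h : Fin n → ℤ) →
             sum (λ i → a * f i + b * g i + c * h i) ≡ a * sum f + b * sum g + c * sum h
sum-linear {n} a b c f g h = begin
  sum (λ i → a * f i + b * g i + c * h i)
    ≡⟨ sum-+ {n} (λ i → a * f i + b * g i) (λ i → c * h i) ⟩
  sum (λ i → a * f i + b * g i) + sum (λ i → c * h i)
    ≡⟨ cong (λ s → s + sum (λ i → c * h i)) (sum-+ {n} (λ i → a * f i) (λ i → b * g i)) ⟩
  sum (λ i → a * f i) + sum (λ i → b * g i) + sum (λ i → c * h i)
    ≡⟨ cong₂ _+_ (cong₂ _+_ (sum-*ˡ {n} a f) (sum-*ˡ {n} b g)) (sum-*ˡ {n} c h) ⟩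
  a * sum f + b * sum g + c * sum h ∎
  where open ≡-Reasoning

ι : ∀ {n} → Fin n → ℤ
ι i = + toℕ i

∑ι : ℕ → ℤ
∑ι n = sum {n} ι

∑ι² : ℕ → ℤ
∑ι² n = sum {n} (λ i → ι i * ι i)

∑ι-suc : ∀ n → ∑ι (suc n) ≡ + n + ∑ι n
∑ι-suc n = begin
  0ℤ + sum {n} (λ i → 1ℤ + ι i)        ≡⟨ ℤ.+-identityˡ _ ⟩
  sum {n} (λ i → 1ℤ + ι i)             ≡⟨ sum-+ {n} (λ _ → 1ℤ) ι ⟩
  sum {n} (λ _ → 1ℤ) + ∑ι n            ≡⟨ cong (λ s → s + ∑ι n) (trans (sum-const n 1ℤ) (ℤ.*-identityʳ (+ n))) ⟩
  + n + ∑ι n                           ∎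
  where open ≡-Reasoning

∑ι-closed : ∀ n → + 2 * ∑ι n ≡ + n * (+ n - 1ℤ)
∑ι-closed zero    = refl
∑ι-closed (suc n) = trans (cong (λ s → + 2 * s) (∑ι-suc n)) (trans (lem (+ n) (∑ι n))
  (trans (cong (λ s → + 2 * + n + s) (∑ι-closed n)) (lem′ (+ n))))
  where
  lem : ∀ N s → + 2 * (N + s) ≡ + 2 * N + + 2 * s
  lem = solve-∀
  lem′ : ∀ N → + 2 * N + N * (N - 1ℤ) ≡ (1ℤ + N) * (1ℤ + N - 1ℤ)
  lem′ = solve-∀

∑ι²-closed : ∀ n → + 6 * ∑ι² n ≡ + n * (+ n - 1ℤ) * (+ 2 * + n - 1ℤ)
∑ι²-closed zero    = refl
∑ι²-closed (suc n) = begin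
  + 6 * (0ℤ + sum {n} (λ i → (1ℤ + ι i) * (1ℤ + ι i)))
    ≡⟨ cong (λ s → + 6 * s) (trans (ℤ.+-identityˡ _) (sum-cong-≗ {n} (λ i → square (ι i)))) ⟩
  + 6 * sum {n} (λ i → 1ℤ * 1ℤ + + 2 * ι i + 1ℤ * (ι i * ι i))
    ≡⟨ cong (λ s → + 6 * s) (sum-linear {n} 1ℤ (+ 2) 1ℤ (λ _ → 1ℤ) ι (λ i → ι i * ι i)) ⟩
  + 6 * (1ℤ * sum {n} (λ _ → 1ℤ) + + 2 * ∑ι n + 1ℤ * ∑ι² n)
    ≡⟨ cong₂ (λ s t → + 6 * (1ℤ * s + t + 1ℤ * ∑ι² n)) (trans (sum-const n 1ℤ) (ℤ.*-identityʳ (+ n))) (∑ι-closed n) ⟩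
  + 6 * (1ℤ * + n + + n * (+ n - 1ℤ) + 1ℤ * ∑ι² n)
    ≡⟨ expand (+ n) (∑ι² n) ⟩
  + 6 * (+ n * + n) + + 6 * ∑ι² n
    ≡⟨ cong (λ s → + 6 * (+ n * + n) + s) (∑ι²-closed n) ⟩
  + 6 * (+ n * + n) + + n * (+ n - 1ℤ) * (+ 2 * + n - 1ℤ)
    ≡⟨ collect (+ n) ⟩
  (1ℤ + + n) * (1ℤ + + n - 1ℤ) * (+ 2 * (1ℤ + + n) - 1ℤ) ∎
  where
  open ≡-Reasoning
  square : ∀ x → (1ℤ + x) * (1ℤ + x) ≡ 1ℤ * 1ℤ + + 2 * x + 1ℤ * (x * x)
  square = solve-∀
  expand : ∀ N s → + 6 * (1ℤ * N + N * (N - 1ℤ) + 1ℤ * s) ≡ + 6 * (N * N) + + 6 * s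
  expand = solve-∀
  collect : ∀ N → + 6 * (N * N) + N * (N - 1ℤ) * (+ 2 * N - 1ℤ) ≡ (1ℤ + N) * (1ℤ + N - 1ℤ) * (+ 2 * (1ℤ + N) - 1ℤ)
  collect = solve-∀

sum-above : ∀ {n} (a : Fin n) → sum {n} (λ i → below a (toℕ i)) + ι a + 1ℤ ≡ + n
sum-above {suc n} zero = trans (cong (λ s → 0ℤ + s + 0ℤ + 1ℤ) (trans (sum-const n 1ℤ) (ℤ.*-identityʳ (+ n)))) (lem
    (+ n))
  where
  lem : ∀ N → 0ℤ + N + 0ℤ + 1ℤ ≡ 1ℤ + N
  lem = solve-∀
sum-above {suc n} (suc a) = trans (lem (sum {n} (λ i → below a (toℕ i))) (ι a)) (cong (λ s → 1ℤ + s) (sum-above a))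
  where
  lem : ∀ s x → 0ℤ + s + (1ℤ + x) + 1ℤ ≡ 1ℤ + (s + x + 1ℤ)
  lem = solve-∀

∑ι-above : ∀ {n} → Fin n → ℤ
∑ι-above {n} a = sum {n} (λ i → below a (toℕ i) * ι i)

-- The sum is quadratic in `a`; its product with the one at `τ(a)` is the source of the moment Σ a²
-- τ(a)².
∑ι-above-closed : ∀ {n} (a : Fin n) → + 2 * ∑ι-above a ≡ + n * (+ n - 1ℤ) - (ι a * ι a + ι a)
∑ι-above-closed {suc n} zero = begin
  + 2 * (0ℤ * 0ℤ + sum {n} (λ i → 1ℤ * ι (suc i)))
    ≡⟨ cong (λ s → + 2 * (0ℤ * 0ℤ + s)) (sum-cong-≗ {n} (λ i → ℤ.*-identityˡ (ι (suc i)))) ⟩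
  + 2 * ∑ι (suc n)                    ≡⟨ ∑ι-closed (suc n) ⟩
  + suc n * (+ suc n - 1ℤ)            ≡⟨ sym (ℤ.+-identityʳ _) ⟩
  + suc n * (+ suc n - 1ℤ) - (0ℤ * 0ℤ + 0ℤ) ∎
  where open ≡-Reasoning
∑ι-above-closed {suc n} (suc a) = begin
  + 2 * (0ℤ + sum {n} (λ i → below a (toℕ i) * (1ℤ + ι i)))
    ≡⟨ cong (λ s → + 2 * (0ℤ + s)) (trans (sum-cong-≗ {n} (λ i → distrib (below a (toℕ i)) (ι i)))
                                          (sum-+ {n} (λ i → below a (toℕ i)) (λ i → below a (toℕ i) * ι i))) ⟩
  + 2 * (0ℤ + (U + ∑ι-above a))
    ≡⟨ expand U (∑ι-above a) (ι a) ⟩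
  + 2 * (U + ι a + 1ℤ) + + 2 * ∑ι-above a - + 2 * (ι a + 1ℤ)
    ≡⟨ cong₂ (λ s t → + 2 * s + t - + 2 * (ι a + 1ℤ)) (sum-above a) (∑ι-above-closed a) ⟩
  + 2 * + n + (+ n * (+ n - 1ℤ) - (ι a * ι a + ι a)) - + 2 * (ι a + 1ℤ)
    ≡⟨ collect (+ n) (ι a) ⟩
  (1ℤ + + n) * (1ℤ + + n - 1ℤ) - ((1ℤ + ι a) * (1ℤ + ι a) + (1ℤ + ι a)) ∎
  where
  open ≡-Reasoning
  U = sum {n} (λ i → below a (toℕ i))
  distrib : ∀ b x → b * (1ℤ + x) ≡ b + b * x
  distrib = solve-∀
  expand : ∀ u t x → + 2 * (0ℤ + (u + t)) ≡ + 2 * (u + x + 1ℤ) + + 2 * t - + 2 * (x + 1ℤ)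
  expand = solve-∀
  collect : ∀ N x → + 2 * N + (N * (N - 1ℤ) - (x * x + x)) - + 2 * (x + 1ℤ) ≡ (1ℤ + N) * (1ℤ + N - 1ℤ) - ((1ℤ + x) *
      (1ℤ + x) + (1ℤ + x))
  collect = solve-∀

𝟙-∧ : ∀ a b → 𝟙 (a ∧ b) ≡ 𝟙 a * 𝟙 b
𝟙-∧ true  b = sym (ℤ.*-identityˡ (𝟙 b))
𝟙-∧ false b = refl

-- The two energies and their four-point part

module Energy {n} (τ : Perm n) where
  private
    N = + n
    t′ : Fin n → Fin n
    t′ = τ ⟨$⟩ʳ_

  -- Corners are naturals from 0 to `n`, one value more than `Fin n` has: the upper ends of
  -- intervals may be `n`.
  dominated : ℕ → ℕ → ℤ
  dominated h h′ = sum {n} (λ a → below a h * below (τ ⟨$⟩ʳ a) h′)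

  discrepancy : ℕ → ℕ → ℤ
  discrepancy h h′ = N * dominated h h′ - + h * + h′

  gridEnergy : ℤ
  gridEnergy = sum {n} (λ i → sum {n} (λ j → discrepancy (toℕ i) (toℕ j) * discrepancy (toℕ i) (toℕ j)))

  graphEnergy : ℤ
  graphEnergy = sum {n} (λ i → discrepancy (toℕ i) (toℕ (t′ i)) * discrepancy (toℕ i) (toℕ (t′ i)))

  private
    F : Fin n → Fin n → ℤ
    F i j = dominated (toℕ i) (toℕ j)
    v : Fin n → Fin n → Fin n → ℤ
    v i j a = below a (toℕ i) * below (t′ a) (toℕ j)

    gridF² gridFι : ℤ
    gridF² = sum {n} (λ i → sum {n} (λ j → F i j * F i j))
    gridFι = sum {n} (λ i → sum {n} (λ j → F i j * (ι i * ι j)))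

    graphF² graphFι graphι² : ℤ
    graphF² = sum {n} (λ i → F i (t′ i) * F i (t′ i))
    graphFι = sum {n} (λ i → F i (t′ i) * (ι i * ι (t′ i)))
    graphι² = sum {n} (λ i → (ι i * ι (t′ i)) * (ι i * ι (t′ i)))

    square : ∀ N f p → (N * f - p) * (N * f - p) ≡ (N * N) * (f * f) + (- (+ 2 * N)) * (f * p) + 1ℤ * (p * p)
    square = solve-∀

    square′ : ∀ N f x y → (N * f - x * y) * (N * f - x * y) ≡
              (N * N) * (f * f) + (- (+ 2 * N)) * (f * (x * y)) + 1ℤ * ((x * x) * (y * y))
    square′ = solve-∀

    gridEnergy-expand : gridEnergy ≡ (N * N) * gridF² + (- (+ 2 * N)) * gridFι + 1ℤ * (∑ι² n * ∑ι² n)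
    gridEnergy-expand = begin
      gridEnergy
        ≡⟨ sum-cong-≗ {n} (λ i → sum-cong-≗ {n} (λ j → square′ N (F i j) (ι i) (ι j))) ⟩
      sum {n} (λ i → sum {n} (λ j → (N * N) * (F i j * F i j) + (- (+ 2 * N)) * (F i j * (ι i * ι j)) + 1ℤ *
          ((ι i * ι i) * (ι j * ι j))))
        ≡⟨ sum-cong-≗ {n} (λ i → sum-linear {n} (N * N) (- (+ 2 * N)) 1ℤ (λ j → F i j * F i j) (λ j → F i j *
            (ι i * ι j)) (λ j → (ι i * ι i) * (ι j * ι j))) ⟩
      sum {n} (λ i → (N * N) * sum {n} (λ j → F i j * F i j) + (- (+ 2 * N)) * sum {n} (λ j → F i j *
          (ι i * ι j)) + 1ℤ * sum {n} (λ j → (ι i * ι i) * (ι j * ι j)))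
        ≡⟨ sum-linear {n} (N * N) (- (+ 2 * N)) 1ℤ (λ i → sum {n} (λ j → F i j * F i j)) (λ i → sum {n}
            (λ j → F i j * (ι i * ι j))) (λ i → sum {n} (λ j → (ι i * ι i) * (ι j * ι j))) ⟩
      (N * N) * gridF² + (- (+ 2 * N)) * gridFι + 1ℤ * sum {n} (λ i → sum {n} (λ j → (ι i * ι i) * (ι j * ι j)))
        ≡⟨ cong (λ s → (N * N) * gridF² + (- (+ 2 * N)) * gridFι + 1ℤ * s) (sum-product {n} {n} (λ i → ι i * ι i)
            (λ j → ι j * ι j)) ⟩
      (N * N) * gridF² + (- (+ 2 * N)) * gridFι + 1ℤ * (∑ι² n * ∑ι² n) ∎
      where open ≡-Reasoning

    graphEnergy-expand : graphEnergy ≡ (N * N) * graphF² + (- (+ 2 * N)) * graphFι + 1ℤ * graphι²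
    graphEnergy-expand =
      trans (sum-cong-≗ {n} (λ i → square N (F i (t′ i)) (ι i * ι (t′ i))))
            (sum-linear {n} (N * N) (- (+ 2 * N)) 1ℤ (λ i → F i (t′ i) * F i (t′ i)) (λ i → F i (t′ i) * (ι i * ι
                (t′ i)))
                        (λ i → (ι i * ι (t′ i)) * (ι i * ι (t′ i))))

    -- After exchanging sums, each point `a` contributes over the grid points above and to the right
    -- of it, and that contribution factors into a sum over columns and one over rows.
    gridFι-expand : gridFι ≡ sum {n} (λ a → ∑ι-above a * ∑ι-above (t′ a))
    gridFι-expand = begin
      sum {n} (λ i → sum {n} (λ j → F i j * (ι i * ι j)))
        ≡⟨ sum-cong-≗ {n} (λ i → sum-cong-≗ {n} (λ j → trans (ℤ.*-comm (F i j) (ι i * ι j)) (sym (sum-*ˡ {n}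
            (ι i * ι j) (v i j))))) ⟩
      sum {n} (λ i → sum {n} (λ j → sum {n} (λ a → (ι i * ι j) * v i j a)))
        ≡⟨ sum-cong-≗ {n} (λ i → ∑-comm {n} {n} (λ j a → (ι i * ι j) * v i j a)) ⟩
      sum {n} (λ i → sum {n} (λ a → sum {n} (λ j → (ι i * ι j) * v i j a)))
        ≡⟨ ∑-comm {n} {n} (λ i a → sum {n} (λ j → (ι i * ι j) * v i j a)) ⟩
      sum {n} (λ a → sum {n} (λ i → sum {n} (λ j → (ι i * ι j) * v i j a)))
        ≡⟨ sum-cong-≗ {n} (λ a → sum-cong-≗ {n} (λ i → sum-cong-≗ {n} (λ j → regroup (ι i) (ι j) (below a (toℕ i))
            (below (t′ a) (toℕ j))))) ⟩
      sum {n} (λ a → sum {n} (λ i → sum {n} (λ j → (below a (toℕ i) * ι i) * (below (t′ a) (toℕ j) * ι j))))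
        ≡⟨ sum-cong-≗ {n} (λ a → sum-product {n} {n} (λ i → below a (toℕ i) * ι i) (λ j → below (t′ a) (toℕ j) * ι j)) ⟩
      sum {n} (λ a → ∑ι-above a * ∑ι-above (t′ a)) ∎
      where
      open ≡-Reasoning
      regroup : ∀ x y b c → (x * y) * (b * c) ≡ (b * x) * (c * y)
      regroup = solve-∀

    -- Twice `0 + … + a`, so that `+ 2 * ∑ι-above a` is `m - p a`.
    p : Fin n → ℤ
    p a = ι a * ι a + ι a

    ∑p : sum {n} p ≡ ∑ι² n + ∑ι n
    ∑p = sum-+ {n} (λ a → ι a * ι a) ι

    ∑pτ : sum {n} (λ a → p (t′ a)) ≡ ∑ι² n + ∑ι n
    ∑pτ = trans (sym (sum-permute {n} {n} p τ)) ∑p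

    m = N * (N - 1ℤ)

    gridFι-closed : + 4 * gridFι ≡ N * (m * m) - + 2 * m * (∑ι² n + ∑ι n) + sum {n} (λ a → p a * p (t′ a))
    gridFι-closed = begin
      + 4 * gridFι
        ≡⟨ cong (λ s → + 4 * s) gridFι-expand ⟩
      + 4 * sum {n} (λ a → ∑ι-above a * ∑ι-above (t′ a))
        ≡⟨ sym (sum-*ˡ {n} (+ 4) (λ a → ∑ι-above a * ∑ι-above (t′ a))) ⟩
      sum {n} (λ a → + 4 * (∑ι-above a * ∑ι-above (t′ a)))
        ≡⟨ sum-cong-≗ {n} (λ a → trans (double (∑ι-above a) (∑ι-above (t′ a))) (cong₂ _*_ (∑ι-above-closed a)
            (∑ι-above-closed (t′ a)))) ⟩
      sum {n} (λ a → (m - p a) * (m - p (t′ a)))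
        ≡⟨ sum-cong-≗ {n} (λ a → expand m (p a) (p (t′ a))) ⟩
      sum {n} (λ a → 1ℤ * (m * m) + (- m) * (p a + p (t′ a)) + 1ℤ * (p a * p (t′ a)))
        ≡⟨ sum-linear {n} 1ℤ (- m) 1ℤ (λ _ → m * m) (λ a → p a + p (t′ a)) (λ a → p a * p (t′ a)) ⟩
      1ℤ * sum {n} (λ _ → m * m) + (- m) * sum {n} (λ a → p a + p (t′ a)) + 1ℤ * sum {n} (λ a → p a * p (t′ a))
        ≡⟨ cong₂ (λ s u → 1ℤ * s + (- m) * u + 1ℤ * sum {n} (λ a → p a * p (t′ a))) (sum-const n (m * m))
             (trans (sum-+ {n} p (λ a → p (t′ a))) (cong₂ _+_ ∑p ∑pτ)) ⟩
      1ℤ * (N * (m * m)) + (- m) * ((∑ι² n + ∑ι n) + (∑ι² n + ∑ι n)) + 1ℤ * sum {n} (λ a → p a * p (t′ a))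
        ≡⟨ collect N m (∑ι² n + ∑ι n) (sum {n} (λ a → p a * p (t′ a))) ⟩
      N * (m * m) - + 2 * m * (∑ι² n + ∑ι n) + sum {n} (λ a → p a * p (t′ a)) ∎
      where
      open ≡-Reasoning
      double : ∀ x y → + 4 * (x * y) ≡ (+ 2 * x) * (+ 2 * y)
      double = solve-∀
      expand : ∀ m x y → (m - x) * (m - y) ≡ 1ℤ * (m * m) + (- m) * (x + y) + 1ℤ * (x * y)
      expand = solve-∀
      collect : ∀ N m P s → 1ℤ * (N * (m * m)) + (- m) * (P + P) + 1ℤ * s ≡ N * (m * m) - + 2 * m * P + s
      collect = solve-∀

    graphι²≤ : graphι² ≤ sum {n} (λ a → p a * p (t′ a))
    graphι²≤ = sum-mono {n} (λ a → ≤-by-gap (lem (ι a) (ι (t′ a)))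
      (nonneg-+ (nonneg-+ (nonneg-* (nonneg-* {ι a} {ι a} nonneg-pos nonneg-pos) (nonneg-pos {toℕ (t′ a)})) (nonneg-*
          (nonneg-pos {toℕ a}) (nonneg-* {ι (t′ a)} {ι (t′ a)} nonneg-pos nonneg-pos))) (nonneg-* {ι a} {ι
          (t′ a)} nonneg-pos nonneg-pos)))
      where
      lem : ∀ x y → (x * x + x) * (y * y + y) - (x * y) * (x * y) ≡ x * x * y + x * (y * y) + x * y
      lem = solve-∀

  quadrantCount : ℤ
  quadrantCount = ∑ᵛ 4 (λ xs → OrderKernel.value quadrants (lookup xs) ((τ ⟨$⟩ʳ_) ∘ lookup xs))

  private
    term : Fin n → Fin n → Fin n → Fin n → ℤ
    term i a b c = combine ((lt a i ∧ lt (t′ a) (t′ c)) ∧ (lt b i ∧ lt (t′ b) (t′ c)))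
                           ((lt a i ∧ lt (t′ a) (t′ i)) ∧ (lt b i ∧ lt (t′ b) (t′ i)))
                           ((lt a i ∧ lt (t′ a) (t′ i)) ∧ (lt b i ∧ lt (t′ c) (t′ i)))

    ∧⁴ : ∀ a b c d → 𝟙 ((a ∧ b) ∧ (c ∧ d)) ≡ (𝟙 a * 𝟙 b) * (𝟙 c * 𝟙 d)
    ∧⁴ a b c d = trans (𝟙-∧ (a ∧ b) (c ∧ d)) (cong₂ _*_ (𝟙-∧ a b) (𝟙-∧ c d))

    𝟙-not : ∀ a → 𝟙 (not a) ≡ 1ℤ - 𝟙 a
    𝟙-not true  = refl
    𝟙-not false = refl

    x₁ x₂ x₃ : Fin n → Fin n → Fin n → Fin n → ℤ
    x₁ i a b c = v i (t′ c) a * v i (t′ c) b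
    x₂ i a b c = v i (t′ i) a * v i (t′ i) b
    x₃ i a b c = v i (t′ i) a * (below b (toℕ i) * below (t′ c) (toℕ (t′ i)))

    term-expand : ∀ i a b c → term i a b c ≡ + 2 * x₁ i a b c + 1ℤ * (x₂ i a b c + + 2) + (- + 2) * x₃ i a b c
    term-expand i a b c =
      trans (cong₂ (λ s u → + 2 * s + u + + 2 * 𝟙 (not ((lt a i ∧ lt (t′ a) (t′ i)) ∧ (lt b i ∧ lt (t′ c) (t′ i)))))
                   (∧⁴ (lt a i) (lt (t′ a) (t′ c)) (lt b i) (lt (t′ b) (t′ c)))
                   (∧⁴ (lt a i) (lt (t′ a) (t′ i)) (lt b i) (lt (t′ b) (t′ i))))
      (trans (cong (λ s → + 2 * x₁ i a b c + x₂ i a b c + + 2 * s)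
                   (trans (𝟙-not ((lt a i ∧ lt (t′ a) (t′ i)) ∧ (lt b i ∧ lt (t′ c) (t′ i))))
                          (cong (λ s → 1ℤ - s) (∧⁴ (lt a i) (lt (t′ a) (t′ i)) (lt b i) (lt (t′ c) (t′ i))))))
             (lem (x₁ i a b c) (x₂ i a b c) (x₃ i a b c)))
      where
      lem : ∀ x y z → + 2 * x + y + + 2 * (1ℤ - z) ≡ + 2 * x + 1ℤ * (y + + 2) + (- + 2) * z
      lem = solve-∀

    ∑⁴ : (Fin n → Fin n → Fin n → Fin n → ℤ) → ℤ
    ∑⁴ f = sum {n} (λ i → sum {n} (λ a → sum {n} (λ b → sum {n} (λ c → f i a b c))))

    ∑⁴-linear : ∀ a b c f g h → ∑⁴ (λ i j k l → a * f i j k l + b * g i j k l + c * h i j k l) ≡ a * ∑⁴ f + b * ∑⁴ g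
        + c * ∑⁴ h
    ∑⁴-linear a b c f g h =
      trans (sum-cong-≗ {n} (λ i →
        trans (sum-cong-≗ {n} (λ j →
          trans (sum-cong-≗ {n} (λ k → sum-linear {n} a b c (f i j k) (g i j k) (h i j k)))
                (sum-linear {n} a b c (λ k → sum {n} (f i j k)) (λ k → sum {n} (g i j k)) (λ k → sum {n} (h i j k)))))
              (sum-linear {n} a b c (λ j → sum {n} (λ k → sum {n} (f i j k))) (λ j → sum {n} (λ k → sum {n}
                  (g i j k))) (λ j → sum {n} (λ k → sum {n} (h i j k))))))
      (sum-linear {n} a b c (λ i → sum {n} (λ j → sum {n} (λ k → sum {n} (f i j k)))) (λ i → sum {n} (λ j → sum {n}
          (λ k → sum {n} (g i j k)))) (λ i → sum {n} (λ j → sum {n} (λ k → sum {n} (h i j k)))))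

    -- The point `c` only names a row: as `c` runs over all points, `τ(c)` runs over all rows. For
    -- fixed `i` and `c` the points `a` and `b` are independent, which gives the square.
    ∑x₁ : ∑⁴ x₁ ≡ gridF²
    ∑x₁ = sum-cong-≗ {n} (λ i → begin
      sum {n} (λ a → sum {n} (λ b → sum {n} (λ c → v i (t′ c) a * v i (t′ c) b)))
        ≡⟨ sum-cong-≗ {n} (λ a → ∑-comm {n} {n} (λ b c → v i (t′ c) a * v i (t′ c) b)) ⟩
      sum {n} (λ a → sum {n} (λ c → sum {n} (λ b → v i (t′ c) a * v i (t′ c) b)))
        ≡⟨ ∑-comm {n} {n} (λ a c → sum {n} (λ b → v i (t′ c) a * v i (t′ c) b)) ⟩
      sum {n} (λ c → sum {n} (λ a → sum {n} (λ b → v i (t′ c) a * v i (t′ c) b)))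
        ≡⟨ sum-cong-≗ {n} (λ c → sum-product {n} {n} (v i (t′ c)) (v i (t′ c))) ⟩
      sum {n} (λ c → F i (t′ c) * F i (t′ c))
        ≡⟨ sym (sum-permute {n} {n} (λ j → F i j * F i j) τ) ⟩
      sum {n} (λ j → F i j * F i j) ∎)
      where open ≡-Reasoning

    -- The point `c` is free and supplies the factor `N` that multiplies `graphEnergy` in
    -- `energy-bound`; the constant 2 comes from the complement in `combine`.
    ∑x₂ : ∑⁴ (λ i a b c → x₂ i a b c + + 2) ≡ N * graphF² + + 2 * (N * N * N * N)
    ∑x₂ = begin
      ∑⁴ (λ i a b c → x₂ i a b c + + 2)
        ≡⟨ sum-cong-≗ {n} (λ i → sum-cong-≗ {n} (λ a → sum-cong-≗ {n} (λ b → sum-const n (x₂ i a b a + + 2)))) ⟩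
      sum {n} (λ i → sum {n} (λ a → sum {n} (λ b → N * (x₂ i a b a + + 2))))
        ≡⟨ sum-cong-≗ {n} (λ i → sum-cong-≗ {n} (λ a → trans (sum-cong-≗ {n} (λ b → ℤ.*-distribˡ-+ N (x₂ i a b a)
            (+ 2)))
             (trans (sum-+ {n} (λ b → N * x₂ i a b a) (λ _ → N * + 2)) (cong₂ _+_ (sum-*ˡ {n} N (λ b → x₂ i a b a))
                 (sum-const n (N * + 2)))))) ⟩
      sum {n} (λ i → sum {n} (λ a → N * sum {n} (λ b → x₂ i a b a) + N * (N * + 2)))
        ≡⟨ sum-cong-≗ {n} (λ i → trans (sum-+ {n} (λ a → N * sum {n} (λ b → x₂ i a b a)) (λ _ → N * (N * + 2)))
             (cong₂ _+_ (trans (sum-*ˡ {n} N (λ a → sum {n} (λ b → x₂ i a b a))) (cong (λ s → N * s)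
                 (sum-product {n} {n} (v i (t′ i)) (v i (t′ i)))))
                        (sum-const n (N * (N * + 2))))) ⟩
      sum {n} (λ i → N * (F i (t′ i) * F i (t′ i)) + N * (N * (N * + 2)))
        ≡⟨ trans (sum-+ {n} (λ i → N * (F i (t′ i) * F i (t′ i))) (λ _ → N * (N * (N * + 2))))
                 (cong₂ _+_ (sum-*ˡ {n} N (λ i → F i (t′ i) * F i (t′ i))) (sum-const n (N * (N * (N * + 2))))) ⟩
      N * graphF² + N * (N * (N * (N * + 2)))
        ≡⟨ cong (λ s → N * graphF² + s) (lem N) ⟩
      N * graphF² + + 2 * (N * N * N * N) ∎
      where
      open ≡-Reasoning
      lem : ∀ N → N * (N * (N * (N * + 2))) ≡ + 2 * (N * N * N * N)
      lem = solve-∀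

    -- Two independent points produce the product `ι i * ι (t′ i)`: `b` with smaller position than
    -- `i`, and `c` with smaller value.
    ∑x₃ : ∑⁴ x₃ ≡ graphFι
    ∑x₃ = sum-cong-≗ {n} (λ i → begin
      sum {n} (λ a → sum {n} (λ b → sum {n} (λ c → v i (t′ i) a * (below b (toℕ i) * below (t′ c) (toℕ (t′ i))))))
        ≡⟨ sum-cong-≗ {n} (λ a → trans (sum-cong-≗ {n} (λ b → sum-*ˡ {n} (v i (t′ i) a) (λ c → below b
            (toℕ i) * below (t′ c) (toℕ (t′ i)))))
             (trans (sum-*ˡ {n} (v i (t′ i) a) (λ b → sum {n} (λ c → below b (toℕ i) * below (t′ c) (toℕ (t′ i)))))
                    (cong (λ s → v i (t′ i) a * s) (ranks i)))) ⟩
      sum {n} (λ a → v i (t′ i) a * (ι i * ι (t′ i)))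
        ≡⟨ trans (sum-cong-≗ {n} (λ a → ℤ.*-comm (v i (t′ i) a) (ι i * ι (t′ i)))) (trans (sum-*ˡ {n} (ι i * ι
            (t′ i)) (v i (t′ i))) (ℤ.*-comm (ι i * ι (t′ i)) (F i (t′ i)))) ⟩
      F i (t′ i) * (ι i * ι (t′ i)) ∎)
      where
      open ≡-Reasoning
      ranks : ∀ i → sum {n} (λ b → sum {n} (λ c → below b (toℕ i) * below (t′ c) (toℕ (t′ i)))) ≡ ι i * ι (t′ i)
      ranks i = trans (sum-product {n} {n} (λ b → below b (toℕ i)) (λ c → below (t′ c) (toℕ (t′ i))))
        (cong₂ _*_ (sum-below {n} (toℕ i) (ℕ.<⇒≤ (Fin.toℕ<n i)))
                   (trans (sym (sum-permute {n} {n} (λ c → below c (toℕ (t′ i))) τ)) (sum-below {n} (toℕ (t′ i))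
                       (ℕ.<⇒≤ (Fin.toℕ<n (t′ i))))))

    quadrantCount-expand : quadrantCount ≡ + 2 * gridF² + 1ℤ * (N * graphF² + + 2 * (N * N * N * N)) + (- + 2) * graphFι
    quadrantCount-expand = begin
      ∑⁴ term ≡⟨ sum-cong-≗ {n} (λ i → sum-cong-≗ {n} (λ a → sum-cong-≗ {n} (λ b → sum-cong-≗ {n}
          (λ c → term-expand i a b c)))) ⟩
      ∑⁴ (λ i a b c → + 2 * x₁ i a b c + 1ℤ * (x₂ i a b c + + 2) + (- + 2) * x₃ i a b c)
        ≡⟨ ∑⁴-linear (+ 2) 1ℤ (- + 2) x₁ (λ i a b c → x₂ i a b c + + 2) x₃ ⟩
      + 2 * ∑⁴ x₁ + 1ℤ * ∑⁴ (λ i a b c → x₂ i a b c + + 2) + (- + 2) * ∑⁴ x₃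
        ≡⟨ cong₂ _+_ (cong₂ (λ s u → + 2 * s + 1ℤ * u) ∑x₁ ∑x₂) (cong (λ s → (- + 2) * s) ∑x₃) ⟩
      + 2 * gridF² + 1ℤ * (N * graphF² + + 2 * (N * N * N * N)) + (- + 2) * graphFι ∎
      where open ≡-Reasoning

    18P : + 18 * (∑ι² n + ∑ι n) ≡ + 6 * (N * N * N - N)
    18P = trans (split (∑ι² n) (∑ι n)) (trans (cong₂ (λ s u → + 3 * s + + 9 * u) (∑ι²-closed n) (∑ι-closed n))
        (collect N))
      where
      split : ∀ s u → + 18 * (s + u) ≡ + 3 * (+ 6 * s) + + 9 * (+ 2 * u)
      split = solve-∀
      collect : ∀ N → + 3 * (N * (N - 1ℤ) * (+ 2 * N - 1ℤ)) + + 9 * (N * (N - 1ℤ)) ≡ + 6 * (N * N * N - N)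
      collect = solve-∀

    3∑ι²≤N³ : 1ℤ ≤ N → + 3 * ∑ι² n ≤ N * N * N
    3∑ι²≤N³ 1≤N = ℤ.*-cancelˡ-≤-pos (+ 3 * ∑ι² n) (N * N * N) (+ 2) (≤-by-gap
      (trans (cong (λ s → + 2 * (N * N * N) - s) (trans (double (∑ι² n)) (∑ι²-closed n))) (lem N))
      (nonneg-+ (nonneg-* {+ 2} nonneg-pos (nonneg-* {N} {N} nonneg-pos nonneg-pos)) (nonneg-* {N} nonneg-pos
          (gap 1≤N))))
      where
      double : ∀ s → + 2 * (+ 3 * s) ≡ + 6 * s
      double = solve-∀
      lem : ∀ N → + 2 * (N * N * N) - N * (N - 1ℤ) * (+ 2 * N - 1ℤ) ≡ + 2 * (N * N) + N * (N - 1ℤ)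
      lem = solve-∀

    N⁶ : ℤ
    N⁶ = N * N * N * (N * N * N)

  -- The unknown moment Σ a² τ(a)² enters gridEnergy (through gridFι) and graphEnergy
  -- with opposite signs, and cancels in this combination.
  energy-bound : 1ℤ ≤ N → + 9 * (+ 2 * gridEnergy + N * graphEnergy) ≤
    + 9 * (N * N) * quadrantCount - + 19 * (N * N * N * (N * N * N)) + + 12 * (N * N * (N * N * N))
  energy-bound 1≤N = ≤-by-gap gap≡ (nonneg-+ (nonneg-+ (nonneg-* {+ 9 * N} (nonneg-* {+ 9} {N} nonneg-pos nonneg-pos)
      (gap graphι²≤))
      (nonneg-* {+ 2} nonneg-pos (gap (*-mono {+ 3 * ∑ι² n} 0≤3s 0≤3s (3∑ι²≤N³ 1≤N) (3∑ι²≤N³ 1≤N)))))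
      (nonneg-+ (nonneg-* {+ 9} nonneg-pos (nonneg-* {N * N * N} {N} 0≤N³ nonneg-pos)) (nonneg-* {+ 6} nonneg-pos
          (nonneg-* {N * N * N} 0≤N³ (gap 1≤N)))))
    where
    open ≡-Reasoning
    0≤N³ : 0ℤ ≤ N * N * N
    0≤N³ = nonneg-* {N * N} {N} (nonneg-* {N} {N} nonneg-pos nonneg-pos) nonneg-pos
    0≤3s : 0ℤ ≤ + 3 * ∑ι² n
    0≤3s = nonneg-* {+ 3} nonneg-pos (sum-nonneg {n} (λ i → nonneg-square (ι i)))
    w = sum {n} (λ a → p a * p (t′ a))
    s = ∑ι² n
    eliminate : ∀ N a b c x y s → + 9 * (N * N) * (+ 2 * a + 1ℤ * (N * b + + 2 * (N * N * N * N)) +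
        (- + 2) * c) - + 19 * (N * N * N * (N * N * N)) + + 12 * (N * N * (N * N * N))
      - + 9 * (+ 2 * ((N * N) * a + (- (+ 2 * N)) * x + 1ℤ * (s * s)) + N * ((N * N) * b + (- (+ 2 * N)) * c + 1ℤ * y))
      ≡ + 9 * N * (+ 4 * x) - + 18 * (s * s) - + 9 * N * y - N * N * N * (N * N * N) + + 12 * (N * N * (N * N * N))
    eliminate = solve-∀
    regroup : ∀ N s P w y → + 9 * N * (N * ((N * (N - 1ℤ)) * (N * (N - 1ℤ))) - + 2 * (N * (N - 1ℤ)) * P + w) - + 18 *
        (s * s) - + 9 * N * y - N * N * N * (N * N * N) + + 12 * (N * N * (N * N * N))
      ≡ (+ 9 * N * (w - y) + + 2 * (N * N * N * (N * N * N) - + 3 * s * (+ 3 * s))) +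
        (+ 9 * N * (N * ((N * (N - 1ℤ)) * (N * (N - 1ℤ)))) - N * (N * (N - 1ℤ)) * (+ 18 * P) - + 3 * (N * N * N *
            (N * N * N)) + + 12 * (N * N * (N * N * N)))
    regroup = solve-∀
    -- At `N⁶` the coefficients 9, -6 and -3 cancel; 12 is the number that cancels -18 + 6 at `N⁵`.
    collect : ∀ N → + 9 * N * (N * ((N * (N - 1ℤ)) * (N * (N - 1ℤ)))) - N * (N * (N - 1ℤ)) * (+ 6 *
        (N * N * N - N)) - + 3 * (N * N * N * (N * N * N)) + + 12 * (N * N * (N * N * N))
      ≡ + 9 * (N * N * N * N) + + 6 * (N * N * N * (N - 1ℤ))
    collect = solve-∀
    gap≡ : + 9 * (N * N) * quadrantCount - + 19 * (N * N * N * (N * N * N)) + + 12 * (N * N * (N * N * N))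
           - + 9 * (+ 2 * gridEnergy + N * graphEnergy)
         ≡ (+ 9 * N * (w - graphι²) + + 2 * (N * N * N * (N * N * N) - + 3 * s * (+ 3 * s))) +
           (+ 9 * (N * N * N * N) + + 6 * (N * N * N * (N - 1ℤ)))
    gap≡ = begin
      + 9 * (N * N) * quadrantCount - + 19 * (N * N * N * (N * N * N)) + + 12 * (N * N * (N * N * N)) - + 9 *
          (+ 2 * gridEnergy + N * graphEnergy)
        ≡⟨ cong₂ (λ h e → + 9 * (N * N) * h - + 19 * (N * N * N * (N * N * N)) + + 12 * (N * N * (N * N * N)) - + 9 * e)
             quadrantCount-expand (cong₂ (λ d e → + 2 * d + N * e) gridEnergy-expand graphEnergy-expand) ⟩
      _ ≡⟨ eliminate N gridF² graphF² graphFι gridFι graphι² s ⟩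
      + 9 * N * (+ 4 * gridFι) - + 18 * (s * s) - + 9 * N * graphι² - N * N * N * (N * N * N) + + 12 * (N * N *
          (N * N * N))
        ≡⟨ cong (λ z → + 9 * N * z - + 18 * (s * s) - + 9 * N * graphι² - N * N * N * (N * N * N) + + 12 * (N * N *
            (N * N * N))) gridFι-closed ⟩
      _ ≡⟨ regroup N s (∑ι² n + ∑ι n) w graphι² ⟩
      _ ≡⟨ cong (λ z → (+ 9 * N * (w - graphι²) + + 2 * (N * N * N * (N * N * N) - + 3 * s * (+ 3 * s))) +
             (+ 9 * N * (N * (m * m)) - N * m * z - + 3 * (N * N * N * (N * N * N)) + + 12 * (N * N *
                 (N * N * N)))) 18P ⟩
      _ ≡⟨ cong (λ z → (+ 9 * N * (w - graphι²) + + 2 * (N * N * N * (N * N * N) - + 3 * s * (+ 3 * s))) + z)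
          (collect N) ⟩
      _ ∎

  -- 3 + 2 + 1 is the number of pairs among four coordinates that may coincide.
  repeats₄ : repeats n 4 ≤ + 6 * (N * N * N)
  repeats₄ = begin
    repeats n 4                                  ≤⟨ repeats-suc n 3 ⟩
    + 3 * N ^ 3 + N * repeats n 3                ≤⟨ step (+ 3 * N ^ 3) (repeats-suc n 2) ⟩
    + 3 * N ^ 3 + N * (+ 2 * N ^ 2 + N * repeats n 2)
      ≤⟨ step (+ 3 * N ^ 3) (step (+ 2 * N ^ 2) (repeats-suc n 1)) ⟩
    + 3 * N ^ 3 + N * (+ 2 * N ^ 2 + N * (+ 1 * N ^ 1 + N * repeats n 1))
      ≤⟨ step (+ 3 * N ^ 3) (step (+ 2 * N ^ 2) (step (+ 1 * N ^ 1) (repeats-suc n 0))) ⟩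
    + 3 * (N * (N * (N * 1ℤ))) + N * (+ 2 * (N * (N * 1ℤ)) + N * (+ 1 * (N * 1ℤ) + N * (0ℤ * 1ℤ + N * 0ℤ)))
      ≡⟨ lem N ⟩
    + 6 * (N * N * N) ∎
    where
    open ℤ.≤-Reasoning
    step : ∀ {y z} x → y ≤ z → x + N * y ≤ x + N * z
    step x y≤z = ℤ.+-monoʳ-≤ x (*-monoˡ {c = N} nonneg-pos y≤z)
    lem : ∀ N → + 3 * (N * (N * (N * 1ℤ))) + N * (+ 2 * (N * (N * 1ℤ)) + N * (+ 1 * (N * 1ℤ) + N *
        (0ℤ * 1ℤ + N * 0ℤ))) ≡ + 6 * (N * N * N)
    lem = solve-∀

  -- After multiplying by 576 `E`, the main terms cancel since 9 · 1216 = 19 · 576. The tolerance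
  -- leaves 19 · 24 at `N⁶`; the lower-order terms leave 12 + 9 · 5 · 6 = 282 at `E N⁵`, which is at
  -- most `N⁶` times 282 because `E ≤ N`. The total 738 is 18 · 41, and `graphEnergy` is discarded
  -- as nonnegative.
  gridEnergy-bound : ∀ {E} → 1ℤ ≤ E → E ≤ N →
    (∀ (π : Perm 4) → (+ 576 * E) * + occurrences π τ ≤ (E + + 24) * (N * N * N * N)) →
    E * gridEnergy ≤ + 41 * (N * N * N * (N * N * N))
  gridEnergy-bound {E} 1≤E E≤N occ≤ =
    ℤ.*-cancelˡ-≤-pos (E * gridEnergy) (+ 41 * (N * N * N * (N * N * N))) (+ 18 * c) (≤-by-gap
      (sym (trans (expand c (+ 1216) E N gridEnergy graphEnergy quadrantCount (repeats n 4))
                  (trans (cong (λ W → c * E * (+ 12 * N⁵ - + 19 * N⁶ - + 18 * gridEnergy) + (N * N) * W *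
                      ((E + + 24) * (N * N * N * N))
                                      + + 270 * (c * E) * N⁵ + + 282 * c * N⁵ * (N - E)) 9W≡19c)
                         (collect c E N gridEnergy))))
      (nonneg-+ (nonneg-+ (nonneg-+ (nonneg-+
        (nonneg-* {c * E} 0≤cE (gap (energy-bound (ℤ.≤-trans 1≤E E≤N))))
        (nonneg-* {+ 9 * (N * N)} 0≤9N² (gap count≤)))
        (nonneg-* {+ 9 * (N * N) * ((c * E) * + 5)} (nonneg-* {+ 9 * (N * N)} 0≤9N²
            (nonneg-* {c * E} {+ 5} 0≤cE nonneg-pos)) (gap repeats₄)))
        (nonneg-* {+ 9 * (c * E) * N} (nonneg-* {+ 9 * (c * E)} {N} (nonneg-* {+ 9} nonneg-pos 0≤cE) nonneg-pos)
          (sum-nonneg {n} (λ i → nonneg-square (discrepancy (toℕ i) (toℕ (t′ i)))))))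
        (nonneg-* {+ 282 * c * N⁵} (nonneg-* {+ 282 * c} nonneg-pos (nonneg-* {N * N} {N * N * N} 0≤N²
            (nonneg-* {N * N} {N} 0≤N² nonneg-pos))) (gap E≤N))))
    where
    c = + 576
    N⁵ = N * N * (N * N * N)
    0≤N² : 0ℤ ≤ N * N
    0≤N² = nonneg-* {N} {N} nonneg-pos nonneg-pos
    0≤9N² : 0ℤ ≤ + 9 * (N * N)
    0≤9N² = nonneg-* {+ 9} {N * N} nonneg-pos 0≤N²
    0≤cE : 0ℤ ≤ c * E
    0≤cE = nonneg-* {c} nonneg-pos (ℤ.≤-trans nonneg-pos 1≤E)
    count≤ : (c * E) * quadrantCount ≤ (c * E) * (+ 5 * repeats n 4) + + 1216 * ((E + + 24) * (N * N * N * N))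
    count≤ = subst (λ z → (c * E) * quadrantCount ≤ (c * E) * (+ 5 * repeats n 4) + z * ((E + + 24) * (N * N * N * N)))
      totalWeight-quadrants (∑-value-bound quadrants τ {c * E} 0≤cE occ≤)
    9W≡19c : + 9 * + 1216 ≡ + 19 * c
    9W≡19c = refl
    expand : ∀ c W E N G H Q R →
      (c * E) * (+ 9 * (N * N) * Q - + 19 * (N * N * N * (N * N * N)) + + 12 * (N * N * (N * N * N)) - + 9 *
          (+ 2 * G + N * H))
      + + 9 * (N * N) * ((c * E) * (+ 5 * R) + W * ((E + + 24) * (N * N * N * N)) - (c * E) * Q)
      + + 9 * (N * N) * ((c * E) * + 5) * (+ 6 * (N * N * N) - R)
      + + 9 * (c * E) * N * H
      + + 282 * c * (N * N * (N * N * N)) * (N - E) ≡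
      c * E * (+ 12 * (N * N * (N * N * N)) - + 19 * (N * N * N * (N * N * N)) - + 18 * G) + (N * N) * (+ 9 * W) *
          ((E + + 24) * (N * N * N * N))
      + + 270 * (c * E) * (N * N * (N * N * N)) + + 282 * c * (N * N * (N * N * N)) * (N - E)
    expand = solve-∀
    collect : ∀ c E N G → c * E * (+ 12 * (N * N * (N * N * N)) - + 19 * (N * N * N * (N * N * N)) - + 18 * G) +
        (N * N) * (+ 19 * c) * ((E + + 24) * (N * N * N * N))
      + + 270 * (c * E) * (N * N * (N * N * N)) + + 282 * c * (N * N * (N * N * N)) * (N - E) ≡
      + 18 * c * (+ 41 * (N * N * N * (N * N * N))) - + 18 * c * (E * G)
    collect = solve-∀

open Energy

-- From mean-square to uniform discrepancy

below-mono : ∀ {n} (x : Fin n) {h h′} → h ℕ.≤ h′ → below x h ≤ below x h′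
below-mono zero    {zero}  {h′}    _           = 𝟙-nonneg (0 ℕ.<ᵇ h′)
below-mono (suc x) {zero}  {h′}    _           = 𝟙-nonneg (suc (toℕ x) ℕ.<ᵇ h′)
below-mono zero    {suc h} {suc h′} _          = ℤ.≤-refl
below-mono (suc x) {suc h} {suc h′} (ℕ.s≤s le) = below-mono x le

below-nonneg : ∀ {n} (x : Fin n) h → 0ℤ ≤ below x h
below-nonneg x h = 𝟙-nonneg (toℕ x ℕ.<ᵇ h)

below≤1 : ∀ {n} (x : Fin n) h → below x h ≤ 1ℤ
below≤1 x h = 𝟙≤1 (toℕ x ℕ.<ᵇ h)

window-sum : ∀ n m L (f : ℕ → ℤ) {c} → m ℕ.+ L ℕ.≤ n → (∀ i → 0ℤ ≤ f i) →
             (∀ a → a ℕ.< L → c ≤ f (m ℕ.+ a)) → + L * c ≤ sum {n} (f ∘ toℕ)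
window-sum n       zero    zero    f {c} _  0≤f c≤f = sum-nonneg {n} (λ i → 0≤f (toℕ i))
window-sum (suc n) zero    (suc L) f {c} (ℕ.s≤s L≤n) 0≤f c≤f = subst (_≤ sum {suc n} (f ∘ toℕ)) (lem (+ L) c)
  (ℤ.+-mono-≤ (c≤f 0 (ℕ.s≤s ℕ.z≤n))
              (window-sum n zero L (f ∘ suc) L≤n (0≤f ∘ suc) (λ a a<L → c≤f (suc a) (ℕ.s≤s a<L))))
  where
  lem : ∀ L c → c + L * c ≡ (1ℤ + L) * c
  lem = solve-∀
window-sum (suc n) (suc m) L       f {c} (ℕ.s≤s m+L≤n) 0≤f c≤f = subst (_≤ sum {suc n} (f ∘ toℕ)) (ℤ.+-identityˡ
    (+ L * c))
  (ℤ.+-mono-≤ (0≤f 0) (window-sum n m L (f ∘ suc) m+L≤n (0≤f ∘ suc) c≤f))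

module UniformBound {n} (τ : Perm n) where
  private
    N = + n
    F = dominated τ
    D = discrepancy τ

    0≤N : 0ℤ ≤ N
    0≤N = nonneg-pos

  sum-below-τ : ∀ h → h ℕ.≤ n → sum {n} (λ a → below (τ ⟨$⟩ʳ a) h) ≡ + h
  sum-below-τ h h≤n = trans (sym (sum-permute {n} {n} (λ a → below a h) τ)) (sum-below h h≤n)

  dominated-monoˡ : ∀ {h₀ h} h′ → h₀ ℕ.≤ h → F h₀ h′ ≤ F h h′
  dominated-monoˡ {h₀} h′ h₀≤h = sum-mono {n} (λ a →
    *-mono (below-nonneg a h₀) (below-nonneg (τ ⟨$⟩ʳ a) h′) (below-mono a h₀≤h) ℤ.≤-refl)

  dominated-monoʳ : ∀ h {h₀ h′} → h₀ ℕ.≤ h′ → F h h₀ ≤ F h h′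
  dominated-monoʳ h {h₀} h₀≤h′ = sum-mono {n} (λ a →
    *-mono (below-nonneg a h) (below-nonneg (τ ⟨$⟩ʳ a) h₀) ℤ.≤-refl (below-mono (τ ⟨$⟩ʳ a) h₀≤h′))

  -- Each new column holds exactly one point of the graph.
  dominated-stepˡ : ∀ {h₀ h} h′ → h₀ ℕ.≤ h → h ℕ.≤ n → F h h′ + + h₀ ≤ F h₀ h′ + + h
  dominated-stepˡ {h₀} {h} h′ h₀≤h h≤n = subst₂ _≤_
    (trans (sum-+ {n} (λ a → below a h * below (τ ⟨$⟩ʳ a) h′) (λ a → below a h₀)) (cong (λ s → F h h′ + s)
        (sum-below h₀ (ℕ.≤-trans h₀≤h h≤n))))
    (trans (sum-+ {n} (λ a → below a h₀ * below (τ ⟨$⟩ʳ a) h′) (λ a → below a h)) (cong (λ s → F h₀ h′ + s)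
        (sum-below h h≤n)))
    (sum-mono {n} (λ a → ≤-by-gap (lem (below a h) (below a h₀) (below (τ ⟨$⟩ʳ a) h′))
      (nonneg-* (gap (below-mono a h₀≤h)) (gap (below≤1 (τ ⟨$⟩ʳ a) h′)))))
    where
    lem : ∀ x x₀ y → (x₀ * y + x) - (x * y + x₀) ≡ (x - x₀) * (1ℤ - y)
    lem = solve-∀

  dominated-stepʳ : ∀ h {h₀ h′} → h₀ ℕ.≤ h′ → h′ ℕ.≤ n → F h h′ + + h₀ ≤ F h h₀ + + h′
  dominated-stepʳ h {h₀} {h′} h₀≤h′ h′≤n = subst₂ _≤_
    (trans (sum-+ {n} (λ a → below a h * below (τ ⟨$⟩ʳ a) h′) (λ a → below (τ ⟨$⟩ʳ a) h₀)) (cong (λ s → F h h′ + s)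
        (sum-below-τ h₀ (ℕ.≤-trans h₀≤h′ h′≤n))))
    (trans (sum-+ {n} (λ a → below a h * below (τ ⟨$⟩ʳ a) h₀) (λ a → below (τ ⟨$⟩ʳ a) h′)) (cong (λ s → F h h₀ + s)
        (sum-below-τ h′ h′≤n)))
    (sum-mono {n} (λ a → ≤-by-gap (lem (below a h) (below (τ ⟨$⟩ʳ a) h′) (below (τ ⟨$⟩ʳ a) h₀))
      (nonneg-* (gap (below-mono (τ ⟨$⟩ʳ a) h₀≤h′)) (gap (below≤1 a h)))))
    where
    lem : ∀ x y y₀ → (x * y₀ + y) - (x * y + y₀) ≡ (y - y₀) * (1ℤ - x)
    lem = solve-∀

  -- Along the path through the corner `(h₀ , h′)`, both `N * F` and the product of the coordinates
  -- are monotone and change by at most `N` per unit step, hence so does their difference.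
  -- Comparable corners are enough for windows that lie below a given corner.
  discrepancy-lipschitz : ∀ {h₀ h h₀′ h′} → h₀ ℕ.≤ h → h ℕ.≤ n → h₀′ ℕ.≤ h′ → h′ ℕ.≤ n →
    D h h′ - D h₀ h₀′ ≤ N * ((+ h - + h₀) + (+ h′ - + h₀′)) ×
    D h₀ h₀′ - D h h′ ≤ N * ((+ h - + h₀) + (+ h′ - + h₀′))
  discrepancy-lipschitz {h₀} {h} {h₀′} {h′} h₀≤h h≤n h₀′≤h′ h′≤n =
    ≤-by-gap (upper N (F h h′) (F h₀ h′) (F h₀ h₀′) (+ h) (+ h₀) (+ h′) (+ h₀′))
      (nonneg-+ (nonneg-+ (nonneg-* 0≤N (gap (dominated-stepˡ h′ h₀≤h h≤n))) (nonneg-* 0≤N (gap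
          (dominated-stepʳ h₀ h₀′≤h′ h′≤n))))
                (nonneg-+ (nonneg-* (gap (+≤+ h₀≤h)) (nonneg-pos {h′})) (nonneg-* (nonneg-pos {h₀}) (gap
                    (+≤+ h₀′≤h′))))) ,
    ≤-by-gap (lower N (F h h′) (F h₀ h′) (F h₀ h₀′) (+ h) (+ h₀) (+ h′) (+ h₀′))
      (nonneg-+ (nonneg-+ (nonneg-* 0≤N (gap (dominated-monoˡ h′ h₀≤h))) (nonneg-* 0≤N (gap
          (dominated-monoʳ h₀ h₀′≤h′))))
                (nonneg-+ (nonneg-* (gap (+≤+ h₀≤h)) (gap (+≤+ h′≤n))) (nonneg-* (gap (+≤+ (ℕ.≤-trans h₀≤h h≤n)))
                    (gap (+≤+ h₀′≤h′)))))
    where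
    upper : ∀ N f f₁ f₀ x x₀ y y₀ → N * ((x - x₀) + (y - y₀)) - ((N * f - x * y) - (N * f₀ - x₀ * y₀)) ≡
      N * ((f₁ + x) - (f + x₀)) + N * ((f₀ + y) - (f₁ + y₀)) + ((x - x₀) * y + x₀ * (y - y₀))
    upper = solve-∀
    lower : ∀ N f f₁ f₀ x x₀ y y₀ → N * ((x - x₀) + (y - y₀)) - ((N * f₀ - x₀ * y₀) - (N * f - x * y)) ≡
      N * (f - f₁) + N * (f₁ - f₀) + ((x - x₀) * (N - y) + (N - x₀) * (y - y₀))
    lower = solve-∀

  -- Both `N * F h h′` and the product of `h` and `h′` lie between 0 and `N` times the smaller of
  -- `h` and `h′`.
  discrepancy-edge : ∀ {h h′} → h ℕ.≤ n → h′ ℕ.≤ n →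
    (D h h′ ≤ N * + h × - D h h′ ≤ N * + h) × (D h h′ ≤ N * + h′ × - D h h′ ≤ N * + h′)
  discrepancy-edge {h} {h′} h≤n h′≤n =
    (≤-by-gap (u N (F h h′) (+ h) (+ h′)) (nonneg-+ (nonneg-* 0≤N (gap F≤h)) (nonneg-* (nonneg-pos {h})
        (nonneg-pos {h′}))) ,
     ≤-by-gap (l N (F h h′) (+ h) (+ h′)) (nonneg-+ (nonneg-* 0≤N 0≤F) (nonneg-* (nonneg-pos {h}) (gap (+≤+ h′≤n))))) ,
    (≤-by-gap (u′ N (F h h′) (+ h) (+ h′)) (nonneg-+ (nonneg-* 0≤N (gap F≤h′)) (nonneg-* (nonneg-pos {h})
        (nonneg-pos {h′}))) ,
     ≤-by-gap (l′ N (F h h′) (+ h) (+ h′)) (nonneg-+ (nonneg-* 0≤N 0≤F) (nonneg-* (nonneg-pos {h′}) (gap (+≤+ h≤n)))))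
    where
    0≤F : 0ℤ ≤ F h h′
    0≤F = sum-nonneg {n} (λ a → nonneg-* (below-nonneg a h) (below-nonneg (τ ⟨$⟩ʳ a) h′))
    F≤h : F h h′ ≤ + h
    F≤h = subst (F h h′ ≤_) (sum-below h h≤n) (sum-mono {n} (λ a → subst (below a h * below (τ ⟨$⟩ʳ a) h′ ≤_)
        (ℤ.*-identityʳ (below a h))
      (*-monoˡ (below-nonneg a h) (below≤1 (τ ⟨$⟩ʳ a) h′))))
    F≤h′ : F h h′ ≤ + h′
    F≤h′ = subst (F h h′ ≤_) (sum-below-τ h′ h′≤n) (sum-mono {n} (λ a → subst (below a h * below (τ ⟨$⟩ʳ a) h′ ≤_)
        (ℤ.*-identityˡ (below (τ ⟨$⟩ʳ a) h′))
      (*-mono (below-nonneg a h) (below-nonneg (τ ⟨$⟩ʳ a) h′) (below≤1 a h) ℤ.≤-refl)))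
    u : ∀ N f x y → N * x - (N * f - x * y) ≡ N * (x - f) + x * y
    u = solve-∀
    l : ∀ N f x y → N * x - (- (N * f - x * y)) ≡ N * f + x * (N - y)
    l = solve-∀
    u′ : ∀ N f x y → N * y - (N * f - x * y) ≡ N * (y - f) + x * y
    u′ = solve-∀
    l′ : ∀ N f x y → N * y - (- (N * f - x * y)) ≡ N * f + y * (N - x)
    l′ = solve-∀

  -- A value s D(h, h′) > 3LN (s = ±1) persists, with LN in place of 3LN, on the L × L window
  -- below (h, h′), which fits into the grid because |D(h, h′)| ≤ N min(h, h′).
  window-energy : ∀ {s L h h′} → s * s ≡ 1ℤ → (∀ {h₀ h₀′} → h₀ ℕ.≤ h → h₀′ ℕ.≤ h′ →
                    s * D h h′ - s * D h₀ h₀′ ≤ N * ((+ h - + h₀) + (+ h′ - + h₀′))) →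
                  h ℕ.≤ n → h′ ℕ.≤ n → L ℕ.≤ h → L ℕ.≤ h′ → + 3 * + L * N ≤ s * D h h′ →
                  + L * (+ L * (+ L * N * (+ L * N))) ≤ gridEnergy τ
  window-energy {s} {L} {h} {h′} s² lip h≤n h′≤n L≤h L≤h′ big =
    window-sum n m L (λ i → sum {n} (λ j → D i (toℕ j) * D i (toℕ j))) (subst (ℕ._≤ n) (sym (ℕ.m∸n+n≡m L≤h)) h≤n)
      (λ i → sum-nonneg {n} (λ j → nonneg-square (D i (toℕ j))))
      (λ a a<L → window-sum n m′ L (λ j → D (m ℕ.+ a) j * D (m ℕ.+ a) j) (subst (ℕ._≤ n) (sym (ℕ.m∸n+n≡m L≤h′)) h′≤n)
        (λ j → nonneg-square (D (m ℕ.+ a) j))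
        (λ b b<L → square a b (ℕ.<⇒≤ a<L) (ℕ.<⇒≤ b<L)))
    where
    m = h ℕ.∸ L
    m′ = h′ ℕ.∸ L
    0≤LN : 0ℤ ≤ + L * N
    0≤LN = nonneg-* {+ L} {N} nonneg-pos nonneg-pos
    near : ∀ {h m a} → h ≡ m ℕ.+ L → a ℕ.≤ L → 0ℤ ≤ + L - (+ h - + (m ℕ.+ a))
    near {h} {m} {a} refl a≤L = subst (0ℤ ≤_) (lem (+ L) (+ m) (+ a)) (nonneg-pos {a})
      where
      lem : ∀ L m a → a ≡ L - ((m + L) - (m + a))
      lem = solve-∀
    fits : ∀ {h a} → L ℕ.≤ h → a ℕ.≤ L → (h ℕ.∸ L) ℕ.+ a ℕ.≤ h
    fits {h} {a} L≤h a≤L = subst ((h ℕ.∸ L) ℕ.+ a ℕ.≤_) (ℕ.m∸n+n≡m L≤h) (ℕ.+-monoʳ-≤ (h ℕ.∸ L) a≤L)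
    -- Each coordinate moves by at most `L`, so the Lipschitz bound takes at most `2LN` from the
    -- initial `3LN`.
    lower : ∀ a b → a ℕ.≤ L → b ℕ.≤ L → + L * N ≤ s * D (m ℕ.+ a) (m′ ℕ.+ b)
    lower a b a≤L b≤L = ≤-by-gap
      (lem (s * D h h′) (s * D (m ℕ.+ a) (m′ ℕ.+ b)) N (+ L) (+ h - + (m ℕ.+ a)) (+ h′ - + (m′ ℕ.+ b)))
      (nonneg-+ (nonneg-+ (gap big) (gap (lip (fits L≤h a≤L) (fits L≤h′ b≤L))))
        (nonneg-* 0≤N (nonneg-+ (near {h} {m} {a} (sym (ℕ.m∸n+n≡m L≤h)) a≤L) (near {h′} {m′} {b} (sym
            (ℕ.m∸n+n≡m L≤h′)) b≤L))))
      where
      lem : ∀ d d₀ N L x y → d₀ - L * N ≡ (d - + 3 * L * N) + (N * (x + y) - (d - d₀)) + N * ((L - x) + (L - y))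
      lem = solve-∀
    square : ∀ a b → a ℕ.≤ L → b ℕ.≤ L → + L * N * (+ L * N) ≤ D (m ℕ.+ a) (m′ ℕ.+ b) * D (m ℕ.+ a) (m′ ℕ.+ b)
    square a b a≤L b≤L = subst (+ L * N * (+ L * N) ≤_)
      (trans (lem s (D (m ℕ.+ a) (m′ ℕ.+ b))) (trans (cong (λ z → z * (D (m ℕ.+ a) (m′ ℕ.+ b) * D (m ℕ.+ a)
          (m′ ℕ.+ b))) s²) (ℤ.*-identityˡ _)))
      (*-mono 0≤LN 0≤LN (lower a b a≤L b≤L) (lower a b a≤L b≤L))
      where
      lem : ∀ s d → s * d * (s * d) ≡ s * s * (d * d)
      lem = solve-∀

  window-fits : ∀ {L h} {d} → + 3 * + L * N ℤ.< d → d ≤ N * + h → L ℕ.≤ h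
  window-fits {L} {h} {d} big small with L ℕ.≤? h
  ... | yes L≤h = L≤h
  ... | no  L≰h = contradiction (ℤ.<-≤-trans big small) (ℤ.≤⇒≯
    (≤-by-gap (lem N (+ L) (+ h)) (nonneg-+ (nonneg-* 0≤N (gap (+≤+ (ℕ.<⇒≤ (ℕ.≰⇒> L≰h))))) (nonneg-* {+ 2} nonneg-pos
        (nonneg-* {+ L} {N} nonneg-pos nonneg-pos)))))
    where
    lem : ∀ N L h → + 3 * L * N - N * h ≡ N * (L - h) + + 2 * (L * N)
    lem = solve-∀

  -- A single violation would, by `window-energy`, already force more energy than the whole grid
  -- has; `s = 1` treats `D` and `s = -1` treats its negative.
  discrepancy-bound : ∀ {L} → gridEnergy τ ℤ.< + L * (+ L * (+ L * N * (+ L * N))) →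
    ∀ h h′ → h ℕ.≤ n → h′ ℕ.≤ n → D h h′ ≤ + 3 * + L * N × - D h h′ ≤ + 3 * + L * N
  discrepancy-bound {L} small h h′ h≤n h′≤n = upper , lower
    where
    edge = discrepancy-edge h≤n h′≤n
    lip = λ {h₀ h₀′} (a : h₀ ℕ.≤ h) (b : h₀′ ℕ.≤ h′) → discrepancy-lipschitz a h≤n b h′≤n
    upper : D h h′ ≤ + 3 * + L * N
    upper with D h h′ ℤ.≤? + 3 * + L * N
    ... | yes ≤3LN = ≤3LN
    ... | no  ≰3LN = contradiction small (ℤ.≤⇒≯ (window-energy {1ℤ} {L} {h} {h′} refl
        (λ {h₀} {h₀′} a b → subst (_≤ N * ((+ h - + h₀) + (+ h′ - + h₀′))) (lem (D h h′) (D h₀ h₀′)) (proj₁ (lip a b)))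
        h≤n h′≤n (window-fits {L} big (proj₁ (proj₁ edge))) (window-fits {L} big (proj₁ (proj₂ edge)))
        (subst (+ 3 * + L * N ≤_) (sym (ℤ.*-identityˡ _)) (ℤ.<⇒≤ big))))
      where
      big = ℤ.≰⇒> ≰3LN
      lem : ∀ d d₀ → d - d₀ ≡ 1ℤ * d - 1ℤ * d₀
      lem = solve-∀
    lower : - D h h′ ≤ + 3 * + L * N
    lower with - D h h′ ℤ.≤? + 3 * + L * N
    ... | yes ≤3LN = ≤3LN
    ... | no  ≰3LN = contradiction small (ℤ.≤⇒≯ (window-energy { - 1ℤ} {L} {h} {h′} refl
        (λ {h₀} {h₀′} a b → subst (_≤ N * ((+ h - + h₀) + (+ h′ - + h₀′))) (lem (D h h′) (D h₀ h₀′)) (proj₂ (lip a b)))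
        h≤n h′≤n (window-fits {L} big (proj₂ (proj₁ edge))) (window-fits {L} big (proj₂ (proj₂ edge)))
        (subst (+ 3 * + L * N ≤_) (sym (ℤ.-1*i≡-i _)) (ℤ.<⇒≤ big))))
      where
      big = ℤ.≰⇒> ≰3LN
      lem : ∀ d d₀ → d₀ - d ≡ (- 1ℤ) * d - (- 1ℤ) * d₀
      lem = solve-∀

open UniformBound

-- Convex slices and telescoping

Convex : ∀ {n} → (Fin n → Bool) → Set
Convex u = ∀ {a b c} → toℕ a ℕ.≤ toℕ b → toℕ b ℕ.≤ toℕ c → u a ≡ true → u c ≡ true → u b ≡ true

downset⇒initial : ∀ {n} (u : Fin n → Bool) → (∀ {a b} → toℕ a ℕ.≤ toℕ b → u b ≡ true → u a ≡ true) →
                  ∃[ h ] h ℕ.≤ n × (∀ x → 𝟙 (u x) ≡ below x h)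
downset⇒initial {zero}  u down = 0 , ℕ.z≤n , λ ()
downset⇒initial {suc n} u down with u zero in eq
... | false = 0 , ℕ.z≤n , λ x → cong 𝟙 (bool-ext {b = false} (λ ux → trans (sym eq) (down {zero} {x} ℕ.z≤n ux)) λ ())
... | true with h , h≤n , initial ← downset⇒initial (u ∘ suc) (λ a≤b → down (ℕ.s≤s a≤b)) =
  suc h , ℕ.s≤s h≤n , λ { zero → cong 𝟙 eq ; (suc x) → initial x }

-- If `u zero` holds, convexity makes `u` a downset; otherwise everything shifts by one. The empty
-- set comes out with `lo` equal to `hi`.
convex⇒interval : ∀ {n} (u : Fin n → Bool) → Convex u →
                  ∃[ lo ] ∃[ hi ] lo ℕ.≤ n × hi ℕ.≤ n × (∀ x → 𝟙 (u x) ≡ below x hi - below x lo)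
convex⇒interval {zero}  u convex = 0 , 0 , ℕ.z≤n , ℕ.z≤n , λ ()
convex⇒interval {suc n} u convex with u zero in eq
... | true with h , h≤n , initial ← downset⇒initial u (λ a≤b ub → convex {zero} ℕ.z≤n a≤b eq ub) =
  0 , h , ℕ.z≤n , h≤n , λ x → trans (initial x) (sym (ℤ.+-identityʳ (below x h)))
... | false with lo , hi , lo≤n , hi≤n , interval ← convex⇒interval (u ∘ suc) (λ a≤b b≤c → convex (ℕ.s≤s a≤b)
    (ℕ.s≤s b≤c)) =
  suc lo , suc hi , ℕ.s≤s lo≤n , ℕ.s≤s hi≤n , λ { zero → cong 𝟙 eq ; (suc x) → interval x }

CoordinatewiseConvex : ∀ {n k} → (Vec (Fin n) k → Bool) → Set
CoordinatewiseConvex U = ∀ xs i → Convex (λ v → U (xs [ i ]≔ v))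

-- Every comparison with coordinate `i` is monotone in the entry placed there, so an outcome shared
-- by `a` and `c` is also the outcome at any `b` between them.
matches-convex : ∀ {n k m} (s : Fin k → Fin m) → CoordinatewiseConvex {n} (λ xs → matches s (lookup xs))
matches-convex {n} s xs i {a} {b} {c} a≤b b≤c ma mc =
  matches-intro s (lookup (xs [ i ]≔ b)) same
  where
  update : Fin n → Fin _ → Fin n
  update v = lookup (xs [ i ]≔ v)
  at : ∀ v → update v i ≡ v
  at v = Vec.lookup∘updateAt i xs
  away : ∀ v {j} → ¬ j ≡ i → update v j ≡ lookup xs j
  away v {j} j≢i = Vec.lookup∘updateAt′ j i j≢i xs
  sandwich : ∀ {p q r t} → (p ≡ true → q ≡ true) → (q ≡ true → r ≡ true) → p ≡ t → r ≡ t → q ≡ t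
  sandwich {t = true}  p⇒q q⇒r p≡t r≡t = p⇒q p≡t
  sandwich {q = false} {t = false} p⇒q q⇒r p≡t r≡t = refl
  sandwich {q = true}  {t = false} p⇒q q⇒r p≡t r≡t = contradiction r≡t (true≢false (q⇒r refl))
  sa = matches-true s (update a) ma
  sc = matches-true s (update c) mc
  same : SameOrder s (update b)
  same j l with j Fin.≟ i | l Fin.≟ i
  ... | yes refl | yes refl = trans (cong₂ le (at b) (at b)) (trans (le-refl b)
        (trans (sym (le-refl a)) (trans (sym (cong₂ le (at a) (at a))) (sa i i))))
    where
    le-refl : ∀ v → le v v ≡ true
    le-refl v = le-intro v v ℕ.≤-refl
  ... | no j≢i | no l≢i = trans (cong₂ le (trans (away b j≢i) (sym (away a j≢i))) (trans (away b l≢i) (sym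
      (away a l≢i)))) (sa j l)
  ... | yes refl | no l≢i = trans (cong₂ le (at b) (away b l≢i)) (sandwich
        (λ c≤y → le-intro b y (ℕ.≤-trans b≤c (le-true c y c≤y)))
        (λ b≤y → le-intro a y (ℕ.≤-trans a≤b (le-true b y b≤y)))
        (trans (sym (cong₂ le (at c) (away c l≢i))) (sc i l))
        (trans (sym (cong₂ le (at a) (away a l≢i))) (sa i l)))
    where y = lookup xs l
  ... | no j≢i | yes refl = trans (cong₂ le (away b j≢i) (at b)) (sandwich
        (λ y≤a → le-intro y b (ℕ.≤-trans (le-true y a y≤a) a≤b))
        (λ y≤b → le-intro y c (ℕ.≤-trans (le-true y b y≤b) b≤c))
        (trans (sym (cong₂ le (away a j≢i) (at a))) (sa j i))
        (trans (sym (cong₂ le (away c j≢i) (at c))) (sc j i)))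
    where y = lookup xs j

-- Integrals over points of the grid

∑² : ∀ {n} → (Fin n → Fin n → ℤ) → ℤ
∑² {n} f = sum {n} (λ x → sum {n} (λ y → f x y))

∑²-cong : ∀ {n} {f g : Fin n → Fin n → ℤ} → (∀ x y → f x y ≡ g x y) → ∑² f ≡ ∑² g
∑²-cong {n} f≡g = sum-cong-≗ {n} (λ x → sum-cong-≗ {n} (λ y → f≡g x y))

∑²-mono : ∀ {n} {f g : Fin n → Fin n → ℤ} → (∀ x y → f x y ≤ g x y) → ∑² f ≤ ∑² g
∑²-mono {n} f≤g = sum-mono {n} (λ x → sum-mono {n} (λ y → f≤g x y))

∑²-+ : ∀ {n} (f g : Fin n → Fin n → ℤ) → ∑² (λ x y → f x y + g x y) ≡ ∑² f + ∑² g
∑²-+ {n} f g = trans (sum-cong-≗ {n} (λ x → sum-+ {n} (f x) (g x))) (sum-+ {n} (λ x → sum {n} (f x)) (λ x → sum {n}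
    (g x)))

∑²-*ʳ : ∀ {n} c (f : Fin n → Fin n → ℤ) → ∑² (λ x y → f x y * c) ≡ c * ∑² f
∑²-*ʳ {n} c f = trans (∑²-cong (λ x y → ℤ.*-comm (f x y) c))
  (trans (sum-cong-≗ {n} (λ x → sum-*ˡ {n} c (f x))) (sum-*ˡ {n} c (λ x → sum {n} (f x))))

∑²-*ˡ : ∀ {n} c (f : Fin n → Fin n → ℤ) → ∑² (λ x y → c * f x y) ≡ c * ∑² f
∑²-*ˡ {n} c f = trans (sum-cong-≗ {n} (λ x → sum-*ˡ {n} c (f x))) (sum-*ˡ {n} c (λ x → sum {n} (f x)))

∑²-comm : ∀ {n} (f : Fin n → Fin n → Fin n → Fin n → ℤ) →
          ∑² (λ x y → ∑² (λ z w → f x y z w)) ≡ ∑² (λ z w → ∑² (λ x y → f x y z w))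
∑²-comm {n} f = begin
  sum {n} (λ x → sum {n} (λ y → sum {n} (λ z → sum {n} (λ w → f x y z w))))
    ≡⟨ sum-cong-≗ {n} (λ x → trans (∑-comm {n} {n} (λ y z → sum {n} (λ w → f x y z w)))
         (sum-cong-≗ {n} (λ z → ∑-comm {n} {n} (λ y w → f x y z w)))) ⟩
  sum {n} (λ x → sum {n} (λ z → sum {n} (λ w → sum {n} (λ y → f x y z w))))
    ≡⟨ trans (∑-comm {n} {n} (λ x z → sum {n} (λ w → sum {n} (λ y → f x y z w))))
         (sum-cong-≗ {n} (λ z → ∑-comm {n} {n} (λ x w → sum {n} (λ y → f x y z w)))) ⟩
  sum {n} (λ z → sum {n} (λ w → sum {n} (λ x → sum {n} (λ y → f x y z w)))) ∎
  where open ≡-Reasoning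

-- Positions and values are passed as two tuples because the integrand of interest is a condition on
-- positions times a condition on values.
integral : ∀ {n} (w : Fin n → Fin n → ℤ) k → (Vec (Fin n) k → Vec (Fin n) k → ℤ) → ℤ
integral w zero    W = W [] []
integral w (suc k) W = ∑² (λ x y → w x y * integral w k (λ xs ys → W (x ∷ xs) (y ∷ ys)))

module _ {n} (w : Fin n → Fin n → ℤ) where

  integral-cong : ∀ k {V W} → (∀ xs ys → V xs ys ≡ W xs ys) → integral w k V ≡ integral w k W
  integral-cong zero    V≡W = V≡W [] []
  integral-cong (suc k) V≡W = ∑²-cong (λ x y → cong (λ z → w x y * z) (integral-cong k (λ xs ys → V≡W (x ∷ xs)
      (y ∷ ys))))

  integral-mono : (∀ x y → 0ℤ ≤ w x y) → ∀ k {V W} → (∀ xs ys → V xs ys ≤ W xs ys) → integral w k V ≤ integral w k W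
  integral-mono 0≤w zero    V≤W = V≤W [] []
  integral-mono 0≤w (suc k) V≤W = ∑²-mono (λ x y → *-monoˡ (0≤w x y) (integral-mono 0≤w k (λ xs ys → V≤W (x ∷ xs)
      (y ∷ ys))))

  integral-+ : ∀ k V W → integral w k (λ xs ys → V xs ys + W xs ys) ≡ integral w k V + integral w k W
  integral-+ zero    V W = refl
  integral-+ (suc k) V W = trans
    (∑²-cong (λ x y → trans (cong (λ z → w x y * z) (integral-+ k (λ xs ys → V (x ∷ xs) (y ∷ ys)) (λ xs ys → W
        (x ∷ xs) (y ∷ ys))))
      (ℤ.*-distribˡ-+ (w x y) _ _)))
    (∑²-+ (λ x y → w x y * integral w k (λ xs ys → V (x ∷ xs) (y ∷ ys))) (λ x y → w x y * integral w k (λ xs ys → W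
        (x ∷ xs) (y ∷ ys))))

  integral-const : ∀ k c → integral w k (λ _ _ → c) ≡ ∑² w ^ k * c
  integral-const zero    c = sym (ℤ.*-identityˡ c)
  integral-const (suc k) c = trans (∑²-cong (λ x y → cong (λ z → w x y * z) (integral-const k c)))
    (trans (∑²-*ʳ (∑² w ^ k * c) w) (lem (∑² w) (∑² w ^ k) c))
    where
    lem : ∀ a b c → (b * c) * a ≡ (a * b) * c
    lem = solve-∀

  integral-∑²-comm : ∀ k (v : Fin n → Fin n → ℤ) (W : Fin n → Fin n → Vec (Fin n) k → Vec (Fin n) k → ℤ) →
    ∑² (λ x y → v x y * integral w k (W x y)) ≡ integral w k (λ xs ys → ∑² (λ x y → v x y * W x y xs ys))
  integral-∑²-comm zero    v W = refl
  integral-∑²-comm (suc k) v W = begin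
    ∑² (λ x y → v x y * ∑² (λ z u → w z u * I x y z u))
      ≡⟨ ∑²-cong (λ x y → sym (∑²-*ˡ (v x y) (λ z u → w z u * I x y z u))) ⟩
    ∑² (λ x y → ∑² (λ z u → v x y * (w z u * I x y z u)))
      ≡⟨ ∑²-comm (λ x y z u → v x y * (w z u * I x y z u)) ⟩
    ∑² (λ z u → ∑² (λ x y → v x y * (w z u * I x y z u)))
      ≡⟨ ∑²-cong (λ z u → trans (∑²-cong (λ x y → lem (v x y) (w z u) (I x y z u))) (∑²-*ˡ (w z u)
          (λ x y → v x y * I x y z u))) ⟩
    ∑² (λ z u → w z u * ∑² (λ x y → v x y * I x y z u))
      ≡⟨ ∑²-cong (λ z u → cong (λ e → w z u * e) (integral-∑²-comm k v (λ x y xs ys → W x y (z ∷ xs) (u ∷ ys)))) ⟩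
    ∑² (λ z u → w z u * integral w k (λ xs ys → ∑² (λ x y → v x y * W x y (z ∷ xs) (u ∷ ys)))) ∎
    where
    open ≡-Reasoning
    I : Fin n → Fin n → Fin n → Fin n → ℤ
    I x y z u = integral w k (λ xs ys → W x y (z ∷ xs) (u ∷ ys))
    lem : ∀ a b c → a * (b * c) ≡ b * (a * c)
    lem = solve-∀

-- Equal to `k η mass^(k-1)`; the recursion mirrors `telescoping` and avoids the exponent `k - 1`.
telescopingError : ℤ → ℤ → ℕ → ℤ
telescopingError η mass zero    = 0ℤ
telescopingError η mass (suc k) = mass * telescopingError η mass k + η * mass ^ k

module _ {n} {v w : Fin n → Fin n → ℤ} (0≤v : ∀ x y → 0ℤ ≤ v x y) (0≤w : ∀ x y → 0ℤ ≤ w x y)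
         (mass≡ : ∑² v ≡ ∑² w) {η : ℤ}
         (rectangle : ∀ (f g : Fin n → Bool) → Convex f → Convex g →
           ∑² (λ x y → v x y * (𝟙 (f x) * 𝟙 (g y))) ≤ ∑² (λ x y → w x y * (𝟙 (f x) * 𝟙 (g y))) + η) where

  -- Hybrid argument: the tail is exchanged first, by induction, with the head still weighted by
  -- `v`. After swapping the sums, the head is exchanged against fixed tails; its admissible
  -- positions and its admissible values are both convex, so they span a rectangle.
  telescoping : ∀ k (U V : Vec (Fin n) k → Bool) → CoordinatewiseConvex U → CoordinatewiseConvex V →
    integral v k (λ xs ys → 𝟙 (U xs) * 𝟙 (V ys)) ≤
    integral w k (λ xs ys → 𝟙 (U xs) * 𝟙 (V ys)) + telescopingError η (∑² w) k
  telescoping zero    U V U-convex V-convex = ℤ.≤-reflexive (sym (ℤ.+-identityʳ _))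
  telescoping (suc k) U V U-convex V-convex = begin
    ∑² (λ x y → v x y * integral v k (W x y))
      ≤⟨ ∑²-mono (λ x y → *-monoˡ (0≤v x y) (telescoping k (λ xs → U (x ∷ xs)) (λ ys → V (y ∷ ys)) (λ xs i → U-convex
          (x ∷ xs) (suc i)) (λ ys i → V-convex (y ∷ ys) (suc i)))) ⟩
    ∑² (λ x y → v x y * (integral w k (W x y) + e))
      ≡⟨ trans (∑²-cong (λ x y → ℤ.*-distribˡ-+ (v x y) (integral w k (W x y)) e))
               (∑²-+ (λ x y → v x y * integral w k (W x y)) (λ x y → v x y * e)) ⟩
    ∑² (λ x y → v x y * integral w k (W x y)) + ∑² (λ x y → v x y * e)
      ≡⟨ cong₂ _+_ (integral-∑²-comm w k v W) (trans (∑²-*ʳ e v) (trans (cong (λ z → e * z) mass≡) (ℤ.*-comm e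
          (∑² w)))) ⟩
    integral w k (λ xs ys → ∑² (λ x y → v x y * W x y xs ys)) + ∑² w * e
      ≤⟨ ℤ.+-monoˡ-≤ (∑² w * e) (integral-mono w 0≤w k (λ xs ys → rectangle (λ x → U (x ∷ xs)) (λ y → V (y ∷ ys))
             (λ {a} {b} {c} → slice U U-convex xs {a} {b} {c}) (λ {a} {b} {c} → slice V V-convex ys {a} {b} {c}))) ⟩
    integral w k (λ xs ys → ∑² (λ x y → w x y * W x y xs ys) + η) + ∑² w * e
      ≡⟨ cong (λ z → z + ∑² w * e) (trans (integral-+ w k (λ xs ys → ∑² (λ x y → w x y * W x y xs ys)) (λ _ _ → η))
           (cong₂ _+_ (sym (integral-∑²-comm w k w W)) (trans (integral-const w k η) (ℤ.*-comm (∑² w ^ k) η)))) ⟩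
    ∑² (λ x y → w x y * integral w k (W x y)) + η * ∑² w ^ k + ∑² w * e
      ≡⟨ lem (∑² (λ x y → w x y * integral w k (W x y))) (η * ∑² w ^ k) (∑² w * e) ⟩
    ∑² (λ x y → w x y * integral w k (W x y)) + (∑² w * e + η * ∑² w ^ k) ∎
    where
    open ℤ.≤-Reasoning
    e = telescopingError η (∑² w) k
    W : Fin n → Fin n → Vec (Fin n) k → Vec (Fin n) k → ℤ
    W x y xs ys = 𝟙 (U (x ∷ xs)) * 𝟙 (V (y ∷ ys))
    slice : ∀ (U : Vec (Fin n) (suc k) → Bool) → CoordinatewiseConvex U → ∀ xs → Convex (λ x → U (x ∷ xs))
    slice U U-convex xs {a} = U-convex (a ∷ xs) zero
    lem : ∀ a b c → a + b + c ≡ a + (c + b)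
    lem = solve-∀

integral-one : ∀ {n} k (f g : Vec (Fin n) k → ℤ) → integral (λ _ _ → 1ℤ) k (λ xs ys → f xs * g ys) ≡ ∑ᵛ k f * ∑ᵛ k g
integral-one zero    f g = refl
integral-one {n} (suc k) f g = trans
  (∑²-cong (λ x y → trans (ℤ.*-identityˡ _) (integral-one k (λ xs → f (x ∷ xs)) (λ ys → g (y ∷ ys)))))
  (sum-product {n} {n} (λ x → ∑ᵛ k (λ xs → f (x ∷ xs))) (λ y → ∑ᵛ k (λ ys → g (y ∷ ys))))

-- The graph of a permutation against the uniform grid

module GraphMeasure {n} (τ : Perm n) where
  private
    N = + n
    t′ : Fin n → Fin n
    t′ = τ ⟨$⟩ʳ_
    D = discrepancy τ
    F = dominated τ

  -- The factor `N` gives the graph the total mass `N * N` of the full grid, as `telescoping`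
  -- demands.
  graphMeasure : Fin n → Fin n → ℤ
  graphMeasure x y = N * δ (t′ x) y

  ∑²-graphMeasure : ∀ (f : Fin n → Fin n → ℤ) → ∑² (λ x y → graphMeasure x y * f x y) ≡ N * sum {n} (λ x → f x (t′ x))
  ∑²-graphMeasure f = trans
    (sum-cong-≗ {n} (λ x → trans (sum-cong-≗ {n} (λ y → ℤ.*-assoc N (δ (t′ x) y) (f x y)))
      (trans (sum-*ˡ {n} N (λ y → δ (t′ x) y * f x y)) (cong (λ z → N * z) (sum-δ (t′ x) (f x))))))
    (sum-*ˡ {n} N (λ x → f x (t′ x)))

  mass-graphMeasure : ∑² graphMeasure ≡ N * N
  mass-graphMeasure = trans (∑²-cong (λ x y → sym (ℤ.*-identityʳ (graphMeasure x y))))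
    (trans (∑²-graphMeasure (λ _ _ → 1ℤ)) (cong (λ z → N * z) (trans (sum-const n 1ℤ) (ℤ.*-identityʳ N))))

  mass-one : ∑² {n} (λ _ _ → 1ℤ) ≡ N * N
  mass-one = trans (sum-cong-≗ {n} (λ _ → sum-const n 1ℤ)) (trans (sum-const n (N * 1ℤ)) (cong (λ z → N * z)
      (ℤ.*-identityʳ N)))

  integral-graph : ∀ k (W : Vec (Fin n) k → Vec (Fin n) k → ℤ) →
                   integral graphMeasure k W ≡ N ^ k * ∑ᵛ k (λ xs → W xs (Vec.map t′ xs))
  integral-graph zero    W = sym (ℤ.*-identityˡ (W [] []))
  integral-graph (suc k) W = begin
    ∑² (λ x y → graphMeasure x y * integral graphMeasure k (λ xs ys → W (x ∷ xs) (y ∷ ys)))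
      ≡⟨ ∑²-graphMeasure (λ x y → integral graphMeasure k (λ xs ys → W (x ∷ xs) (y ∷ ys))) ⟩
    N * sum {n} (λ x → integral graphMeasure k (λ xs ys → W (x ∷ xs) (t′ x ∷ ys)))
      ≡⟨ cong (λ z → N * z) (sum-cong-≗ {n} (λ x → integral-graph k (λ xs ys → W (x ∷ xs) (t′ x ∷ ys)))) ⟩
    N * sum {n} (λ x → N ^ k * ∑ᵛ k (λ xs → W (x ∷ xs) (t′ x ∷ Vec.map t′ xs)))
      ≡⟨ cong (λ z → N * z) (sum-*ˡ {n} (N ^ k) (λ x → ∑ᵛ k (λ xs → W (x ∷ xs) (t′ x ∷ Vec.map t′ xs)))) ⟩
    N * (N ^ k * ∑ᵛ (suc k) (λ xs → W xs (Vec.map t′ xs)))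
      ≡⟨ sym (ℤ.*-assoc N (N ^ k) (∑ᵛ (suc k) (λ xs → W xs (Vec.map t′ xs)))) ⟩
    N * N ^ k * ∑ᵛ (suc k) (λ xs → W xs (Vec.map t′ xs)) ∎
    where open ≡-Reasoning

  private
    corners : ∀ lo hi lo′ hi′ → sum {n} (λ x → (below x hi - below x lo) * (below (t′ x) hi′ - below (t′ x) lo′))
              ≡ F hi hi′ - F hi lo′ - F lo hi′ + F lo lo′
    corners lo hi lo′ hi′ = begin
      sum {n} (λ x → (below x hi - below x lo) * (below (t′ x) hi′ - below (t′ x) lo′))
        ≡⟨ sum-cong-≗ {n} (λ x → expand (below x hi) (below x lo) (below (t′ x) hi′) (below (t′ x) lo′)) ⟩
      sum {n} (λ x → 1ℤ * (below x hi * below (t′ x) hi′ + below x lo * below (t′ x) lo′) + (- 1ℤ) *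
          (below x hi * below (t′ x) lo′) + (- 1ℤ) * (below x lo * below (t′ x) hi′))
        ≡⟨ sum-linear {n} 1ℤ (- 1ℤ) (- 1ℤ) (λ x → below x hi * below (t′ x) hi′ + below x lo * below (t′ x) lo′)
            (λ x → below x hi * below (t′ x) lo′) (λ x → below x lo * below (t′ x) hi′) ⟩
      1ℤ * sum {n} (λ x → below x hi * below (t′ x) hi′ + below x lo * below (t′ x) lo′) + (- 1ℤ) * F hi lo′ +
          (- 1ℤ) * F lo hi′
        ≡⟨ cong (λ z → 1ℤ * z + (- 1ℤ) * F hi lo′ + (- 1ℤ) * F lo hi′) (sum-+ {n} (λ x → below x hi * below
            (t′ x) hi′) (λ x → below x lo * below (t′ x) lo′)) ⟩
      1ℤ * (F hi hi′ + F lo lo′) + (- 1ℤ) * F hi lo′ + (- 1ℤ) * F lo hi′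
        ≡⟨ collect (F hi hi′) (F lo lo′) (F hi lo′) (F lo hi′) ⟩
      F hi hi′ - F hi lo′ - F lo hi′ + F lo lo′ ∎
      where
      open ≡-Reasoning
      expand : ∀ a b c d → (a - b) * (c - d) ≡ 1ℤ * (a * c + b * d) + (- 1ℤ) * (a * d) + (- 1ℤ) * (b * c)
      expand = solve-∀
      collect : ∀ a b c d → 1ℤ * (a + b) + (- 1ℤ) * c + (- 1ℤ) * d ≡ a - c - d + b
      collect = solve-∀

    sum-interval : ∀ lo hi → lo ℕ.≤ n → hi ℕ.≤ n → sum {n} (λ x → below x hi - below x lo) ≡ + hi - + lo
    sum-interval lo hi lo≤n hi≤n = trans (sum-+ {n} (λ x → below x hi) (λ x → - below x lo))
      (cong₂ _+_ (sum-below hi hi≤n)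
        (trans (sum-cong-≗ {n} (λ x → sym (ℤ.-1*i≡-i (below x lo)))) (trans (sum-*ˡ {n} (- 1ℤ) (λ x → below x lo))
          (trans (ℤ.-1*i≡-i _) (cong -_ (sum-below lo lo≤n))))))

  rectangle-discrepancy : ∀ {B} → (∀ h h′ → h ℕ.≤ n → h′ ℕ.≤ n → D h h′ ≤ B × - D h h′ ≤ B) →
    ∀ (f g : Fin n → Bool) → Convex f → Convex g →
    let μ = ∑² (λ x y → graphMeasure x y * (𝟙 (f x) * 𝟙 (g y)))
        ν = ∑² (λ x y → 1ℤ * (𝟙 (f x) * 𝟙 (g y)))
    in μ ≤ ν + + 4 * B × ν ≤ μ + + 4 * B
  rectangle-discrepancy {B} D≤B f g f-convex g-convex
    with lo , hi , lo≤n , hi≤n , f≡ ← convex⇒interval f f-convex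
       | lo′ , hi′ , lo′≤n , hi′≤n , g≡ ← convex⇒interval g g-convex =
    subst₂ (λ a b → a ≤ b + + 4 * B) (sym μ≡) (sym ν≡)
      (≤-by-gap (up N (F hi hi′) (F hi lo′) (F lo hi′) (F lo lo′) (+ hi) (+ lo) (+ hi′) (+ lo′) B)
        (nonneg-+ (nonneg-+ (gap (proj₁ (D≤B hi hi′ hi≤n hi′≤n))) (gap (proj₂ (D≤B hi lo′ hi≤n lo′≤n))))
                  (nonneg-+ (gap (proj₂ (D≤B lo hi′ lo≤n hi′≤n))) (gap (proj₁ (D≤B lo lo′ lo≤n lo′≤n)))))) ,
    subst₂ (λ a b → a ≤ b + + 4 * B) (sym ν≡) (sym μ≡)
      (≤-by-gap (down N (F hi hi′) (F hi lo′) (F lo hi′) (F lo lo′) (+ hi) (+ lo) (+ hi′) (+ lo′) B)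
        (nonneg-+ (nonneg-+ (gap (proj₂ (D≤B hi hi′ hi≤n hi′≤n))) (gap (proj₁ (D≤B hi lo′ hi≤n lo′≤n))))
                  (nonneg-+ (gap (proj₁ (D≤B lo hi′ lo≤n hi′≤n))) (gap (proj₂ (D≤B lo lo′ lo≤n lo′≤n))))))
    where
    up : ∀ N a b c d h l h′ l′ B → ((h - l) * (h′ - l′) + + 4 * B) - N * (a - b - c + d) ≡
      ((B - (N * a - h * h′)) + (B - (- (N * b - h * l′)))) + ((B - (- (N * c - l * h′))) + (B - (N * d - l * l′)))
    up = solve-∀
    down : ∀ N a b c d h l h′ l′ B → (N * (a - b - c + d) + + 4 * B) - (h - l) * (h′ - l′) ≡
      ((B - (- (N * a - h * h′))) + (B - (N * b - h * l′))) + ((B - (N * c - l * h′)) + (B - (- (N * d - l * l′))))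
    down = solve-∀
    μ≡ : ∑² (λ x y → graphMeasure x y * (𝟙 (f x) * 𝟙 (g y))) ≡ N * (F hi hi′ - F hi lo′ - F lo hi′ + F lo lo′)
    μ≡ = trans (∑²-graphMeasure (λ x y → 𝟙 (f x) * 𝟙 (g y)))
      (cong (λ z → N * z) (trans (sum-cong-≗ {n} (λ x → cong₂ _*_ (f≡ x) (g≡ (t′ x)))) (corners lo hi lo′ hi′)))
    ν≡ : ∑² (λ x y → 1ℤ * (𝟙 (f x) * 𝟙 (g y))) ≡ (+ hi - + lo) * (+ hi′ - + lo′)
    ν≡ = trans (∑²-cong (λ x y → trans (ℤ.*-identityˡ _) (cong₂ _*_ (f≡ x) (g≡ y))))
      (trans (sum-product {n} {n} (λ x → below x hi - below x lo) (λ y → below y hi′ - below y lo′))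
        (cong₂ _*_ (sum-interval lo hi lo≤n hi≤n) (sum-interval lo′ hi′ lo′≤n hi′≤n)))

  -- Against the constant weight the conditions on positions and on values decouple, and each is met
  -- by `n C k` tuples. The two inequalities come from `telescoping` with the two weights in either
  -- order.
  occurrences-approx : ∀ {B} → (∀ h h′ → h ℕ.≤ n → h′ ℕ.≤ n → D h h′ ≤ B × - D h h′ ≤ B) →
    ∀ {k} (π : Perm k) → let c = + (n C k); e = telescopingError (+ 4 * B) (N * N) k in
    N ^ k * + occurrences π τ ≤ c * c + e × c * c ≤ N ^ k * + occurrences π τ + e
  occurrences-approx {B} D≤B {k} π =
    subst₂ (λ a b → a ≤ b + telescopingError (+ 4 * B) (N * N) k) μ≡ ν≡
      (subst (λ z → μ ≤ ν + telescopingError (+ 4 * B) z k) mass-one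
        (telescoping 0≤graph 0≤one (trans mass-graphMeasure (sym mass-one)) (λ f g fc gc → proj₁
            (rectangle-discrepancy D≤B f g fc gc)) k U V U-convex V-convex)) ,
    subst₂ (λ a b → a ≤ b + telescopingError (+ 4 * B) (N * N) k) ν≡ μ≡
      (subst (λ z → ν ≤ μ + telescopingError (+ 4 * B) z k) mass-graphMeasure
        (telescoping 0≤one 0≤graph (trans mass-one (sym mass-graphMeasure)) (λ f g fc gc → proj₂
            (rectangle-discrepancy D≤B f g fc gc)) k U V U-convex V-convex))
    where
    U V : Vec (Fin n) k → Bool
    U xs = matches id (lookup xs)
    V ys = matches (π ⟨$⟩ʳ_) (lookup ys)
    U-convex : CoordinatewiseConvex U
    U-convex = matches-convex id
    V-convex : CoordinatewiseConvex V
    V-convex = matches-convex (π ⟨$⟩ʳ_)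
    μ = integral graphMeasure k (λ xs ys → 𝟙 (U xs) * 𝟙 (V ys))
    ν = integral {n} (λ _ _ → 1ℤ) k (λ xs ys → 𝟙 (U xs) * 𝟙 (V ys))
    0≤graph : ∀ x y → 0ℤ ≤ graphMeasure x y
    0≤graph x y = nonneg-* {N} nonneg-pos (𝟙-nonneg ⌊ t′ x Fin.≟ y ⌋)
    0≤one : ∀ (x y : Fin n) → 0ℤ ≤ 1ℤ
    0≤one _ _ = nonneg-pos
    μ≡ : μ ≡ N ^ k * + occurrences π τ
    μ≡ = trans (integral-graph k (λ xs ys → 𝟙 (U xs) * 𝟙 (V ys))) (cong (λ z → N ^ k * z) (trans
      (∑ᵛ-cong k (λ xs → cong (λ b → 𝟙 (U xs) * 𝟙 b) (matches-cong {s = π ⟨$⟩ʳ_} (λ _ → refl)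
          (λ i → Vec.lookup-map i t′ xs))))
      (sym (occurrences≡∑ π τ))))
    ν≡ : ν ≡ + (n C k) * + (n C k)
    ν≡ = trans (integral-one k (𝟙 ∘ U) (𝟙 ∘ V)) (cong₂ _*_ (∑-matches-id k n) (∑-matches-perm n π))

open GraphMeasure

-- Binomial coefficients

-- For `suc n` both sides equal `(1 + n) C(n, k)`, by the induction hypothesis at `k` and at
-- `k - 1`. In ℤ the factor `n - k` may be negative, but then the binomial before it is zero.
absorption : ∀ n k → (1ℤ + + k) * + (n C suc k) ≡ + (n C k) * (+ n - + k)
absorption zero    zero    = refl
absorption zero    (suc k) = trans (ℤ.*-zeroʳ (1ℤ + + suc k)) (sym (ℤ.*-zeroˡ (+ 0 - + suc k)))
absorption (suc n) k = trans top (sym (bottom k))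
  where
  top : (1ℤ + + k) * + (suc n C suc k) ≡ (1ℤ + + n) * + (n C k)
  top = begin
    (1ℤ + + k) * + (suc n C suc k)                          ≡⟨ cong (λ z → (1ℤ + + k) * + z) (sym
        (nCk+nC[k+1]≡[n+1]C[k+1] n k)) ⟩
    (1ℤ + + k) * (+ (n C k) + + (n C suc k))                ≡⟨ ℤ.*-distribˡ-+ (1ℤ + + k) (+ (n C k)) (+ (n C suc k)) ⟩
    (1ℤ + + k) * + (n C k) + (1ℤ + + k) * + (n C suc k)     ≡⟨ cong (λ z → (1ℤ + + k) * + (n C k) + z)
        (absorption n k) ⟩
    (1ℤ + + k) * + (n C k) + + (n C k) * (+ n - + k)        ≡⟨ lem (+ k) (+ n) (+ (n C k)) ⟩
    (1ℤ + + n) * + (n C k)                                  ∎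
    where
    open ≡-Reasoning
    lem : ∀ k n c → (1ℤ + k) * c + c * (n - k) ≡ (1ℤ + n) * c
    lem = solve-∀
  bottom : ∀ k → + (suc n C k) * (+ suc n - + k) ≡ (1ℤ + + n) * + (n C k)
  bottom zero    = lem (1ℤ + + n)
    where
    lem : ∀ n → 1ℤ * (n - 0ℤ) ≡ n * 1ℤ
    lem = solve-∀
  bottom (suc k) = begin
    + (suc n C suc k) * (1ℤ + + n - (1ℤ + + k))             ≡⟨ cong (λ z → + z * (1ℤ + + n - (1ℤ + + k))) (sym
        (nCk+nC[k+1]≡[n+1]C[k+1] n k)) ⟩
    (+ (n C k) + + (n C suc k)) * (1ℤ + + n - (1ℤ + + k))   ≡⟨ split (+ n) (+ k) (+ (n C k)) (+ (n C suc k)) ⟩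
    + (n C k) * (+ n - + k) + + (n C suc k) * (+ n - + k)   ≡⟨ cong (λ z → z + + (n C suc k) * (+ n - + k)) (sym
        (absorption n k)) ⟩
    (1ℤ + + k) * + (n C suc k) + + (n C suc k) * (+ n - + k) ≡⟨ merge (+ n) (+ k) (+ (n C suc k)) ⟩
    (1ℤ + + n) * + (n C suc k)                              ∎
    where
    open ≡-Reasoning
    split : ∀ n k a b → (a + b) * (1ℤ + n - (1ℤ + k)) ≡ a * (n - k) + b * (n - k)
    split = solve-∀
    merge : ∀ n k b → (1ℤ + k) * b + b * (n - k) ≡ (1ℤ + n) * b
    merge = solve-∀

falling : ℕ → ℕ → ℤ
falling n k = + (k !) * + (n C k)

falling-suc : ∀ n k → falling n (suc k) ≡ falling n k * (+ n - + k)
falling-suc n k = begin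
  + (suc k ℕ.* k !) * + (n C suc k)            ≡⟨ cong (λ z → z * + (n C suc k)) (ℤ.pos-* (suc k) (k !)) ⟩
  + suc k * + (k !) * + (n C suc k)            ≡⟨ regroup (+ suc k) (+ (k !)) (+ (n C suc k)) ⟩
  + (k !) * ((1ℤ + + k) * + (n C suc k))       ≡⟨ cong (λ z → + (k !) * z) (absorption n k) ⟩
  + (k !) * (+ (n C k) * (+ n - + k))          ≡⟨ sym (ℤ.*-assoc (+ (k !)) (+ (n C k)) (+ n - + k)) ⟩
  falling n k * (+ n - + k)                    ∎
  where
  open ≡-Reasoning
  regroup : ∀ a b c → a * b * c ≡ b * (a * c)
  regroup = solve-∀

falling-nonneg : ∀ n k → 0ℤ ≤ falling n k
falling-nonneg n k = nonneg-* {+ (k !)} {+ (n C k)} nonneg-pos nonneg-pos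

falling≤power : ∀ n k → falling n k ≤ (+ n) ^ k
falling≤power n zero    = ℤ.≤-refl
falling≤power n (suc k) = subst (_≤ + n * (+ n) ^ k) (sym (falling-suc n k))
  (≤-by-gap (lem (+ n) (+ k) (falling n k) ((+ n) ^ k))
    (nonneg-+ (nonneg-* {+ n} nonneg-pos (gap (falling≤power n k))) (nonneg-* {+ k} nonneg-pos (falling-nonneg n k))))
  where
  lem : ∀ N k f p → N * p - f * (N - k) ≡ N * (p - f) + k * f
  lem = solve-∀

power-nonneg : ∀ n k → 0ℤ ≤ (+ n) ^ k
power-nonneg n k = ℤ.≤-trans (falling-nonneg n k) (falling≤power n k)

-- The power exceeds the falling factorial by at most `k² n^(k-1)`; the extra factor `n` avoids the
-- exponent `k - 1`. In the induction `(k+1)²` splits as `k² + k + (k+1)`.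
power≤falling : ∀ n k → + n * (+ n) ^ k ≤ + n * falling n k + + k * + k * (+ n) ^ k
power≤falling n zero    = ℤ.≤-reflexive (sym (ℤ.+-identityʳ (+ n * 1ℤ)))
power≤falling n (suc k) = subst (λ z → + n * (+ n * (+ n) ^ k) ≤ + n * z + + suc k * + suc k * (+ n * (+ n) ^ k))
    (sym (falling-suc n k))
  (≤-by-gap (lem (+ n) (+ k) (falling n k) ((+ n) ^ k))
    (nonneg-+ (nonneg-+ (nonneg-* {+ n} nonneg-pos (gap (power≤falling n k)))
                        (nonneg-* {+ k * + n} (nonneg-* {+ k} {+ n} nonneg-pos nonneg-pos) (gap (falling≤power n k))))
              (nonneg-* {+ suc k * + n} (nonneg-* {+ suc k} {+ n} nonneg-pos nonneg-pos) (power-nonneg n k))))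
  where
  lem : ∀ N k f p → (N * (f * (N - k)) + (1ℤ + k) * (1ℤ + k) * (N * p)) - N * (N * p) ≡
        N * ((N * f + k * k * p) - N * p) + k * N * (p - f) + (1ℤ + k) * N * p
  lem = solve-∀

-- Error estimates and choice of constants

telescopingError-bound : ∀ {K η T c} → 0ℤ ≤ T → (∀ k → 0ℤ ≤ T ^ k) → K * η ≤ c * T →
                         ∀ k → K * telescopingError η T k ≤ c * + k * T ^ k
telescopingError-bound {K} {η} {T} {c} 0≤T 0≤Tᵏ Kη≤cT zero = ℤ.≤-reflexive (trans (ℤ.*-zeroʳ K) (lem c))
  where
  lem : ∀ c → 0ℤ ≡ c * 0ℤ * 1ℤ
  lem = solve-∀
telescopingError-bound {K} {η} {T} {c} 0≤T 0≤Tᵏ Kη≤cT (suc k) = ≤-by-gap (lem K η T c (+ k) (T ^ k)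
    (telescopingError η T k))
  (nonneg-+ (nonneg-* 0≤T (gap (telescopingError-bound {K} {η} {T} {c} 0≤T 0≤Tᵏ Kη≤cT k))) (nonneg-* (0≤Tᵏ k)
      (gap Kη≤cT)))
  where
  lem : ∀ K η T c k p e → c * (1ℤ + k) * (T * p) - K * (T * e + η * p) ≡ T * (c * k * p - K * e) + p * (c * T - K * η)
  lem = solve-∀

square-power : ∀ N k → (N * N) ^ k ≡ N ^ k * N ^ k
square-power N zero    = refl
square-power N (suc k) = trans (cong (λ z → N * N * z) (square-power N k)) (lem N (N ^ k))
  where
  lem : ∀ N p → N * N * (p * p) ≡ N * p * (N * p)
  lem = solve-∀

-- Applied with P = N^k, c = C(n,k), f = k!, o the number of occurrences and accuracy 1/q.
density-estimate : ∀ {q k f c o P N e} → 1ℤ ≤ q → 1ℤ ≤ k → 1ℤ ≤ f → 0ℤ ≤ c → 1ℤ ≤ P → 1ℤ ≤ N →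
  f * c ≤ P → N * P ≤ N * (f * c) + k * k * P → + 3 * q * (k * k) ≤ N →
  (+ 72 * k * f * q) * e ≤ + 12 * k * (P * P) → P * o ≤ c * c + e → c * c ≤ P * o + e →
  1ℤ ≤ c × (+ 3 * q * (f * o - c) ≤ + 2 * (f * c)) × (+ 3 * q * (c - f * o) ≤ + 2 * (f * c))
density-estimate {q} {k} {f} {c} {o} {P} {N} {e} 1≤q 1≤k 1≤f 0≤c 1≤P 1≤N fc≤P NP≤ N-large e-small Po≤ c²≤ = 1≤c ,
    upper , lower
  where
  pos : ∀ {a} → 1ℤ ≤ a → 0ℤ ≤ a
  pos = ℤ.≤-trans nonneg-pos
  cancel : ∀ {x a b} → 1ℤ ≤ x → x * a ≤ x * b → a ≤ b
  cancel {+ suc m} {a} {b} (+≤+ _) = ℤ.*-cancelˡ-≤-pos a b (+ suc m)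
  0≤q = pos 1≤q
  0≤k = pos 1≤k
  0≤f = pos 1≤f
  0≤P = pos 1≤P
  0≤N = pos 1≤N
  0≤fc = nonneg-* 0≤f 0≤c
  1≤kk : 1ℤ ≤ k * k
  1≤kk = *-mono {1ℤ} {k} {1ℤ} {k} nonneg-pos nonneg-pos 1≤k 1≤k
  0≤kk = pos 1≤kk
  -- The relative gap between power and falling factorial is at most `k²/N`, hence at most `1/(3q)`.
  P≤2fc : P ≤ + 2 * (f * c)
  P≤2fc = cancel 1≤N (≤-by-gap (lem N P (f * c) (k * k) q)
    (nonneg-+ (nonneg-+ (nonneg-* {+ 2} nonneg-pos (gap NP≤)) (nonneg-* 0≤P (gap N-large)))
              (nonneg-+ (nonneg-* {+ 3} nonneg-pos (nonneg-* (nonneg-* 0≤kk 0≤P) (gap 1≤q))) (nonneg-* 0≤kk 0≤P))))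
    where
    lem : ∀ N P x y q → N * (+ 2 * x) - N * P ≡
      + 2 * ((N * x + y * P) - N * P) + P * (N - + 3 * q * y) + (+ 3 * (y * P * (q - 1ℤ)) + y * P)
    lem = solve-∀
  1≤c : 1ℤ ≤ c
  1≤c with 1ℤ ℤ.≤? c
  ... | yes 1≤c = 1≤c
  ... | no  1≰c = contradiction (ℤ.≤-trans 1≤P (ℤ.≤-trans P≤2fc (≤-by-gap (lem f c) (nonneg-*
      (nonneg-* {+ 2} nonneg-pos 0≤f) (gap (ℤ.i<j⇒i≤pred[j] (ℤ.≰⇒> 1≰c)))))))
                                (ℤ.<⇒≱ (ℤ.+<+ (ℕ.s≤s ℕ.z≤n)))
    where
    lem : ∀ f c → 0ℤ - + 2 * (f * c) ≡ + 2 * f * (0ℤ - c)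
    lem = solve-∀
  -- 72 = 12 · 2 · 3: the 12 of the bound on `e`, the 2 of `P≤2fc`, and the 3 of the share `1/(3q)`
  -- granted to this error.
  3qfe≤ : + 3 * q * f * e ≤ P * (f * c)
  3qfe≤ = cancel {+ 2} (+≤+ (ℕ.s≤s ℕ.z≤n)) (cancel {+ 12 * k} (pos-12k) (≤-by-gap (lem k f q e P (f * c))
    (nonneg-+ (gap e-small) (nonneg-* (nonneg-* (nonneg-* {+ 12} nonneg-pos 0≤k) 0≤P) (gap P≤2fc)))))
    where
    pos-12k : 1ℤ ≤ + 12 * k
    pos-12k = ℤ.≤-trans (+≤+ {1} {12} (ℕ.s≤s ℕ.z≤n)) (*-monoˡ {1ℤ} {k} {+ 12} nonneg-pos 1≤k)
    lem : ∀ k f q e P x → + 12 * k * (+ 2 * (P * x)) - + 12 * k * (+ 2 * (+ 3 * q * f * e)) ≡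
          (+ 12 * k * (P * P) - + 72 * k * f * q * e) + + 12 * k * P * (+ 2 * x - P)
    lem = solve-∀
  -- The second error, power against falling factorial, costs another `1/(3q)`. It matters only for
  -- `lower`; in `upper` it has the favourable sign.
  3qc≤ : + 3 * q * (c * (P - f * c)) ≤ P * (f * c)
  3qc≤ = cancel 1≤N (≤-by-gap (lem N P f c (k * k) q)
    (nonneg-+ (nonneg-+ (nonneg-* (nonneg-* (nonneg-* {+ 3} nonneg-pos 0≤q) 0≤c) (gap NP≤)) (nonneg-*
        (nonneg-* 0≤c 0≤P) (gap N-large)))
              (nonneg-* (nonneg-* (nonneg-* 0≤N 0≤P) 0≤c) (gap 1≤f))))
    where
    lem : ∀ N P f c y q → N * (P * (f * c)) - N * (+ 3 * q * (c * (P - f * c))) ≡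
      + 3 * q * c * ((N * (f * c) + y * P) - N * P) + c * P * (N - + 3 * q * y) + N * P * c * (f - 1ℤ)
    lem = solve-∀
  3qf≥0 = nonneg-* (nonneg-* {+ 3} nonneg-pos 0≤q) 0≤f
  upper : + 3 * q * (f * o - c) ≤ + 2 * (f * c)
  upper = cancel 1≤P (≤-by-gap (lem P q f o c e)
    (nonneg-+ (nonneg-+ (gap 3qfe≤) (nonneg-* 3qf≥0 (gap Po≤)))
              (nonneg-+ (nonneg-* (nonneg-* (nonneg-* {+ 3} nonneg-pos 0≤q) 0≤c) (gap fc≤P)) (nonneg-* 0≤P 0≤fc))))
    where
    lem : ∀ P q f o c e → P * (+ 2 * (f * c)) - P * (+ 3 * q * (f * o - c)) ≡
      (P * (f * c) - + 3 * q * f * e) + + 3 * q * f * ((c * c + e) - P * o) + (+ 3 * q * c * (P - f * c) + P * (f * c))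
    lem = solve-∀
  lower : + 3 * q * (c - f * o) ≤ + 2 * (f * c)
  lower = cancel 1≤P (≤-by-gap (lem P q f o c e)
    (nonneg-+ (nonneg-+ (gap 3qfe≤) (nonneg-* 3qf≥0 (gap c²≤))) (gap 3qc≤)))
    where
    lem : ∀ P q f o c e → P * (+ 2 * (f * c)) - P * (+ 3 * q * (c - f * o)) ≡
      (P * (f * c) - + 3 * q * f * e) + + 3 * q * f * ((P * o + e) - c * c) + (P * (f * c) - + 3 * q * (c *
          (P - f * c)))
    lem = solve-∀

-- Otherwise, with `Z = (JL)⁴ N²`, multiplication by `42 J⁴` would give `42 Z ≤ 41 N⁶ ≤ 41 Z` for a
-- positive `Z`. This is why `E` carries 42, one more than the constant of `gridEnergy-bound`.
energy-small : ∀ {J L N G} → 1ℤ ≤ N → N ≤ J * L → (+ 42 * (J * J * J * J)) * G ≤ + 41 * (N * N * N * (N * N * N)) →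
               G ℤ.< L * (L * (L * N * (L * N)))
energy-small {J} {L} {N} {G} 1≤N N≤JL EG≤ = ℤ.≰⇒> (λ Y≤G → contradiction (ℤ.≤-trans 1≤Z (Z≤0 Y≤G)) (ℤ.<⇒≱ (ℤ.+<+
    (ℕ.s≤s ℕ.z≤n))))
  where
  X = J * L
  0≤N = ℤ.≤-trans nonneg-pos 1≤N
  0≤X = ℤ.≤-trans 0≤N N≤JL
  1≤X = ℤ.≤-trans 1≤N N≤JL
  X² = *-mono 0≤N 0≤N N≤JL N≤JL
  Z = X * X * (X * X) * (N * N)
  0≤N² = nonneg-square N
  N⁶≤Z : N * N * (N * N) * (N * N) ≤ Z
  N⁶≤Z = *-mono (nonneg-* 0≤N² 0≤N²) 0≤N² (*-mono 0≤N² 0≤N² X² X²) ℤ.≤-refl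
  1≤² : ∀ {a} → 1ℤ ≤ a → 1ℤ ≤ a * a
  1≤² {a} 1≤a = *-mono {1ℤ} {a} {1ℤ} {a} nonneg-pos nonneg-pos 1≤a 1≤a
  1≤Z : 1ℤ ≤ Z
  1≤Z = *-mono {1ℤ} {X * X * (X * X)} {1ℤ} {N * N} nonneg-pos nonneg-pos (1≤² {X * X} (1≤² 1≤X)) (1≤² 1≤N)
  J⁴≥0 : 0ℤ ≤ J * J * J * J
  J⁴≥0 = subst (0ℤ ≤_) (lem J) (nonneg-square (J * J))
    where
    lem : ∀ J → J * J * (J * J) ≡ J * J * J * J
    lem = solve-∀
  Z≤0 : L * (L * (L * N * (L * N))) ≤ G → Z ≤ 0ℤ
  Z≤0 Y≤G = ≤-by-gap (lem J L N G)
    (nonneg-+ (nonneg-+ (gap EG≤) (nonneg-* {+ 41} nonneg-pos (gap N⁶≤Z))) (nonneg-*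
        (nonneg-* {+ 42} nonneg-pos J⁴≥0) (gap Y≤G)))
    where
    lem : ∀ J L N G → 0ℤ - J * L * (J * L) * (J * L * (J * L)) * (N * N) ≡
      (+ 41 * (N * N * N * (N * N * N)) - (+ 42 * (J * J * J * J)) * G)
      + + 41 * (J * L * (J * L) * (J * L * (J * L)) * (N * N) - N * N * (N * N) * (N * N))
      + (+ 42 * (J * J * J * J)) * (G - L * (L * (L * N * (L * N))))
    lem = solve-∀

-- Densities as integer inequalities

positive⇒suc : ∀ {x} → 1ℤ ≤ x → ∃[ m ] + suc m ≡ x
positive⇒suc {+ suc m} _ = m , refl
positive⇒suc {+ zero}  (+≤+ ())

1≤power : ∀ {n} → 1 ℕ.≤ n → ∀ k → 1ℤ ≤ (+ n) ^ k
1≤power         1≤n zero    = ℤ.≤-refl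
1≤power {n} 1≤n (suc k) = *-mono {1ℤ} {+ n} {1ℤ} {(+ n) ^ k} nonneg-pos nonneg-pos (+≤+ 1≤n) (1≤power 1≤n k)

occurrences≤C : ∀ {k n} (π : Perm k) (τ : Perm n) → + occurrences π τ ≤ + (n C k)
occurrences≤C {k} {n} π τ = subst₂ _≤_ (sym (occurrences≡∑ π τ)) (∑-matches-id k n)
  (∑ᵛ-mono k (λ xs → subst (𝟙 (matches id (lookup xs)) * 𝟙 (matches (π ⟨$⟩ʳ_) ((τ ⟨$⟩ʳ_) ∘ lookup xs)) ≤_)
      (ℤ.*-identityʳ (𝟙 (matches id (lookup xs))))
    (*-monoˡ (𝟙-nonneg (matches id (lookup xs))) (𝟙≤1 (matches (π ⟨$⟩ʳ_) ((τ ⟨$⟩ʳ_) ∘ lookup xs))))))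

occurrences-cong : ∀ {k n} {π ρ : Perm k} (τ : Perm n) → (∀ i → π ⟨$⟩ʳ i ≡ ρ ⟨$⟩ʳ i) → occurrences π τ ≡ occurrences ρ τ
occurrences-cong {k} {π = π} {ρ} τ π≗ρ = ℤ.+-injective (trans (occurrences≡∑ π τ) (trans
  (∑ᵛ-cong k (λ xs → cong (λ b → 𝟙 (matches id (lookup xs)) * 𝟙 b) (matches-cong {p = (τ ⟨$⟩ʳ_) ∘ lookup xs} π≗ρ
      (λ _ → refl))))
  (sym (occurrences≡∑ ρ τ))))

module Finitary {n k} (τ : Perm n) (π : Perm k) (1≤k : 1 ℕ.≤ k) {q : ℕ} (1≤q : 1 ℕ.≤ q) {K E : ℕ} {J : ℤ}
    (1≤K : 1 ℕ.≤ K) (1≤E : 1 ℕ.≤ E) where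
  private
    N = + n
    f = + (k !)
    c = + (n C k)
    o = + occurrences π τ

  -- `K` and `E` are naturals tied to their integer formulas by equations: `K` serves as a divisor
  -- of `n`, and `E` later becomes the denominator of a tolerance.
  finitary-quasirandomness :
    + K ≡ + 72 * + k * f * + q → J ≡ + 2 * + K → + E ≡ + 42 * (J * J * J * J) →
    K ℕ.≤ n → E ℕ.≤ n → + 3 * + q * (+ k * + k) ≤ N →
    (∀ (ρ : Perm 4) → (+ 576 * + E) * + occurrences ρ τ ≤ (+ E + + 24) * (N * N * N * N)) →
    1ℤ ≤ c × (+ 3 * + q * (f * o - c) ≤ + 2 * (f * c)) × (+ 3 * + q * (c - f * o) ≤ + 2 * (f * c))
  finitary-quasirandomness K≡ J≡ E≡ K≤n E≤n N-large occ≤ =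
    density-estimate {+ q} {+ k} {f} {c} {o} {N ^ k} {N} {e}
      (+≤+ 1≤q) (+≤+ 1≤k) (+≤+ (ℕ.1≤n! k)) nonneg-pos (1≤power 1≤n k) (+≤+ 1≤n)
      (falling≤power n k) (power≤falling n k) N-large e-small (proj₁ approx) (proj₂ approx)
    where
    1≤n : 1 ℕ.≤ n
    1≤n = ℕ.≤-trans 1≤K K≤n
    instance
      K-nonZero : NonZero K
      K-nonZero = ℕ.>-nonZero 1≤K
    L = n / K
    L≥1 : 1 ℕ.≤ L
    L≥1 = m≥n⇒m/n>0 K≤n
    -- Rounding in `n / K` costs at most one `K`, which `L ≥ 1` absorbs into `L * K`; hence the 2 in
    -- `J`.
    N≤JL : N ≤ J * + L
    N≤JL = subst (N ≤_) (trans (lem (+ K) (+ L)) (cong (λ z → z * + L) (sym J≡))) (subst (λ z → N ≤ z + z)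
        (ℤ.pos-* L K) (+≤+ (ℕ.≤-trans (ℕ.≤-reflexive (m≡m%n+[m/n]*n n K))
      (ℕ.+-monoˡ-≤ (L ℕ.* K) (ℕ.≤-trans (ℕ.<⇒≤ (m%n<n n K)) (ℕ.≤-trans (ℕ.≤-reflexive (sym (ℕ.*-identityˡ K)))
          (ℕ.*-monoˡ-≤ K L≥1)))))))
      where
      lem : ∀ K L → L * K + L * K ≡ + 2 * K * L
      lem = solve-∀
    LK≤N : + L * + K ≤ N
    LK≤N = subst (_≤ N) (ℤ.pos-* L K) (+≤+ (m/n*n≤m n K))
    B = + 3 * + L * N
    small : gridEnergy τ ℤ.< + L * (+ L * (+ L * N * (+ L * N)))
    small = energy-small {J} {+ L} {N} (+≤+ 1≤n) N≤JL
      (subst (λ z → z * gridEnergy τ ≤ + 41 * (N * N * N * (N * N * N))) E≡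
        (gridEnergy-bound τ {+ E} (+≤+ 1≤E) (+≤+ E≤n) occ≤))
    e = telescopingError (+ 4 * B) (N * N) k
    approx = occurrences-approx τ {B} (discrepancy-bound τ {L} small) π
    -- 12 = 4 · 3: four corners of a rectangle, each with discrepancy at most `3LN`, and
    -- `L * K ≤ N`.
    e-small : (+ 72 * + k * f * + q) * e ≤ + 12 * + k * (N ^ k * N ^ k)
    e-small = subst₂ (λ a b → a * e ≤ + 12 * + k * b) K≡ (square-power N k)
      (telescopingError-bound {+ K} {+ 4 * B} {N * N} {+ 12} (nonneg-square N)
        (λ i → subst (0ℤ ≤_) (sym (square-power N i)) (nonneg-square (N ^ i)))
        (≤-by-gap (lem (+ K) (+ L) N) (nonneg-* {+ 12 * N} (nonneg-* {+ 12} {N} nonneg-pos nonneg-pos) (gap LK≤N))) k)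
      where
      lem : ∀ K L N → + 12 * (N * N) - K * (+ 4 * (+ 3 * L * N)) ≡ + 12 * N * (N - L * K)
      lem = solve-∀

open Finitary

-- Translation between rational and integer inequalities

toℚᵘ-difference : ∀ {p q P Q} → ℚ.toℚᵘ p ℚᵘ.≃ P → ℚ.toℚᵘ q ℚᵘ.≃ Q → ℚ.toℚᵘ (p ℚ.- q) ℚᵘ.≃ P ℚᵘ.- Q
toℚᵘ-difference {p} {q} p≃P q≃Q = ℚᵘ.≃-trans (ℚ.toℚᵘ-homo-+ p (ℚ.- q))
  (ℚᵘ.+-cong p≃P (ℚᵘ.≃-trans (ℚ.toℚᵘ-homo‿- q) (ℚᵘ.-‿cong q≃Q)))

p≤∣p∣ : ∀ p → p ℚ.≤ ℚ.∣ p ∣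
p≤∣p∣ (mkℚ (+ _)       _ _) = ℚ.≤-refl
p≤∣p∣ (mkℚ ℤ.-[1+ _ ] _ _) = ℚ.*≤* ℤ.-≤+

-- Only the upper half of the absolute value is kept, in non-strict form, since `∑-value-bound` asks
-- for nothing but upper bounds on the counts.
difference<⇒ : ∀ {p q r} o c f e → ℚ.toℚᵘ p ℚᵘ.≃ mkℚᵘ (+ o) c → ℚ.toℚᵘ q ℚᵘ.≃ mkℚᵘ (+ 1) f → ℚ.toℚᵘ r ℚᵘ.≃ mkℚᵘ
    (+ 1) e →
  ℚ.∣ p ℚ.- q ∣ ℚ.< r → (+ o * + suc f - + suc c) * + suc e ≤ + suc c * + suc f
difference<⇒ {p} {q} o c f e p≃ q≃ r≃ close =
  subst₂ _≤_ (lem (+ o) (+ suc c) (+ suc f) (+ suc e)) (trans (ℤ.*-identityˡ _) (ℤ.pos-* (suc c) (suc f)))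
    (ℤ.<⇒≤ (ℚᵘ.drop-*<* (ℚᵘ.<-respʳ-≃ r≃ (ℚᵘ.<-respˡ-≃ (toℚᵘ-difference p≃ q≃)
      (ℚ.toℚᵘ-mono-< (ℚ.≤-<-trans (p≤∣p∣ (p ℚ.- q)) close))))))
  where
  lem : ∀ o c f e → (o * f + (- 1ℤ) * c) * e ≡ (o * f - c) * e
  lem = solve-∀

-- Aiming at two thirds of the accuracy leaves room for the strict inequality. Here `p` will be the
-- numerator of ε, and as it is at least 1 the accuracy depends on the denominator alone.
strict-third : ∀ {x y p} → 1ℤ ≤ y → 1ℤ ≤ p → + 3 * x ≤ + 2 * y → x ℤ.< p * y
strict-third {x} {y} {p} 1≤y 1≤p 3x≤2y = ℤ.≰⇒> (λ py≤x → contradiction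
  (ℤ.≤-trans 1≤y (≤-by-gap (lem x y p) (nonneg-+ (nonneg-+ (gap 3x≤2y) (nonneg-* {+ 3} nonneg-pos (gap py≤x)))
    (nonneg-* {+ 3} nonneg-pos (nonneg-* (gap 1≤p) (ℤ.≤-trans nonneg-pos 1≤y))))))
  (ℤ.<⇒≱ (ℤ.+<+ (ℕ.s≤s ℕ.z≤n))))
  where
  lem : ∀ x y p → 0ℤ - y ≡ (+ 2 * y - + 3 * x) + + 3 * (x - p * y) + + 3 * ((p - 1ℤ) * y)
  lem = solve-∀

⇒difference< : ∀ {p q} o c f u d .(cop : Coprime (suc u) (suc d)) → ℚ.toℚᵘ p ℚᵘ.≃ mkℚᵘ (+ o) c → ℚ.toℚᵘ q ℚᵘ.≃ mkℚᵘ
    (+ 1) f →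
  + 3 * + suc d * (+ suc f * + o - + suc c) ≤ + 2 * (+ suc f * + suc c) →
  + 3 * + suc d * (+ suc c - + suc f * + o) ≤ + 2 * (+ suc f * + suc c) →
  ℚ.∣ p ℚ.- q ∣ ℚ.< mkℚ (+ suc u) d cop
⇒difference< {p} {q} o c f u d cop p≃ q≃ upper lower = conclude (ℚ.∣p∣≡p∨∣p∣≡-p x)
  where
  x = p ℚ.- q
  ε = mkℚ (+ suc u) d cop
  strict : ∀ z → + 3 * + suc d * z ≤ + 2 * (+ suc f * + suc c) → + suc d * z ℤ.< + suc u * (+ suc f * + suc c)
  strict z bound = strict-third {+ suc d * z} {+ suc f * + suc c} {+ suc u}
    (*-mono {1ℤ} {+ suc f} {1ℤ} {+ suc c} nonneg-pos nonneg-pos (+≤+ (ℕ.s≤s ℕ.z≤n)) (+≤+ (ℕ.s≤s ℕ.z≤n))) (+≤+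
        (ℕ.s≤s ℕ.z≤n))
    (subst (_≤ + 2 * (+ suc f * + suc c)) (ℤ.*-assoc (+ 3) (+ suc d) z) bound)
  denominators : + suc u * (+ suc f * + suc c) ≡ + suc u * + (suc c ℕ.* suc f)
  denominators = cong (λ z → + suc u * z) (trans (ℤ.*-comm (+ suc f) (+ suc c)) (sym (ℤ.pos-* (suc c) (suc f))))
  lem₁ : ∀ d o c f → d * (f * o - c) ≡ (o * f + (- 1ℤ) * c) * d
  lem₁ = solve-∀
  lem₂ : ∀ d o c f → d * (c - f * o) ≡ (- (o * f + (- 1ℤ) * c)) * d
  lem₂ = solve-∀
  conclude : ℚ.∣ x ∣ ≡ x ⊎ ℚ.∣ x ∣ ≡ ℚ.- x → ℚ.∣ x ∣ ℚ.< ε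
  conclude (inj₁ eq) = subst (ℚ._< ε) (sym eq) (ℚ.toℚᵘ-cancel-<
    (ℚᵘ.<-respˡ-≃ (ℚᵘ.≃-sym (toℚᵘ-difference p≃ q≃)) (ℚᵘ.*<*
      (subst₂ ℤ._<_ (lem₁ (+ suc d) (+ o) (+ suc c) (+ suc f)) denominators (strict (+ suc f * + o - + suc c) upper)))))
  conclude (inj₂ eq) = subst (ℚ._< ε) (sym eq) (ℚ.toℚᵘ-cancel-<
    (ℚᵘ.<-respˡ-≃ (ℚᵘ.≃-sym (ℚᵘ.≃-trans (ℚ.toℚᵘ-homo‿- x) (ℚᵘ.-‿cong (toℚᵘ-difference p≃ q≃)))) (ℚᵘ.*<*
      (subst₂ ℤ._<_ (lem₂ (+ suc d) (+ o) (+ suc c) (+ suc f)) denominators (strict (+ suc c - + suc f * + o) lower)))))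

toℚᵘ-/ : ∀ m n .{{_ : NonZero n}} {n-1} → n ≡ suc n-1 → ℚ.toℚᵘ (+ m ℚ./ n) ℚᵘ.≃ mkℚᵘ (+ m) n-1
toℚᵘ-/ m (suc n) refl = ℚ.toℚᵘ-fromℚᵘ (mkℚᵘ (+ m) n)

toℚᵘ-t : ∀ {k n c} (π : Perm k) (τ : Perm n) → n C k ≡ suc c → ℚ.toℚᵘ (t π τ) ℚᵘ.≃ mkℚᵘ (+ occurrences π τ) c
toℚᵘ-t {k} {n} π τ eq with n C k | eq
... | suc c | refl = toℚᵘ-/ (occurrences π τ) (suc c) refl

density-close : ∀ {k n} (π : Perm k) (τ : Perm n) u d .(cop : Coprime (suc u) (suc d)) →
  let f = + (k !); c = + (n C k); o = + occurrences π τ in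
  1ℤ ≤ c × (+ 3 * + suc d * (f * o - c) ≤ + 2 * (f * c)) × (+ 3 * + suc d * (c - f * o) ≤ + 2 * (f * c)) →
  ℚ.∣ t π τ ℚ.- inv! k ∣ ℚ.< mkℚ (+ suc u) d cop
density-close {k} {n} π τ u d cop (1≤c , upper , lower) =
  generalise (n C k) (k !) refl refl 1≤c (+≤+ (ℕ.1≤n! k)) upper lower
  where
  -- The binomial and the factorial are abstracted so that they can be matched as successors, the
  -- form in which `mkℚᵘ` takes denominators.
  generalise : ∀ c f → n C k ≡ c → k ! ≡ f → 1ℤ ≤ + c → 1ℤ ≤ + f →
    + 3 * + suc d * (+ f * + occurrences π τ - + c) ≤ + 2 * (+ f * + c) →
    + 3 * + suc d * (+ c - + f * + occurrences π τ) ≤ + 2 * (+ f * + c) →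
    ℚ.∣ t π τ ℚ.- inv! k ∣ ℚ.< mkℚ (+ suc u) d cop
  generalise zero    _       _  _   (+≤+ ()) _ _ _
  generalise (suc c) zero    _  _   _ (+≤+ ()) _ _
  generalise (suc c) (suc f) eq eq! _ _ upper lower =
    ⇒difference< (occurrences π τ) c f u d cop (toℚᵘ-t π τ eq) (toℚᵘ-/ 1 (k !) {{k ℕ.!≢0}} eq!) upper lower

-- 576 is 24²: one factor 24 from the limit 1/24, the other from `24 C(n,4) ≤ n⁴`.
density⇒occurrences : ∀ {n} (τ : Perm n) (π : Perm 4) e → ℚ.∣ t π τ ℚ.- inv! 4 ∣ ℚ.< + 1 ℚ./ suc e → let N = + n in
  (+ 576 * + suc e) * + occurrences π τ ≤ (+ suc e + + 24) * (N * N * N * N)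
density⇒occurrences {n} τ π e close = ≤-by-gap (lem (+ 24) (+ suc e) (+ occurrences π τ) c N)
  (nonneg-+ (nonneg-* {+ 24} nonneg-pos (gap (scaled (n C 4) refl)))
            (nonneg-* {+ suc e + + 24} (nonneg-pos {suc e ℕ.+ 24}) (gap (falling≤power n 4))))
  where
  N = + n
  c = + (n C 4)
  scaled : ∀ m → n C 4 ≡ m → + 24 * + suc e * + occurrences π τ ≤ (+ suc e + + 24) * + (n C 4)
  -- Here `t` has its dummy value and `close` carries no information, but there is no 4-subset and
  -- hence no occurrence.
  scaled zero eq = subst₂ _≤_ (sym (trans (cong (λ z → + 24 * + suc e * z) occ≡0) (ℤ.*-zeroʳ (+ 24 * + suc e))))
    (sym (trans (cong (λ z → (+ suc e + + 24) * + z) eq) (ℤ.*-zeroʳ (+ suc e + + 24)))) ℤ.≤-refl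
    where
    occ≡0 : + occurrences π τ ≡ 0ℤ
    occ≡0 = ℤ.≤-antisym (subst (λ z → + occurrences π τ ≤ + z) eq (occurrences≤C π τ)) nonneg-pos
  scaled (suc m) eq = ≤-by-gap (trans (cong (λ z → (+ suc e + + 24) * + z - + 24 * + suc e * + occurrences π τ) eq)
                                    (rearrange (+ suc e) (+ occurrences π τ) (+ suc m)))
    (gap (difference<⇒ (occurrences π τ) m 23 e (toℚᵘ-t π τ eq) (toℚᵘ-/ 1 24 refl) (toℚᵘ-/ 1 (suc e) refl) close))
    where
    rearrange : ∀ e o c → (e + + 24) * c - + 24 * e * o ≡ c * + 24 - (o * + 24 - c) * e
    rearrange = solve-∀
  lem : ∀ a e o c N → (e + + 24) * (N * N * N * N) - (a * a * e) * o ≡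
        a * ((e + + 24) * c - a * e * o) + (e + + 24) * (N * (N * (N * (N * 1ℤ))) - a * c)
  lem = solve-∀

-- Uniformity over S₄

Eventually : (ℕ → Set) → Set
Eventually P = ∃[ N ] ∀ j → j ≥ N → P j

eventually-Fin : ∀ {m} {P : Fin m → ℕ → Set} → (∀ x → Eventually (P x)) → Eventually (λ j → ∀ x → P x j)
eventually-Fin {zero}  ev = 0 , λ _ _ ()
eventually-Fin {suc m} ev with N₀ , h₀ ← ev zero | N₁ , h₁ ← eventually-Fin (ev ∘ suc) =
  N₀ ⊔ N₁ , λ j j≥ → λ where
    zero    → h₀ j (ℕ.≤-trans (ℕ.m≤m⊔n N₀ N₁) j≥)
    (suc x) → h₁ j (ℕ.≤-trans (ℕ.m≤n⊔m N₀ N₁) j≥) x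

eventually-Vec : ∀ {m} k {P : Vec (Fin m) k → ℕ → Set} → (∀ xs → Eventually (P xs)) → Eventually (λ j → ∀ xs → P xs j)
eventually-Vec zero    ev with N , h ← ev [] = N , λ { j j≥ [] → h j j≥ }
eventually-Vec (suc k) ev with N , h ← eventually-Fin (λ x → eventually-Vec k (λ xs → ev (x ∷ xs))) =
  N , λ { j j≥ (x ∷ xs) → h j j≥ x xs }

-- Without function extensionality Perm k is not finite up to _≡_, so permutations are enumerated by their value tables.
eventually-Perm : ∀ {k} {P : Perm k → ℕ → Set} →
  (∀ {π ρ j} → (∀ i → π ⟨$⟩ʳ i ≡ ρ ⟨$⟩ʳ i) → P π j → P ρ j) →
  (∀ π → Eventually (P π)) → Eventually (λ j → ∀ π → P π j)
eventually-Perm {k} {P} resp ev =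
  proj₁ tables , λ j j≥ π → proj₂ tables j j≥ (tabulate (π ⟨$⟩ʳ_)) π (λ i → sym (Vec.lookup∘tabulate (π ⟨$⟩ʳ_) i))
  where
  table : ∀ s → Eventually (λ j → ∀ π → (∀ i → π ⟨$⟩ʳ i ≡ lookup s i) → P π j)
  table s with distinct s in eq
  ... | true with N , h ← ev (fromInjective (lookup s) (distinct-true s eq)) =
    N , λ j j≥ π π≗s → resp (λ i → sym (π≗s i)) (h j j≥)
  ... | false = 0 , λ j _ π π≗s → contradiction eq (true≢false (distinct-intro s (λ {i} {i′} si≡si′ →
    trans (sym (Perm.inverseˡ π)) (trans (cong (π ⟨$⟩ˡ_) (trans (π≗s i) (trans si≡si′ (sym (π≗s i′)))))
        (Perm.inverseˡ π)))))
  tables = eventually-Vec k table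

-- From the finitary estimate to convergence

module _ (τ : PermSeq) (diverge : LengthsDiverge τ) (quasi : (π : Perm 4) → DensityTendsTo π τ (inv! 4)) where

  Balanced : ℕ → Perm 4 → ℕ → Set
  Balanced E ρ j = let N = + len τ j in
    (+ 576 * + E) * + occurrences ρ (proj₂ (τ j)) ≤ (+ E + + 24) * (N * N * N * N)

  eventually-balanced : ∀ e → Eventually (λ j → ∀ ρ → Balanced (suc e) ρ j)
  eventually-balanced e = eventually-Perm
    (λ {ρ} {ρ′} {j} ρ≗ρ′ → subst (λ z → (+ 576 * + suc e) * + z ≤ (+ suc e + + 24) *
        (+ len τ j * + len τ j * + len τ j * + len τ j))
      (occurrences-cong {π = ρ} {ρ′} (proj₂ (τ j)) ρ≗ρ′))
    balanced
    where
    balanced : ∀ ρ → Eventually (Balanced (suc e) ρ)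
    balanced ρ with N , close ← quasi ρ (+ 1 ℚ./ suc e) (ℚ.positive⁻¹ (+ 1 ℚ./ suc e) {{ℚ.normalize-pos 1 (suc e)}}) =
      N , λ j j≥ → density⇒occurrences (proj₂ (τ j)) ρ e (close j j≥)

  density-converges : ∀ {k} → 1 ℕ.≤ k → (π : Perm k) → ∀ u d .(cop : Coprime (suc u) (suc d)) → ∀ {K J e M} → 1 ℕ.≤ K →
    + K ≡ + 72 * + k * + (k !) * + suc d → J ≡ + 2 * + K → + suc e ≡ + 42 * (J * J * J * J) → + M ≡ + 3 * + suc d *
        (+ k * + k) →
    Eventually (λ j → ℚ.∣ t π (proj₂ (τ j)) ℚ.- inv! k ∣ ℚ.< mkℚ (+ suc u) d cop)
  density-converges {k} 1≤k π u d cop {K} {J} {e} {M} 1≤K K≡ J≡ E≡ M≡ = N₁ ⊔ N₂ , converges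
    where
    E = suc e
    -- A single length threshold covers the three requirements `K ≤ n`, `E ≤ n` and
    -- `3 q k² = M ≤ n`.
    threshold = diverge (K ℕ.+ (E ℕ.+ M))
    balanced = eventually-balanced e
    N₁ = proj₁ threshold
    N₂ = proj₁ balanced
    converges : ∀ j → j ≥ N₁ ⊔ N₂ → ℚ.∣ t π (proj₂ (τ j)) ℚ.- inv! k ∣ ℚ.< mkℚ (+ suc u) d cop
    converges j j≥ = density-close π (proj₂ (τ j)) u d cop
      (finitary-quasirandomness (proj₂ (τ j)) π 1≤k {suc d} (ℕ.s≤s ℕ.z≤n) {K} {E} {J} 1≤K (ℕ.s≤s ℕ.z≤n) K≡ J≡ E≡
        (ℕ.≤-trans (ℕ.m≤m+n K (E ℕ.+ M)) n≥)
        (ℕ.≤-trans (ℕ.≤-trans (ℕ.m≤m+n E M) (ℕ.m≤n+m (E ℕ.+ M) K)) n≥)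
        (subst (_≤ + len τ j) M≡ (+≤+ (ℕ.≤-trans (ℕ.≤-trans (ℕ.m≤n+m M E) (ℕ.m≤n+m (E ℕ.+ M) K)) n≥)))
        (proj₂ balanced j (ℕ.≤-trans (ℕ.m≤n⊔m N₁ N₂) j≥)))
      where
      n≥ = proj₂ threshold j (ℕ.≤-trans (ℕ.m≤m⊔n N₁ N₂) j≥)

theorem1 : (τ : PermSeq) → LengthsDiverge τ →
    ((π : Perm 4) → DensityTendsTo π τ (inv! 4)) →
    (k : ℕ) → k ≥ 1 → (π : Perm k) → DensityTendsTo π τ (inv! k)
theorem1 τ diverge quasi k 1≤k π (mkℚ (+ zero) d _) (ℚ.*<* (ℤ.+<+ ()))
theorem1 τ diverge quasi k 1≤k π (mkℚ (ℤ.-[1+ _ ]) d _) (ℚ.*<* ())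
theorem1 τ diverge quasi k 1≤k π (mkℚ (+ suc u) d cop) _ = chooseK (positive⇒suc 1≤72kfq)
  where
  1≤* : ∀ {a b} → 1ℤ ≤ a → 1ℤ ≤ b → 1ℤ ≤ a * b
  1≤* {a} {b} = *-mono {1ℤ} {a} {1ℤ} {b} nonneg-pos nonneg-pos
  1≤suc : ∀ {m} → 1ℤ ≤ + suc m
  1≤suc = +≤+ (ℕ.s≤s ℕ.z≤n)
  1≤72kfq : 1ℤ ≤ + 72 * + k * + (k !) * + suc d
  1≤72kfq = 1≤* {+ 72 * + k * + (k !)} {+ suc d} (1≤* {+ 72 * + k} {+ (k !)} (1≤* {+ 72} {+ k} 1≤suc (+≤+ 1≤k)) (+≤+
      (ℕ.1≤n! k))) 1≤suc
  Goal : Set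
  Goal = Eventually (λ j → ℚ.∣ t π (proj₂ (τ j)) ℚ.- inv! k ∣ ℚ.< mkℚ (+ suc u) d cop)
  chooseE : ∀ {K J} → 1 ℕ.≤ K → + K ≡ + 72 * + k * + (k !) * + suc d → J ≡ + 2 * + K → 1ℤ ≤ J → Goal
  chooseE {K} {J} 1≤K K≡ J≡ 1≤J with e , E≡ ← positive⇒suc (1≤* {+ 42} {J * J * J * J} 1≤suc (1≤* {J * J * J} {J}
      (1≤* {J * J} {J} (1≤* {J} {J} 1≤J 1≤J) 1≤J) 1≤J)) =
    density-converges τ diverge quasi 1≤k π u d cop 1≤K K≡ J≡ E≡
      -- This equation also fixes the implicit `M`, as the absolute value of `3 (d+1) k²`.
      (ℤ.0≤i⇒+∣i∣≡i (nonneg-* {+ 3 * + suc d} nonneg-pos (nonneg-square (+ k))))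
  chooseK : ∃[ K-1 ] + suc K-1 ≡ + 72 * + k * + (k !) * + suc d → Goal
  chooseK (K-1 , K≡) = chooseE (ℕ.s≤s ℕ.z≤n) K≡ refl (1≤* {+ 2} {+ suc K-1} 1≤suc 1≤suc)
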